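{- The only rational points $(x,y) \in \mathbb{Q}^2$ on the curve \[ y^2 = 8x^6 - 12x^4 - 4x^3 + 4x^2 + 4x + 1 \] are those with $x \in \{ -2,-1,0,1\}$. -}

module Defs where

open import Data.Integer using (+_)
open import Data.Rational using (ℚ; _+_; _*_; _-_; _/_; -_)

q : Data.Integer.ℤ → ℚ
q z = z / 1

f : ℚ → ℚ
f x = q (+ 8) * (x * x * x * x * x * x)
      - q (+ 12) * (x * x * x * x)
      - q (+ 4) * (x * x * x)
      + q (+ 4) * (x * x)
      + q (+ 4) * x
      + q (+ 1)

{-# OPTIONS --safe #-}
-- Over the cubic field ℚ(θ), θ³ = θ + 1, the sextic is the norm of G = 2θ x² + 2θ² x + 1.
-- ℤ[θ] is Euclidean with units ± θⁿ, so a rational point a / b yields G(a, b) = τ w² with τ = 1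
-- or τ = θ. Relative to a known point x₀ with the same τ, the point then gives a solution
-- (r, t), t proportional to a - x₀ b, of
--     M² = r⁴ + 4 μ τ r² t² + 4 π τ² t⁴,
-- that is, a point of an elliptic curve over ℚ(θ) of rank 2; since a and b are rational, the
-- 2-adic direction of t / r is prescribed modulo 2. Two 2-isogeny descents halve the point and
-- the 2-adic size of t without changing its direction, unless the halved point lies in the class
-- of - π, the only other one that is trivial at 2. That class, and the trivial class once t is
-- odd, contain no point with the prescribed direction, so the descent forces t = 0.
module Submission where

open import Algebra.Bundles using (CommutativeRing)
import Algebra.Solver.Ring.AlmostCommutativeRing as ACR
import Algebra.Solver.Ring.Simple as RingSolver
open import Data.Empty using (⊥; ⊥-elim)
open import Data.Fin.Base using (Fin; toℕ; fromℕ<)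
open import Data.Fin.Patterns using (0F; 1F; 2F; 3F; 4F; 5F; 6F; 7F; 8F)
open import Data.Fin.Properties using (all?; any?; toℕ-fromℕ<)
open import Data.Integer.Base as ℤ using (ℤ; -[1+_]) renaming (∣_∣ to abs)
open import Data.Integer.DivMod using (_%ℕ_; _/ℕ_; a≡a%ℕn+[a/ℕn]*n; n%ℕd<d)
import Data.Integer.Divisibility.Signed as ℤ∣
import Data.Integer.Properties as ℤₚ
open import Data.Integer.Solver using (module +-*-Solver)
open import Data.Nat.Base as ℕ using (ℕ; zero; suc; z≤n; s≤s; NonZero)
open import Data.Nat.Coprimality using (coprime?; coprime-Bézout)
open import Data.Nat.Divisibility using (divides)
open import Data.Nat.GCD using () renaming (module Bézout to ℕ-Bézout)
open import Data.Nat.Induction using (<-wellFounded)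
open import Data.Nat.Primality using (Prime; prime?; prime⇒irreducible)
import Data.Nat.Properties as ℕₚ
import Data.Nat.Solver as ℕ-Solver
open import Data.Product using (_,_; _×_; ∃; ∃₂; ∃-syntax; proj₁; proj₂)
import Data.Rational.Properties as ℚₚ
open import Data.Rational.Solver renaming (module +-*-Solver to ℚ-Solver)
open import Data.Rational.Unnormalised.Base as ℚᵘ using (mkℚᵘ; *≡*)
import Data.Rational.Unnormalised.Properties as ℚᵘₚ
open import Data.Sum as Sum using (inj₁; inj₂; [_,_]′)
open import Data.Vec.Base using (Vec; []; _∷_)
open import Function using (_∘_; id)
open import Induction.WellFounded using (Acc; acc)
open import Level using (0ℓ)
open import Relation.Binary.PropositionalEquality using (_≢_; refl; sym; trans; cong; cong₂; subst; subst₂; isEquivalence; module ≡-Reasoning)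
open import Relation.Nullary using (Dec; yes; no; ¬_; contradiction; ¬?)
open import Relation.Nullary.Decidable using (from-yes; from-no; _⊎-dec_; _×-dec_; _→-dec_; map′; recompute)

open import Data.Integer using (+_)
open import Data.Sum using (_⊎_)
open import Relation.Binary.PropositionalEquality using (_≡_)

open ≡-Reasoning
open +-*-Solver using (Polynomial; var) renaming
  (⟦_⟧ to eval; ⟦_⟧↓ to eval↓; solve to ℤ-solve; prove to ℤ-prove; _:+_ to _⊕_; _:*_ to _⊗_; _:-_ to
  _⊖_; :-_ to ⊝_; _:=_ to _⊜_; con to K)
open ℕ-Solver.+-*-Solver using () renaming (solve to ℕ-solve; _:+_ to _⊞_; _:*_ to _⊠_; _:=_ to _≜_;
  con to κ)

-- The elliptic curve has infinitely many points, so a descent by itself meets no contradiction;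
-- what can be excluded is a direction. Rationality supplies it: the odd part of a rational integer
-- is 1 modulo 2, while the residue field of the inert prime 2 has seven nonzero elements. Both
-- isogenies respect the resulting congruence between t and r, and one round lowers the exponent of
-- 2 in t by one. Once t is odd, the congruence produces a root of X² + X + θ³ over the field of 8
-- elements, where θ³ has trace 1. The algebra rests on μ² = θ³ + π. It makes (r² + 2 μ τ t² ± M) /
-- 2 two factors with product θ³ τ² t⁴, a unit times a fourth power. On the isogenous curve θ³ and π
-- change places, so there the prime π of norm 23 has to go to one of two factors, whence two
-- classes. Other unit classes die because among 1, - 1, θ, - θ only 1 is a square modulo 4. The
-- class of - π passes this test, since - π ≡ θ² modulo 4, and needs the conic of `pi-impossible`.

infix 9 #_

#_ : ∀ {n} → ℕ → Polynomial n
# m = K (+ m)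

oddᵖ evenᵖ : ∀ {n} → Polynomial n → Polynomial n
oddᵖ x  = # 1 ⊕ # 2 ⊗ x
evenᵖ x = # 0 ⊕ # 2 ⊗ x

-- The ring ℤ[θ], its norm and its conjugates

module Arithmetic where

  infixl 6 _+_ _-_
  infixl 7 _*_
  infix  8 -_

  data ℤ[θ] : Set where
    ⟨_,_,_⟩ : (p q r : ℤ) → ℤ[θ]

  _+_ : ℤ[θ] → ℤ[θ] → ℤ[θ]
  ⟨ a , b , c ⟩ + ⟨ p , q , r ⟩ = ⟨ a ℤ.+ p , b ℤ.+ q , c ℤ.+ r ⟩

  _*_ : ℤ[θ] → ℤ[θ] → ℤ[θ]
  ⟨ a , b , c ⟩ * ⟨ p , q , r ⟩ =
    ⟨ a ℤ.* p ℤ.+ (b ℤ.* r ℤ.+ c ℤ.* q)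
    , a ℤ.* q ℤ.+ b ℤ.* p ℤ.+ (b ℤ.* r ℤ.+ c ℤ.* q) ℤ.+ c ℤ.* r
    , a ℤ.* r ℤ.+ b ℤ.* q ℤ.+ c ℤ.* p ℤ.+ c ℤ.* r ⟩

  -_ : ℤ[θ] → ℤ[θ]
  - ⟨ a , b , c ⟩ = ⟨ ℤ.- a , ℤ.- b , ℤ.- c ⟩

  _-_ : ℤ[θ] → ℤ[θ] → ℤ[θ]
  x - y = x + (- y)

  ι : ℤ → ℤ[θ]
  ι n = ⟨ n , + 0 , + 0 ⟩

  0# 1# θ : ℤ[θ]
  0# = ι (+ 0)
  1# = ι (+ 1)
  θ  = ⟨ + 0 , + 1 , + 0 ⟩

  ⟨⟩-cong : ∀ {a b c p q r} → a ≡ p → b ≡ q → c ≡ r → ⟨ a , b , c ⟩ ≡ ⟨ p , q , r ⟩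
  ⟨⟩-cong refl refl refl = refl

  +-assoc : ∀ x y z → (x + y) + z ≡ x + (y + z)
  +-assoc ⟨ a , b , c ⟩ ⟨ p , q , r ⟩ ⟨ s , t , u ⟩ =
    ⟨⟩-cong (ℤₚ.+-assoc a p s) (ℤₚ.+-assoc b q t) (ℤₚ.+-assoc c r u)

  +-comm : ∀ x y → x + y ≡ y + x
  +-comm ⟨ a , b , c ⟩ ⟨ p , q , r ⟩ =
    ⟨⟩-cong (ℤₚ.+-comm a p) (ℤₚ.+-comm b q) (ℤₚ.+-comm c r)

  +-identityˡ : ∀ x → 0# + x ≡ x
  +-identityˡ ⟨ a , b , c ⟩ =
    ⟨⟩-cong (ℤₚ.+-identityˡ a) (ℤₚ.+-identityˡ b) (ℤₚ.+-identityˡ c)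

  +-identityʳ : ∀ x → x + 0# ≡ x
  +-identityʳ x = trans (+-comm x 0#) (+-identityˡ x)

  -‿inverseˡ : ∀ x → - x + x ≡ 0#
  -‿inverseˡ ⟨ a , b , c ⟩ =
    ⟨⟩-cong (ℤₚ.+-inverseˡ a) (ℤₚ.+-inverseˡ b) (ℤₚ.+-inverseˡ c)

  -‿inverseʳ : ∀ x → x + (- x) ≡ 0#
  -‿inverseʳ x = trans (+-comm x (- x)) (-‿inverseˡ x)

  -- Reified coordinate formulas, so that an identity between triples of integers is solved
  -- without writing out its three coordinates.
  infixl 6 _+ᵖ_
  infixl 7 _*ᵖ_

  record Triple (n : ℕ) : Set where
    constructor ⟪_,_,_⟫
    field #₀ #₁ #₂ : Polynomial n

  open Triple public

  _+ᵖ_ _*ᵖ_ : ∀ {n} → Triple n → Triple n → Triple n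
  ⟪ a , b , c ⟫ +ᵖ ⟪ p , q , r ⟫ = ⟪ a ⊕ p , b ⊕ q , c ⊕ r ⟫
  ⟪ a , b , c ⟫ *ᵖ ⟪ p , q , r ⟫ =
    ⟪ a ⊗ p ⊕ (b ⊗ r ⊕ c ⊗ q)
    , a ⊗ q ⊕ b ⊗ p ⊕ (b ⊗ r ⊕ c ⊗ q) ⊕ c ⊗ r
    , a ⊗ r ⊕ b ⊗ q ⊕ c ⊗ p ⊕ c ⊗ r ⟫

  ιᵖ : ∀ {n} → Polynomial n → Triple n
  ιᵖ a = ⟪ a , # 0 , # 0 ⟫

  1ᵖ θᵖ ρᵖ : ∀ {n} → Triple n
  1ᵖ = ιᵖ (# 1)
  θᵖ = ⟪ # 0 , # 1 , # 0 ⟫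
  ρᵖ = ⟪ K -[1+ 0 ] , # 0 , # 1 ⟫

  Xᵖ : ∀ {n} → Triple (3 ℕ.+ n)
  Xᵖ = ⟪ var 0F , var 1F , var 2F ⟫

  Yᵖ : ∀ {n} → Triple (6 ℕ.+ n)
  Yᵖ = ⟪ var 3F , var 4F , var 5F ⟫

  Zᵖ : ∀ {n} → Triple (9 ℕ.+ n)
  Zᵖ = ⟪ var 6F , var 7F , var 8F ⟫

  evalᵗ : ∀ {n} → Triple n → Vec ℤ n → ℤ[θ]
  evalᵗ ⟪ a , b , c ⟫ xs = ⟨ eval a xs , eval b xs , eval c xs ⟩

  coordinatewise : ∀ {n} (x y : Triple n) (xs : Vec ℤ n) → eval↓ (#₀ x) xs ≡ eval↓ (#₀ y) xs →
    eval↓ (#₁ x) xs ≡ eval↓ (#₁ y) xs → eval↓ (#₂ x) xs ≡ eval↓ (#₂ y) xs → evalᵗ x xs ≡ evalᵗ y xs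
  coordinatewise x y xs e₀ e₁ e₂ =
    ⟨⟩-cong (ℤ-prove xs (#₀ x) (#₀ y) e₀) (ℤ-prove xs (#₁ x) (#₁ y) e₁)
      (ℤ-prove xs (#₂ x) (#₂ y) e₂)

  *-comm : ∀ x y → x * y ≡ y * x
  *-comm ⟨ a , b , c ⟩ ⟨ p , q , r ⟩ =
    coordinatewise (Xᵖ *ᵖ Yᵖ) (Yᵖ *ᵖ Xᵖ) (a ∷ b ∷ c ∷ p ∷ q ∷ r ∷ []) refl refl refl

  *-identityˡ : ∀ x → 1# * x ≡ x
  *-identityˡ ⟨ a , b , c ⟩ = coordinatewise (1ᵖ *ᵖ Xᵖ) Xᵖ (a ∷ b ∷ c ∷ []) refl refl refl

  *-identityʳ : ∀ x → x * 1# ≡ x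
  *-identityʳ x = trans (*-comm x 1#) (*-identityˡ x)

  *-distribˡ-+ : ∀ x y z → x * (y + z) ≡ x * y + x * z
  *-distribˡ-+ ⟨ a , b , c ⟩ ⟨ p , q , r ⟩ ⟨ s , t , u ⟩ =
    coordinatewise (Xᵖ *ᵖ (Yᵖ +ᵖ Zᵖ)) (Xᵖ *ᵖ Yᵖ +ᵖ Xᵖ *ᵖ Zᵖ)
      (a ∷ b ∷ c ∷ p ∷ q ∷ r ∷ s ∷ t ∷ u ∷ []) refl refl refl

  *-distribʳ-+ : ∀ x y z → (y + z) * x ≡ y * x + z * x
  *-distribʳ-+ x y z =
    trans (*-comm (y + z) x) (trans (*-distribˡ-+ x y z) (cong₂ _+_ (*-comm x y) (*-comm x z)))

  *-assoc : ∀ x y z → (x * y) * z ≡ x * (y * z)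
  *-assoc ⟨ a , b , c ⟩ ⟨ p , q , r ⟩ ⟨ s , t , u ⟩ =
    coordinatewise (Xᵖ *ᵖ Yᵖ *ᵖ Zᵖ) (Xᵖ *ᵖ (Yᵖ *ᵖ Zᵖ))
      (a ∷ b ∷ c ∷ p ∷ q ∷ r ∷ s ∷ t ∷ u ∷ []) refl refl refl

  ℤ[θ]-commutativeRing : CommutativeRing 0ℓ 0ℓ
  ℤ[θ]-commutativeRing = record
    { Carrier = ℤ[θ] ; _≈_ = _≡_ ; _+_ = _+_ ; _*_ = _*_ ; -_ = -_ ; 0# = 0# ; 1# = 1#
    ; isCommutativeRing = record
      { isRing = record
        { +-isAbelianGroup = record
          { isGroup = record
            { isMonoid = record
              { isSemigroup = record
                { isMagma = record { isEquivalence = isEquivalence ; ∙-cong = cong₂ _+_ }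
                ; assoc = +-assoc }
              ; identity = +-identityˡ , +-identityʳ }
            ; inverse = -‿inverseˡ , -‿inverseʳ
            ; ⁻¹-cong = cong (-_) }
          ; comm = +-comm }
        ; *-cong = cong₂ _*_
        ; *-assoc = *-assoc
        ; *-identity = *-identityˡ , *-identityʳ
        ; distrib = *-distribˡ-+ , *-distribʳ-+ }
      ; *-comm = *-comm } }

  _≟_ : (x y : ℤ[θ]) → Dec (x ≡ y)
  ⟨ a , b , c ⟩ ≟ ⟨ p , q , r ⟩ with a ℤₚ.≟ p | b ℤₚ.≟ q | c ℤₚ.≟ r
  ... | yes refl | yes refl | yes refl = yes refl
  ... | no a≢p   | _        | _        = no λ { refl → a≢p refl }
  ... | _        | no b≢q   | _        = no λ { refl → b≢q refl }
  ... | _        | _        | no c≢r   = no λ { refl → c≢r refl }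

  module Solver = RingSolver (ACR.fromCommutativeRing ℤ[θ]-commutativeRing) _≟_
  open Solver using (solve; con; _:+_; _:*_; _:-_; :-_; _:=_)

  infixl 9 _²

  _² : ℤ[θ] → ℤ[θ]
  x ² = x * x

  infixl 9 _:²

  _:² : ∀ {n} → Solver.Polynomial n → Solver.Polynomial n
  x :² = x :* x

  -- `ρ` is the inverse of θ. The relation μ² = θ³ + π turns r⁴ + 4 μ τ r² t² + 4 π τ² t⁴ into (r² +
  -- 2 μ τ t²)² - 4 θ³ τ² t⁴, and in the same way R⁴ - 2 μ τ R² n² + θ³ τ² n⁴, the quartic of the
  -- isogenous curve, into (R² - μ τ n²)² - π τ² n⁴.
  2# 4# θ² θ³ θ⁴ ρ μ π : ℤ[θ]
  2# = ι (+ 2)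
  4# = ι (+ 4)
  θ² = θ * θ
  θ³ = θ² * θ
  θ⁴ = θ³ * θ
  ρ = ⟨ -[1+ 0 ] , + 0 , + 1 ⟩
  μ = ⟨ + 1 , + 2 , -[1+ 0 ] ⟩
  π = ⟨ -[1+ 3 ] , + 0 , + 3 ⟩

  infix 4 _∣_
  _∣_ : ℤ[θ] → ℤ[θ] → Set
  x ∣ y = ∃[ k ] y ≡ x * k

  norm : ℤ[θ] → ℤ
  norm ⟨ p , q , r ⟩ =
    p ℤ.* p ℤ.* p ℤ.+ q ℤ.* q ℤ.* q ℤ.+ r ℤ.* r ℤ.* r ℤ.+ + 2 ℤ.* p ℤ.* p ℤ.* r
    ℤ.+ p ℤ.* r ℤ.* r ℤ.- p ℤ.* q ℤ.* q ℤ.- q ℤ.* r ℤ.* r ℤ.- + 3 ℤ.* p ℤ.* q ℤ.* r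

  -- The product of the two other conjugates, which again lies in ℤ[θ].
  adj : ℤ[θ] → ℤ[θ]
  adj ⟨ p , q , r ⟩ =
    ⟨ p ℤ.* p ℤ.+ + 2 ℤ.* p ℤ.* r ℤ.+ r ℤ.* r ℤ.- q ℤ.* r ℤ.- q ℤ.* q
    , r ℤ.* r ℤ.- p ℤ.* q
    , q ℤ.* q ℤ.- p ℤ.* r ℤ.- r ℤ.* r ⟩

  normᵖ : ∀ {n} → Triple n → Polynomial n
  normᵖ ⟪ p , q , r ⟫ =
    p ⊗ p ⊗ p ⊕ q ⊗ q ⊗ q ⊕ r ⊗ r ⊗ r ⊕ # 2 ⊗ p ⊗ p ⊗ r
    ⊕ p ⊗ r ⊗ r ⊖ p ⊗ q ⊗ q ⊖ q ⊗ r ⊗ r ⊖ # 3 ⊗ p ⊗ q ⊗ r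

  adjᵖ : ∀ {n} → Triple n → Triple n
  adjᵖ ⟪ p , q , r ⟫ =
    ⟪ p ⊗ p ⊕ # 2 ⊗ p ⊗ r ⊕ r ⊗ r ⊖ q ⊗ r ⊖ q ⊗ q
    , r ⊗ r ⊖ p ⊗ q
    , q ⊗ q ⊖ p ⊗ r ⊖ r ⊗ r ⟫

  *-adj : ∀ x → x * adj x ≡ ι (norm x)
  *-adj ⟨ p , q , r ⟩ = coordinatewise (Xᵖ *ᵖ adjᵖ Xᵖ) (ιᵖ (normᵖ Xᵖ)) (p ∷ q ∷ r ∷ []) refl refl
    refl

  adj-* : ∀ x y → adj (x * y) ≡ adj x * adj y
  adj-* ⟨ a , b , c ⟩ ⟨ p , q , r ⟩ =
    coordinatewise (adjᵖ (Xᵖ *ᵖ Yᵖ)) (adjᵖ Xᵖ *ᵖ adjᵖ Yᵖ) (a ∷ b ∷ c ∷ p ∷ q ∷ r ∷ []) refl refl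
      refl

  ι-injective : ∀ {m n} → ι m ≡ ι n → m ≡ n
  ι-injective refl = refl

  ι-* : ∀ m n → ι (m ℤ.* n) ≡ ι m * ι n
  ι-* m n = coordinatewise (ιᵖ (var 0F ⊗ var 1F)) (ιᵖ (var 0F) *ᵖ ιᵖ (var 1F)) (m ∷ n ∷ []) refl
    refl refl

  norm-* : ∀ x y → norm (x * y) ≡ norm x ℤ.* norm y
  norm-* x y = ι-injective (begin
    ι (norm (x * y))              ≡⟨ *-adj (x * y) ⟨
    x * y * adj (x * y)           ≡⟨ cong (x * y *_) (adj-* x y) ⟩
    x * y * (adj x * adj y)       ≡⟨ rearrange x y (adj x) (adj y) ⟩
    x * adj x * (y * adj y)       ≡⟨ cong₂ _*_ (*-adj x) (*-adj y) ⟩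
    ι (norm x) * ι (norm y)       ≡⟨ ι-* (norm x) (norm y) ⟨
    ι (norm x ℤ.* norm y)         ∎)
    where
    rearrange : ∀ x y u v → x * y * (u * v) ≡ x * u * (y * v)
    rearrange = solve 4 (λ x y u v → x :* y :* (u :* v) := x :* u :* (y :* v)) refl

  -- Arithmetic modulo 2 and 4

  ι-*-⟨⟩ : ∀ m a b c → ι m * ⟨ a , b , c ⟩ ≡ ⟨ m ℤ.* a , m ℤ.* b , m ℤ.* c ⟩
  ι-*-⟨⟩ m a b c = coordinatewise (ιᵖ (var 3F) *ᵖ Xᵖ)
    ⟪ var 3F ⊗ var 0F , var 3F ⊗ var 1F , var 3F ⊗ var 2F ⟫
    (a ∷ b ∷ c ∷ m ∷ []) refl refl refl

  ι∣? : ∀ m z → Dec (ι m ∣ z)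
  ι∣? m ⟨ a , b , c ⟩ = map′ to from ((m ℤ∣.∣? a) ×-dec (m ℤ∣.∣? b) ×-dec (m ℤ∣.∣? c))
    where
    to : (m ℤ∣.∣ a) × (m ℤ∣.∣ b) × (m ℤ∣.∣ c) → ι m ∣ ⟨ a , b , c ⟩
    to (ℤ∣.divides p refl , ℤ∣.divides q refl , ℤ∣.divides r refl) = ⟨ p , q , r ⟩ ,
      trans (⟨⟩-cong (ℤₚ.*-comm p m) (ℤₚ.*-comm q m) (ℤₚ.*-comm r m)) (sym (ι-*-⟨⟩ m p q r))
    from : ι m ∣ ⟨ a , b , c ⟩ → (m ℤ∣.∣ a) × (m ℤ∣.∣ b) × (m ℤ∣.∣ c)
    from (⟨ p , q , r ⟩ , eq) with refl ← trans eq (ι-*-⟨⟩ m p q r) =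
      ℤ∣.divides p (ℤₚ.*-comm m p) , ℤ∣.divides q (ℤₚ.*-comm m q) , ℤ∣.divides r (ℤₚ.*-comm m r)

  parity : ∀ n → (∃[ k ] n ≡ + 0 ℤ.+ + 2 ℤ.* k) ⊎ (∃[ k ] n ≡ + 1 ℤ.+ + 2 ℤ.* k)
  parity n with n %ℕ 2 | n /ℕ 2 | a≡a%ℕn+[a/ℕn]*n n 2 | n%ℕd<d n 2
  ... | 0 | k | eq | _ = inj₁ (k , trans eq (cong (λ z → + 0 ℤ.+ z) (ℤₚ.*-comm k (+ 2))))
  ... | 1 | k | eq | _ = inj₂ (k , trans eq (cong (λ z → + 1 ℤ.+ z) (ℤₚ.*-comm k (+ 2))))
  ... | suc (suc _) | _ | _ | s≤s (s≤s ())

  1+2k≢0 : ∀ k → ¬ + 1 ℤ.+ + 2 ℤ.* k ≡ + 0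
  1+2k≢0 k eq = from-no (+ 2 ℤ∣.∣? + 1)
    (ℤ∣.divides (ℤ.- k) (trans (ℤ-solve 1 (λ k → # 1 ⊜ oddᵖ k ⊕ ⊝ k ⊗ # 2) refl k)
      (trans (cong (ℤ._+ ℤ.- k ℤ.* + 2) eq) (ℤₚ.+-identityˡ _))))

  residue : Fin 8 → ℤ[θ]
  residue 0F = ⟨ + 0 , + 0 , + 0 ⟩
  residue 1F = ⟨ + 1 , + 0 , + 0 ⟩
  residue 2F = ⟨ + 0 , + 1 , + 0 ⟩
  residue 3F = ⟨ + 1 , + 1 , + 0 ⟩
  residue 4F = ⟨ + 0 , + 0 , + 1 ⟩
  residue 5F = ⟨ + 1 , + 0 , + 1 ⟩
  residue 6F = ⟨ + 0 , + 1 , + 1 ⟩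
  residue 7F = ⟨ + 1 , + 1 , + 1 ⟩

  split-2 : ∀ i j k p q r →
    ⟨ i ℤ.+ + 2 ℤ.* p , j ℤ.+ + 2 ℤ.* q , k ℤ.+ + 2 ℤ.* r ⟩ ≡ ⟨ i , j , k ⟩ + 2# * ⟨ p , q , r ⟩
  split-2 i j k p q r = cong (λ z → ⟨ i , j , k ⟩ + z) (sym (ι-*-⟨⟩ (+ 2) p q r))

  residue-of : ∀ z → ∃₂ λ i k → z ≡ residue i + 2# * k
  residue-of ⟨ a , b , c ⟩ with parity a | parity b | parity c
  ... | inj₁ (p , refl) | inj₁ (q , refl) | inj₁ (r , refl) = 0F , ⟨ p , q , r ⟩ , split-2 (+ 0)
    (+ 0) (+ 0) p q r
  ... | inj₂ (p , refl) | inj₁ (q , refl) | inj₁ (r , refl) = 1F , ⟨ p , q , r ⟩ , split-2 (+ 1)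
    (+ 0) (+ 0) p q r
  ... | inj₁ (p , refl) | inj₂ (q , refl) | inj₁ (r , refl) = 2F , ⟨ p , q , r ⟩ , split-2 (+ 0)
    (+ 1) (+ 0) p q r
  ... | inj₂ (p , refl) | inj₂ (q , refl) | inj₁ (r , refl) = 3F , ⟨ p , q , r ⟩ , split-2 (+ 1)
    (+ 1) (+ 0) p q r
  ... | inj₁ (p , refl) | inj₁ (q , refl) | inj₂ (r , refl) = 4F , ⟨ p , q , r ⟩ , split-2 (+ 0)
    (+ 0) (+ 1) p q r
  ... | inj₂ (p , refl) | inj₁ (q , refl) | inj₂ (r , refl) = 5F , ⟨ p , q , r ⟩ , split-2 (+ 1)
    (+ 0) (+ 1) p q r
  ... | inj₁ (p , refl) | inj₂ (q , refl) | inj₂ (r , refl) = 6F , ⟨ p , q , r ⟩ , split-2 (+ 0)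
    (+ 1) (+ 1) p q r
  ... | inj₂ (p , refl) | inj₂ (q , refl) | inj₂ (r , refl) = 7F , ⟨ p , q , r ⟩ , split-2 (+ 1)
    (+ 1) (+ 1) p q r

  Odd : ℤ[θ] → Set
  Odd z = ¬ 2# ∣ z

  even? : ∀ z → Dec (2# ∣ z)
  even? = ι∣? (+ 2)

  -- X³ - X - 1 is irreducible modulo 2, so 2 is inert and its residue ring is the field of 8
  -- elements.
  inverse-mod-2 : ∀ z → Odd z → ∃₂ λ y k → z * y ≡ 1# + 2# * k
  inverse-mod-2 z odd with residue-of z
  ... | i , k , refl with inverse i
    where
    inverse : ∀ i → 2# ∣ residue i ⊎ ∃[ j ] 2# ∣ (residue i * residue j - 1#)
    inverse = from-yes (all? λ i → even? (residue i) ⊎-dec any? λ j → even?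
      (residue i * residue j - 1#))
  ... | inj₁ (m , eq) = contradiction (m + k , trans (cong (_+ 2# * k) eq)
    (solve 2 (λ m k → con 2# :* m :+ con 2# :* k := con 2# :* (m :+ k)) refl m k)) odd
  ... | inj₂ (j , m , eq) = residue j , m + k * residue j , trans
    (solve 3 (λ x y k → (x :+ con 2# :* k) :* y := con 1# :+ con 2# :* (k :* y) :+
    (x :* y :- con 1#)) refl (residue i) (residue j) k)
    (trans (cong (λ e → 1# + 2# * (k * residue j) + e) eq)
      (solve 3 (λ y k m → con 1# :+ con 2# :* (k :* y) :+ con 2# :* m := con 1# :+ con 2# :*
      (m :+ k :* y)) refl (residue j) k m))

  norm-1+2k : ∀ k → ∃[ m ] norm (1# + 2# * k) ≡ + 1 ℤ.+ + 2 ℤ.* m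
  norm-1+2k ⟨ p , q , r ⟩ =
    half p q r , trans (cong norm (sym (split-2 (+ 1) (+ 0) (+ 0) p q r))) (expand p q r)
    where
    half : (p q r : ℤ) → ℤ
    half p q r =
      + 3 ℤ.* p ℤ.+ + 6 ℤ.* p ℤ.* p ℤ.+ + 2 ℤ.* r ℤ.+ + 8 ℤ.* p ℤ.* r ℤ.+ + 2 ℤ.* r ℤ.* r
      ℤ.- + 2 ℤ.* q ℤ.* q ℤ.- + 6 ℤ.* q ℤ.* r ℤ.+ + 4 ℤ.* norm ⟨ p , q , r ⟩

    expand : ∀ p q r → norm ⟨ + 1 ℤ.+ + 2 ℤ.* p , + 0 ℤ.+ + 2 ℤ.* q , + 0 ℤ.+ + 2 ℤ.* r ⟩
      ≡ + 1 ℤ.+ + 2 ℤ.* half p q r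
    expand = ℤ-solve 3 (λ p q r →
      normᵖ ⟪ # 1 ⊕ # 2 ⊗ p , # 0 ⊕ # 2 ⊗ q , # 0 ⊕ # 2 ⊗ r ⟫
      ⊜ # 1 ⊕ # 2 ⊗
        (# 3 ⊗ p ⊕ # 6 ⊗ p ⊗ p ⊕ # 2 ⊗ r ⊕ # 8 ⊗ p ⊗ r ⊕ # 2 ⊗ r ⊗ r
         ⊖ # 2 ⊗ q ⊗ q ⊖ # 6 ⊗ q ⊗ r ⊕ # 4 ⊗ normᵖ ⟪ p , q , r ⟫)) refl

  odd⇒norm≢0 : ∀ z → Odd z → norm z ≢ + 0
  odd⇒norm≢0 z odd N≡0 with inverse-mod-2 z odd
  ... | y , k , zy≡1+2k with norm-1+2k k
  ... | m , eq = 1+2k≢0 m (begin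
    + 1 ℤ.+ + 2 ℤ.* m   ≡⟨ eq ⟨
    norm (1# + 2# * k)  ≡⟨ cong norm zy≡1+2k ⟨
    norm (z * y)        ≡⟨ norm-* z y ⟩
    norm z ℤ.* norm y   ≡⟨ cong (ℤ._* norm y) N≡0 ⟩
    + 0 ℤ.* norm y      ≡⟨ ℤₚ.*-zeroˡ (norm y) ⟩
    + 0                 ∎)

  private
    size : ℤ[θ] → ℕ
    size ⟨ p , q , r ⟩ = abs p ℕ.+ abs q ℕ.+ abs r

    size≡0⇒≡0 : ∀ z → size z ≡ 0 → z ≡ 0#
    size≡0⇒≡0 ⟨ p , q , r ⟩ eq = ⟨⟩-cong
      (ℤₚ.∣i∣≡0⇒i≡0 (ℕₚ.m+n≡0⇒m≡0 (abs p) (ℕₚ.m+n≡0⇒m≡0 (abs p ℕ.+ abs q) eq)))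
      (ℤₚ.∣i∣≡0⇒i≡0 (ℕₚ.m+n≡0⇒n≡0 (abs p) (ℕₚ.m+n≡0⇒m≡0 (abs p ℕ.+ abs q) eq)))
      (ℤₚ.∣i∣≡0⇒i≡0 (ℕₚ.m+n≡0⇒n≡0 (abs p ℕ.+ abs q) eq))

    size-2* : ∀ z → size (2# * z) ≡ 2 ℕ.* size z
    size-2* ⟨ p , q , r ⟩ = begin
      size (2# * ⟨ p , q , r ⟩)  ≡⟨ cong size (ι-*-⟨⟩ (+ 2) p q r) ⟩
      abs (+ 2 ℤ.* p) ℕ.+ abs (+ 2 ℤ.* q) ℕ.+ abs (+ 2 ℤ.* r)
        ≡⟨ cong₂ ℕ._+_ (cong₂ ℕ._+_ (ℤₚ.abs-* (+ 2) p) (ℤₚ.abs-* (+ 2) q)) (ℤₚ.abs-* (+ 2) r) ⟩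
      2 ℕ.* abs p ℕ.+ 2 ℕ.* abs q ℕ.+ 2 ℕ.* abs r
        ≡⟨ cong (ℕ._+ 2 ℕ.* abs r) (ℕₚ.*-distribˡ-+ 2 (abs p) (abs q)) ⟨
      2 ℕ.* (abs p ℕ.+ abs q) ℕ.+ 2 ℕ.* abs r
        ≡⟨ ℕₚ.*-distribˡ-+ 2 (abs p ℕ.+ abs q) (abs r) ⟨
      2 ℕ.* (abs p ℕ.+ abs q ℕ.+ abs r) ∎

    m+m≤1+n⇒m≤n : ∀ {m n} → m ℕ.+ m ℕ.≤ suc n → m ℕ.≤ n
    m+m≤1+n⇒m≤n {zero}  _         = z≤n
    m+m≤1+n⇒m≤n {suc m} (s≤s le) = ℕₚ.≤-trans (ℕₚ.m≤n+m (suc m) m) le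

    -- Infinite descent at 2: an element of norm 0 cannot be odd, and its half has norm 0 again.
    norm≡0⇒≡0′ : ∀ n z → size z ℕ.≤ n → norm z ≡ + 0 → z ≡ 0#
    norm≡0⇒≡0′ zero    z sz≤0 _   = size≡0⇒≡0 z (ℕₚ.n≤0⇒n≡0 sz≤0)
    norm≡0⇒≡0′ (suc n) z sz≤  N≡0 with even? z
    ... | no odd = contradiction N≡0 (odd⇒norm≢0 z odd)
    ... | yes (k , refl) = cong (2# *_) (norm≡0⇒≡0′ n k
      (m+m≤1+n⇒m≤n (ℕₚ.≤-trans (ℕₚ.≤-reflexive 2k) sz≤)) Nk≡0)
      where
      2k : size k ℕ.+ size k ≡ size (2# * k)
      2k = trans (cong (size k ℕ.+_) (sym (ℕₚ.+-identityʳ (size k)))) (sym (size-2* k))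
      Nk≡0 : norm k ≡ + 0
      Nk≡0 = [ (λ ()) , id ]′ (ℤₚ.i*j≡0⇒i≡0∨j≡0 (+ 8) (trans (sym (norm-* 2# k)) N≡0))

  norm≡0⇒≡0 : ∀ z → norm z ≡ + 0 → z ≡ 0#
  norm≡0⇒≡0 z = norm≡0⇒≡0′ (size z) z ℕₚ.≤-refl

  x*y≡0⇒x≡0∨y≡0 : ∀ x y → x * y ≡ 0# → x ≡ 0# ⊎ y ≡ 0#
  x*y≡0⇒x≡0∨y≡0 x y xy≡0 = Sum.map (norm≡0⇒≡0 x) (norm≡0⇒≡0 y)
    (ℤₚ.i*j≡0⇒i≡0∨j≡0 (norm x) (trans (sym (norm-* x y)) (cong norm xy≡0)))

  x-y≡0⇒x≡y : ∀ x y → x - y ≡ 0# → x ≡ y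
  x-y≡0⇒x≡y x y eq = trans (solve 2 (λ x y → x := x :- y :+ y) refl x y)
    (trans (cong (_+ y) eq) (+-identityˡ y))

  *-cancelˡ : ∀ a {x y} → a ≢ 0# → a * x ≡ a * y → x ≡ y
  *-cancelˡ a {x} {y} a≢0 eq = [ (λ a≡0 → contradiction a≡0 a≢0) , x-y≡0⇒x≡y x y ]′
    (x*y≡0⇒x≡0∨y≡0 a (x - y)
      (trans (solve 3 (λ a x y → a :* (x :- y) := a :* x :- a :* y) refl a x y)
        (trans (cong (_- a * y) eq) (-‿inverseʳ (a * y)))))

  -- ℤ[θ] is norm-Euclidean

  roundℕ : ∀ P d .{{_ : NonZero d}} → ∃[ q ] 2 ℕ.* abs (P ℤ.- q ℤ.* + d) ℕ.≤ d
  roundℕ P d with 2 ℕ.* (P %ℕ d) ℕₚ.≤? d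
  ... | yes 2r≤d = P /ℕ d , subst (λ z → 2 ℕ.* abs z ℕ.≤ d) (sym rem) 2r≤d
    where
    rem : P ℤ.- P /ℕ d ℤ.* + d ≡ + (P %ℕ d)
    rem = trans (cong (ℤ._- P /ℕ d ℤ.* + d) (a≡a%ℕn+[a/ℕn]*n P d))
      (ℤ-solve 3 (λ r q n → (r ⊕ q ⊗ n) ⊖ q ⊗ n ⊜ r) refl (+ (P %ℕ d)) (P /ℕ d) (+ d))
  ... | no 2r≰d = P /ℕ d ℤ.+ + 1 , subst (λ z → 2 ℕ.* z ℕ.≤ d) (sym absrem) bound
    where
    r = P %ℕ d
    absrem : abs (P ℤ.- (P /ℕ d ℤ.+ + 1) ℤ.* + d) ≡ d ℕ.∸ r
    absrem = begin
      abs (P ℤ.- (P /ℕ d ℤ.+ + 1) ℤ.* + d)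
        ≡⟨ cong (λ z → abs (z ℤ.- (P /ℕ d ℤ.+ + 1) ℤ.* + d)) (a≡a%ℕn+[a/ℕn]*n P d) ⟩
      abs (+ r ℤ.+ P /ℕ d ℤ.* + d ℤ.- (P /ℕ d ℤ.+ + 1) ℤ.* + d)
        ≡⟨ cong abs (ℤ-solve 3 (λ r q n → (r ⊕ q ⊗ n) ⊖ (q ⊕ # 1) ⊗ n ⊜ r ⊖ n) refl (+ r) (P /ℕ d)
          (+ d)) ⟩
      abs (+ r ℤ.- + d)   ≡⟨ cong abs (ℤₚ.m-n≡m⊖n r d) ⟩
      abs (r ℤ.⊖ d)       ≡⟨ ℤₚ.∣⊖∣-≤ (ℕₚ.<⇒≤ (n%ℕd<d P d)) ⟩
      d ℕ.∸ r             ∎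
    bound : 2 ℕ.* (d ℕ.∸ r) ℕ.≤ d
    bound = ℕₚ.≤-trans (ℕₚ.≤-reflexive (ℕₚ.*-distribˡ-∸ 2 d r))
      (ℕₚ.≤-trans (ℕₚ.∸-monoʳ-≤ (2 ℕ.* d) (ℕₚ.<⇒≤ (ℕₚ.≰⇒> 2r≰d)))
        (ℕₚ.≤-reflexive (trans (cong (ℕ._∸ d) (cong (d ℕ.+_) (ℕₚ.+-identityʳ d)))
          (ℕₚ.m+n∸n≡m d d))))

  round : ∀ P n → n ≢ + 0 → ∃[ q ] 2 ℕ.* abs (P ℤ.- q ℤ.* n) ℕ.≤ abs n
  round P (+ zero)    n≢0 = contradiction refl n≢0
  round P (+ (suc m)) _   = roundℕ P (suc m)
  round P -[1+ m ]    _   = let q , le = roundℕ P (suc m) in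
    ℤ.- q , subst (λ z → 2 ℕ.* abs z ℕ.≤ suc m) (ℤ-solve 3 (λ P q n → P ⊖ q ⊗ n ⊜ P ⊖ ⊝ q ⊗ ⊝ n)
      refl P q (+ (suc m))) le

  private
    infix 4 _≼_

    -- A wrapper that lets Agda infer x, which it cannot do from abs x.
    record _≼_ (x : ℤ) (a : ℕ) : Set where
      constructor bounded
      field abs≤ : abs x ℕ.≤ a
    open _≼_

    ≼-plus : ∀ {x y a b} → x ≼ a → y ≼ b → x ℤ.+ y ≼ a ℕ.+ b
    ≼-plus {x} {y} (bounded x≤a) (bounded y≤b) =
      bounded (ℕₚ.≤-trans (ℤₚ.∣i+j∣≤∣i∣+∣j∣ x y) (ℕₚ.+-mono-≤ x≤a y≤b))

    ≼-minus : ∀ {x y a b} → x ≼ a → y ≼ b → x ℤ.- y ≼ a ℕ.+ b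
    ≼-minus {x} {y} (bounded x≤a) (bounded y≤b) =
      bounded (ℕₚ.≤-trans (ℤₚ.∣i-j∣≤∣i∣+∣j∣ x y) (ℕₚ.+-mono-≤ x≤a y≤b))

    ≼-times : ∀ {x y a b} → x ≼ a → y ≼ b → x ℤ.* y ≼ a ℕ.* b
    ≼-times {x} {y} (bounded x≤a) (bounded y≤b) =
      bounded (ℕₚ.≤-trans (ℕₚ.≤-reflexive (ℤₚ.abs-* x y)) (ℕₚ.*-mono-≤ x≤a y≤b))

    ≼-con : ∀ c → + c ≼ c
    ≼-con c = bounded ℕₚ.≤-refl

  -- In the coordinates w = r, v = 3p + r, u = 9q - v the norm form has so small coefficients
  -- that the triangle inequality suffices.
  norm-bound : ∀ n p q r → let v = + 3 ℤ.* p ℤ.+ r in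
    0 ℕ.< n → 2 ℕ.* abs (+ 9 ℤ.* q ℤ.- v) ℕ.≤ 9 ℕ.* n → 2 ℕ.* abs v ℕ.≤ 3 ℕ.* n → 2 ℕ.* abs r ℕ.≤ n
      →
    abs (norm ⟨ p , q , r ⟩) ℕ.< n ℕ.* n ℕ.* n
  norm-bound n p q r 0<n u≤ v≤ w≤ = ℕₚ.≰⇒> λ n³≤ → ℕₚ.<⇒≱ 4563<5832
    (ℕₚ.≤-trans (ℕₚ.*-monoˡ-≤ 5832 n³≤)
      (ℕₚ.≤-trans (ℕₚ.≤-reflexive (trans (sym (ℤₚ.abs-* (norm ⟨ p , q , r ⟩) (+ 5832)))
        (cong abs (expand p q r))))
        (ℕₚ.≤-trans (abs≤ (bound (double u u≤) (double v v≤) (double r w≤)))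
          (ℕₚ.≤-reflexive (total n)))))
    where
    v = + 3 ℤ.* p ℤ.+ r
    u = + 9 ℤ.* q ℤ.- v

    double : ∀ x {a} → 2 ℕ.* abs x ℕ.≤ a → + 2 ℤ.* x ≼ a
    double x le = bounded (ℕₚ.≤-trans (ℕₚ.≤-reflexive (ℤₚ.abs-* (+ 2) x)) le)

    -- From p = (v - w) / 3 and q = (u + v) / 9, the form has denominator 9³ in u, v, w, and the
    -- doubled variables contribute 2³; this is 5832. The absolute values of its coefficients,
    -- weighted with the bounds 9n, 3n and n, add up to 4563 n³.
    cubic : (u v w : ℤ) → ℤ
    cubic u v w =
      u ℤ.* u ℤ.* u ℤ.+ (u ℤ.* u ℤ.* w) ℤ.* + 3 ℤ.- (u ℤ.* v ℤ.* v) ℤ.* + 3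
      ℤ.- (u ℤ.* v ℤ.* w) ℤ.* + 75 ℤ.+ (v ℤ.* v ℤ.* v) ℤ.* + 25 ℤ.+ (v ℤ.* v ℤ.* w) ℤ.* + 3
      ℤ.+ (w ℤ.* w ℤ.* w) ℤ.* + 621

    expand : ∀ p q r → norm ⟨ p , q , r ⟩ ℤ.* + 5832
      ≡ cubic (+ 2 ℤ.* (+ 9 ℤ.* q ℤ.- (+ 3 ℤ.* p ℤ.+ r))) (+ 2 ℤ.* (+ 3 ℤ.* p ℤ.+ r)) (+ 2 ℤ.* r)
    expand = ℤ-solve 3 (λ p q r →
      let v = # 2 ⊗ (# 3 ⊗ p ⊕ r)
          u = # 2 ⊗ (# 9 ⊗ q ⊖ (# 3 ⊗ p ⊕ r))
          w = # 2 ⊗ r in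
      normᵖ ⟪ p , q , r ⟫ ⊗ # 5832
      ⊜ u ⊗ u ⊗ u ⊕ (u ⊗ u ⊗ w) ⊗ # 3 ⊖ (u ⊗ v ⊗ v) ⊗ # 3
        ⊖ (u ⊗ v ⊗ w) ⊗ # 75 ⊕ (v ⊗ v ⊗ v) ⊗ # 25 ⊕ (v ⊗ v ⊗ w) ⊗ # 3
        ⊕ (w ⊗ w ⊗ w) ⊗ # 621) refl

    bound : ∀ {u v w U V W} → u ≼ U → v ≼ V → w ≼ W → cubic u v w ≼
      U ℕ.* U ℕ.* U ℕ.+ (U ℕ.* U ℕ.* W) ℕ.* 3 ℕ.+ (U ℕ.* V ℕ.* V) ℕ.* 3
      ℕ.+ (U ℕ.* V ℕ.* W) ℕ.* 75 ℕ.+ (V ℕ.* V ℕ.* V) ℕ.* 25 ℕ.+ (V ℕ.* V ℕ.* W) ℕ.* 3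
      ℕ.+ (W ℕ.* W ℕ.* W) ℕ.* 621
    bound u≤ v≤ w≤ =
      ≼-plus (≼-plus (≼-plus (≼-minus (≼-minus (≼-plus (≼-times (≼-times u≤ u≤) u≤)
        (≼-times (≼-times (≼-times u≤ u≤) w≤) (≼-con 3)))
        (≼-times (≼-times (≼-times u≤ v≤) v≤) (≼-con 3)))
          (≼-times (≼-times (≼-times u≤ v≤) w≤) (≼-con 75)))
        (≼-times (≼-times (≼-times v≤ v≤) v≤) (≼-con 25)))
          (≼-times (≼-times (≼-times v≤ v≤) w≤) (≼-con 3)))
        (≼-times (≼-times (≼-times w≤ w≤) w≤) (≼-con 621))

    total : ∀ n → 9 ℕ.* n ℕ.* (9 ℕ.* n) ℕ.* (9 ℕ.* n) ℕ.+ 9 ℕ.* n ℕ.* (9 ℕ.* n) ℕ.* n ℕ.* 3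
      ℕ.+ 9 ℕ.* n ℕ.* (3 ℕ.* n) ℕ.* (3 ℕ.* n) ℕ.* 3 ℕ.+ 9 ℕ.* n ℕ.* (3 ℕ.* n) ℕ.* n ℕ.* 75
      ℕ.+ 3 ℕ.* n ℕ.* (3 ℕ.* n) ℕ.* (3 ℕ.* n) ℕ.* 25 ℕ.+ 3 ℕ.* n ℕ.* (3 ℕ.* n) ℕ.* n ℕ.* 3
      ℕ.+ n ℕ.* n ℕ.* n ℕ.* 621 ≡ n ℕ.* n ℕ.* n ℕ.* 4563
    total = ℕ-solve 1 (λ n → let 9n = κ 9 ⊠ n ; 3n = κ 3 ⊠ n in
      9n ⊠ 9n ⊠ 9n ⊞ 9n ⊠ 9n ⊠ n ⊠ κ 3 ⊞ 9n ⊠ 3n ⊠ 3n ⊠ κ 3 ⊞ 9n ⊠ 3n ⊠ n ⊠ κ 75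
      ⊞ 3n ⊠ 3n ⊠ 3n ⊠ κ 25 ⊞ 3n ⊠ 3n ⊠ n ⊠ κ 3 ⊞ n ⊠ n ⊠ n ⊠ κ 621
      ≜ n ⊠ n ⊠ n ⊠ κ 4563) refl

    4563<5832 : n ℕ.* n ℕ.* n ℕ.* 4563 ℕ.< n ℕ.* n ℕ.* n ℕ.* 5832
    4563<5832 = ℕₚ.*-monoʳ-< (n ℕ.* n ℕ.* n)
      {{ℕ.>-nonZero (ℕₚ.*-mono-< (ℕₚ.*-mono-< 0<n 0<n) 0<n)}} (from-yes (4563 ℕₚ.<? 5832))

  division : ∀ x y → y ≢ 0# → ∃[ k ] abs (norm (x - k * y)) ℕ.< abs (norm y)
  division x y y≢0 with x * adj y in z-eq
  ... | ⟨ P , Q , R ⟩ = k , ℕₚ.*-cancelʳ-< n³ (abs (norm (x - k * y))) d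
    (subst (ℕ._< d ℕ.* n³) (sym abs-eq) (ℕₚ.*-monoʳ-< d bound′))
    where
    n = norm y
    d = abs n
    n³ = d ℕ.* d ℕ.* d

    n≢0 : n ≢ + 0
    n≢0 = y≢0 ∘ norm≡0⇒≡0 y

    instance
      d≢0 : NonZero d
      d≢0 = ℕ.≢-nonZero (n≢0 ∘ ℤₚ.∣i∣≡0⇒i≡0)

    3n≢0 : + 3 ℤ.* n ≢ + 0
    3n≢0 eq = [ (λ ()) , n≢0 ]′ (ℤₚ.i*j≡0⇒i≡0∨j≡0 (+ 3) eq)
    9n≢0 : + 9 ℤ.* n ≢ + 0
    9n≢0 eq = [ (λ ()) , n≢0 ]′ (ℤₚ.i*j≡0⇒i≡0∨j≡0 (+ 9) eq)

    -- The order r, p, q matters: each rounding takes in the error of the one before, which bounds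
    -- exactly the combinations w, v and u of `norm-bound`.
    r-round = round R n n≢0
    r = proj₁ r-round
    w = R ℤ.- r ℤ.* n
    p-round = round (+ 3 ℤ.* P ℤ.+ w) (+ 3 ℤ.* n) 3n≢0
    p = proj₁ p-round
    v = + 3 ℤ.* P ℤ.+ w ℤ.- p ℤ.* (+ 3 ℤ.* n)
    q-round = round (+ 9 ℤ.* Q ℤ.- v) (+ 9 ℤ.* n) 9n≢0
    q = proj₁ q-round
    k = ⟨ p , q , r ⟩

    v-eq : ∀ P p w n → + 3 ℤ.* P ℤ.+ w ℤ.- p ℤ.* (+ 3 ℤ.* n) ≡ + 3 ℤ.* (P ℤ.- p ℤ.* n) ℤ.+ w
    v-eq = ℤ-solve 4 (λ P p w n → # 3 ⊗ P ⊕ w ⊖ p ⊗ (# 3 ⊗ n) ⊜ # 3 ⊗ (P ⊖ p ⊗ n) ⊕ w) refl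

    e = ⟨ P ℤ.- p ℤ.* n , Q ℤ.- q ℤ.* n , w ⟩

    bound′ : abs (norm e) ℕ.< n³
    bound′ = norm-bound d (P ℤ.- p ℤ.* n) (Q ℤ.- q ℤ.* n) w (ℕ.>-nonZero⁻¹ d)
      (subst₂ (λ t c → 2 ℕ.* abs t ℕ.≤ c)
        (trans (ℤ-solve 4 (λ Q q v n → # 9 ⊗ Q ⊖ v ⊖ q ⊗ (# 9 ⊗ n) ⊜ # 9 ⊗ (Q ⊖ q ⊗ n) ⊖ v) refl Q q
          v n) (cong (λ t → + 9 ℤ.* (Q ℤ.- q ℤ.* n) ℤ.- t) (v-eq P p w n)))
        (ℤₚ.abs-* (+ 9) n) (proj₂ q-round))
      (subst₂ (λ t c → 2 ℕ.* abs t ℕ.≤ c) (v-eq P p w n) (ℤₚ.abs-* (+ 3) n) (proj₂ p-round))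
      (proj₂ r-round)

    e-eq : (x - k * y) * adj y ≡ e
    e-eq = begin
      (x - k * y) * adj y               ≡⟨ h x k y (adj y) ⟩
      x * adj y - (y * adj y) * k       ≡⟨ cong₂ (λ s t → s - t * k) z-eq (*-adj y) ⟩
      ⟨ P , Q , R ⟩ - ι n * k           ≡⟨ cong (λ t → ⟨ P , Q , R ⟩ - t) (ι-*-⟨⟩ n p q r) ⟩
      ⟨ P ℤ.- n ℤ.* p , Q ℤ.- n ℤ.* q , R ℤ.- n ℤ.* r ⟩
        ≡⟨ ⟨⟩-cong (cong (λ t → P ℤ.- t) (ℤₚ.*-comm n p)) (cong (λ t → Q ℤ.- t) (ℤₚ.*-comm n q))
             (cong (λ t → R ℤ.- t) (ℤₚ.*-comm n r)) ⟩
      e                                 ∎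
      where
      h : ∀ x k y y′ → (x - k * y) * y′ ≡ x * y′ - (y * y′) * k
      h = solve 4 (λ x k y y′ → (x :- k :* y) :* y′ := x :* y′ :- (y :* y′) :* k) refl

    norm-ι : ∀ n → norm (ι n) ≡ n ℤ.* n ℤ.* n
    norm-ι = ℤ-solve 1 (λ n → normᵖ (ιᵖ n) ⊜ n ⊗ n ⊗ n) refl

    norm-eq : norm (x - k * y) ℤ.* (n ℤ.* n ℤ.* n) ≡ norm e ℤ.* n
    norm-eq = begin
      norm (x - k * y) ℤ.* (n ℤ.* n ℤ.* n)
        ≡⟨ cong (norm (x - k * y) ℤ.*_) (trans (sym (norm-ι n))
          (trans (cong norm (sym (*-adj y))) (trans (norm-* y (adj y)) (ℤₚ.*-comm n _)))) ⟩
      norm (x - k * y) ℤ.* (norm (adj y) ℤ.* n)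
        ≡⟨ ℤₚ.*-assoc (norm (x - k * y)) _ n ⟨
      norm (x - k * y) ℤ.* norm (adj y) ℤ.* n
        ≡⟨ cong (ℤ._* n) (trans (sym (norm-* (x - k * y) (adj y))) (cong norm e-eq)) ⟩
      norm e ℤ.* n ∎

    abs-eq : abs (norm (x - k * y)) ℕ.* n³ ≡ d ℕ.* abs (norm e)
    abs-eq = begin
      abs (norm (x - k * y)) ℕ.* n³
        ≡⟨ cong (abs (norm (x - k * y)) ℕ.*_) (trans (cong (ℕ._* d) (sym (ℤₚ.abs-* n n)))
          (sym (ℤₚ.abs-* (n ℤ.* n) n))) ⟩
      abs (norm (x - k * y)) ℕ.* abs (n ℤ.* n ℤ.* n)
        ≡⟨ ℤₚ.abs-* (norm (x - k * y)) _ ⟨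
      abs (norm (x - k * y) ℤ.* (n ℤ.* n ℤ.* n))  ≡⟨ cong abs norm-eq ⟩
      abs (norm e ℤ.* n)    ≡⟨ ℤₚ.abs-* (norm e) n ⟩
      abs (norm e) ℕ.* d    ≡⟨ ℕₚ.*-comm (abs (norm e)) d ⟩
      d ℕ.* abs (norm e)    ∎

  -- Bézout domains

  record Bézout (x y : ℤ[θ]) : Set where
    constructor bézout
    field
      g a b u v : ℤ[θ]
      x≡ga : x ≡ g * a
      y≡gb : y ≡ g * b
      g≡ux+vy : g ≡ u * x + v * y

  gcd : ∀ x y → Bézout x y
  gcd x y = go x y (<-wellFounded (abs (norm y)))
    where
    go : ∀ x y → Acc ℕ._<_ (abs (norm y)) → Bézout x y
    go x y (acc rs) with y ≟ 0#
    ... | yes refl = bézout x 1# 0# 1# 0# (solve 1 (λ x → x := x :* con 1#) refl x)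
      (solve 1 (λ x → con 0# := x :* con 0#) refl x)
      (solve 1 (λ x → x := con 1# :* x :+ con 0# :²) refl x)
    ... | no y≢0 with division x y y≢0
    ... | k , r<y with go y (x - k * y) (rs r<y)
    ... | bézout g a b u v y≡ga r≡gb g≡ = bézout g (b + k * a) a v (u - v * k)
      (trans (solve 3 (λ x k y → x := (x :- k :* y) :+ k :* y) refl x k y)
        (trans (cong₂ (λ s t → s + k * t) r≡gb y≡ga)
        (solve 4 (λ g a b k → g :* b :+ k :* (g :* a) := g :* (b :+ k :* a)) refl g a b k)))
      y≡ga
      (trans g≡ (solve 5 (λ u v x y k → u :* y :+ v :* (x :- k :* y) := v :* x :+ (u :- v :* k) :*
        y) refl u v x y k))

  Coprime : ℤ[θ] → ℤ[θ] → Set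
  Coprime x y = ∃₂ λ u v → u * x + v * y ≡ 1#

  IsUnit : ℤ[θ] → Set
  IsUnit x = ∃[ y ] x * y ≡ 1#

  coprime-sym : ∀ {x y} → Coprime x y → Coprime y x
  coprime-sym {x} {y} (u , v , eq) = v , u , trans (+-comm (v * y) (u * x)) eq

  coprime-* : ∀ {x y z} → Coprime x y → Coprime x z → Coprime x (y * z)
  coprime-* {x} {y} {z} (u , v , eq) (u′ , v′ , eq′) =
    u * u′ * x + u * v′ * z + v * u′ * y , v * v′ , trans
      (solve 7 (λ u v u′ v′ x y z → (u :* u′ :* x :+ u :* v′ :* z :+ v :* u′ :* y) :* x :+ v :* v′
      :* (y :* z) := (u :* x :+ v :* y) :* (u′ :* x :+ v′ :* z)) refl u v u′ v′ x y z)
      (cong₂ _*_ eq eq′)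

  coprime-² : ∀ {x y} → Coprime x y → Coprime x (y ²)
  coprime-² c = coprime-* c c

  coprime-factorʳ : ∀ {x y} k → Coprime x (y * k) → Coprime x y
  coprime-factorʳ {x} {y} k (u , v , eq) = u , v * k , trans
    (solve 5 (λ u v x y k → u :* x :+ v :* k :* y := u :* x :+ v :* (y :* k)) refl u v x y k) eq

  coprime-factorˡ : ∀ {x y} k → Coprime (x * k) y → Coprime x y
  coprime-factorˡ k = coprime-sym ∘ coprime-factorʳ k ∘ coprime-sym

  coprime∧∣*⇒∣ : ∀ {x y z} → Coprime x y → x ∣ y * z → x ∣ z
  coprime∧∣*⇒∣ {x} {y} {z} (u , v , eq) (k , yz≡xk) = u * z + v * k , (begin
    z                          ≡⟨ h z ⟩
    1# * z                     ≡⟨ cong (_* z) eq ⟨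
    (u * x + v * y) * z        ≡⟨ h₁ u v x y z ⟩
    x * (u * z) + v * (y * z)  ≡⟨ cong (λ t → x * (u * z) + v * t) yz≡xk ⟩
    x * (u * z) + v * (x * k)  ≡⟨ h₂ u v x z k ⟩
    x * (u * z + v * k)        ∎)
    where
    h : ∀ z → z ≡ 1# * z
    h = solve 1 (λ z → z := con 1# :* z) refl
    h₁ : ∀ u v x y z → (u * x + v * y) * z ≡ x * (u * z) + v * (y * z)
    h₁ = solve 5 (λ u v x y z → (u :* x :+ v :* y) :* z := x :* (u :* z) :+ v :* (y :* z)) refl
    h₂ : ∀ u v x z k → x * (u * z) + v * (x * k) ≡ x * (u * z + v * k)
    h₂ = solve 5 (λ u v x z k → x :* (u :* z) :+ v :* (x :* k) := x :* (u :* z :+ v :* k)) refl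

  coprime∧∣⇒unit : ∀ {x y} → Coprime x y → x ∣ y → IsUnit x
  coprime∧∣⇒unit {x} (u , v , eq) (k , refl) = u + v * k , trans
    (solve 4 (λ u v x k → x :* (u :+ v :* k) := u :* x :+ v :* (x :* k)) refl u v x k) eq

  unit-∣ : ∀ {x y} → x ∣ y → IsUnit y → IsUnit x
  unit-∣ {x} (k , refl) (z , eq) = k * z , trans
    (solve 3 (λ x k z → x :* (k :* z) := x :* k :* z) refl x k z) eq

  unit⇒coprime : ∀ {x} y → IsUnit x → Coprime x y
  unit⇒coprime {x} y (z , eq) = z , 0# , trans (solve 3 (λ x y z → z :* x :+ con 0# :* y := x :* z)
    refl x y z) eq

  unit-* : ∀ {x y} → IsUnit x → IsUnit y → IsUnit (x * y)
  unit-* {x} {y} (x′ , eq) (y′ , eq′) = x′ * y′ , trans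
    (solve 4 (λ x y x′ y′ → x :* y :* (x′ :* y′) := x :* x′ :* (y :* y′)) refl x y x′ y′)
    (cong₂ _*_ eq eq′)

  ∣-trans : ∀ {x y z} → x ∣ y → y ∣ z → x ∣ z
  ∣-trans {x} (k , refl) (l , refl) = k * l , *-assoc x k l

  ∣-* : ∀ {x y} k → x ∣ y → x ∣ y * k
  ∣-* {x} k (l , refl) = l * k , *-assoc x l k

  ∣-+ : ∀ {x y z} → x ∣ y → x ∣ z → x ∣ y + z
  ∣-+ {x} (k , refl) (l , refl) = k + l , sym (*-distribˡ-+ x k l)

  ∣-neg : ∀ {x y} → x ∣ y → x ∣ - y
  ∣-neg {x} (k , refl) = - k , h x k
    where
    h : ∀ x k → - (x * k) ≡ x * (- k)
    h = solve 2 (λ x k → :- (x :* k) := x :* (:- k)) refl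

  unit≢0 : ∀ {x} → IsUnit x → x ≢ 0#
  unit≢0 (y , eq) refl = contradiction (trans (sym (solve 1 (λ y → con 0# :* y := con 0#) refl y))
    eq) λ ()

  gcd-unit⇒coprime : ∀ {x y} → (B : Bézout x y) → IsUnit (Bézout.g B) → Coprime x y
  gcd-unit⇒coprime {x} {y} (bézout g a b u v _ _ g≡) (g′ , eq) =
    g′ * u , g′ * v , trans (solve 5 (λ g′ u v x y → g′ :* u :* x :+ g′ :* v :* y :=
      (u :* x :+ v :* y) :* g′) refl g′ u v x y) (trans (cong (_* g′) (sym g≡)) eq)

  -- To prove two elements coprime, it suffices to show that their common divisors are units.
  coprime-by : ∀ x y → (∀ g → g ∣ x → g ∣ y → IsUnit g) → Coprime x y
  coprime-by x y unit = gcd-unit⇒coprime B (unit g (a , x≡ga) (b , y≡gb))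
    where
    B = gcd x y
    open Bézout B

  cofactors-coprime : ∀ {x y} (B : Bézout x y) → Bézout.g B ≢ 0# → Coprime (Bézout.a B) (Bézout.b B)
  cofactors-coprime {x} {y} (bézout g a b u v x≡ga y≡gb g≡) g≢0 = u , v , *-cancelˡ g g≢0 (begin
    g * (u * a + v * b)      ≡⟨ h₁ g a b u v ⟩
    u * (g * a) + v * (g * b) ≡⟨ cong₂ (λ s t → u * s + v * t) x≡ga y≡gb ⟨
    u * x + v * y            ≡⟨ g≡ ⟨
    g                        ≡⟨ h₂ g ⟩
    g * 1#                   ∎)
    where
    h₁ : ∀ g a b u v → g * (u * a + v * b) ≡ u * (g * a) + v * (g * b)
    h₁ = solve 5 (λ g a b u v → g :* (u :* a :+ v :* b) := u :* (g :* a) :+ v :* (g :* b)) refl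
    h₂ : ∀ g → g ≡ g * 1#
    h₂ = solve 1 (λ g → g := g :* con 1#) refl

  -- Coprime factors of squares and fourth powers

  *-zeroˡ : ∀ x → 0# * x ≡ 0#
  *-zeroˡ = solve 1 (λ x → con 0# :* x := con 0#) refl

  factor≢0 : ∀ x y → x * y ≢ 0# → x ≢ 0#
  factor≢0 x y xy≢0 refl = xy≢0 (*-zeroˡ y)

  -- The two unit factors are inverse to each other, so that t is m n exactly and not only up to a
  -- unit.
  record Squares (A B t : ℤ[θ]) : Set where
    constructor squares
    field
      ε ε′ m n : ℤ[θ]
      εε′≡1 : ε * ε′ ≡ 1#
      A≡ : A ≡ ε * m ²
      B≡ : B ≡ ε′ * n ²
      t≡ : t ≡ m * n

  -- Write A = g a and t = g b with g the gcd. As a and b are coprime, b² divides B; the cofactor c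
  -- satisfies a c = g, and it is prime to g because A and B are coprime. Hence c is a unit.
  coprime-squares : ∀ {A B t} → Coprime A B → t ≢ 0# → A * B ≡ t ² → Squares A B t
  coprime-squares {A} {B} {t} cAB t≢0 AB≡t² with gcd A t
  ... | G@(bézout g a b u v refl refl _) = result
    (coprime∧∣*⇒∣ (coprime-sym (coprime-² ca)) (g , aB≡))
    where
    g≢0 : g ≢ 0#
    g≢0 = factor≢0 g b t≢0
    b≢0 : b ≢ 0#
    b≢0 = factor≢0 b g (t≢0 ∘ trans (*-comm g b))
    ca : Coprime a b
    ca = cofactors-coprime G g≢0
    aB≡ : a * B ≡ b ² * g
    aB≡ = *-cancelˡ g g≢0 (trans (solve 3 (λ g a B → g :* (a :* B) := g :* a :* B) refl g a B)
      (trans AB≡t² (solve 2 (λ g b → (g :* b) :² := g :* (b :² :* g)) refl g b)))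
    result : b * b ∣ B → Squares (g * a) B (g * b)
    result (c , refl) = squares c′ c g b (trans (*-comm c′ c) cc′≡1) A≡ (*-comm (b ²) c) refl
      where
      ac≡g : a * c ≡ g
      ac≡g = *-cancelˡ b b≢0 (*-cancelˡ b b≢0 (trans
        (solve 3 (λ a b c → b :* (b :* (a :* c)) := a :* (b :² :* c)) refl a b c)
        (trans aB≡ (solve 2 (λ b g → b :² :* g := b :* (b :* g)) refl b g))))
      c-unit : IsUnit c
      c-unit = coprime∧∣⇒unit
        (coprime-sym (coprime-factorʳ (b ²) (subst (Coprime g) (*-comm (b ²) c)
          (coprime-factorˡ a cAB))))
        (a , trans (sym ac≡g) (*-comm a c))
      c′ = proj₁ c-unit
      cc′≡1 = proj₂ c-unit
      A≡ : g * a ≡ c′ * g ²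
      A≡ = begin
        g * a                  ≡⟨ h₁ g a ⟩
        1# * (g * a)           ≡⟨ cong (_* (g * a)) cc′≡1 ⟨
        c * c′ * (g * a)       ≡⟨ h₂ c c′ g a ⟩
        c′ * (g * (a * c))     ≡⟨ cong (λ s → c′ * (g * s)) ac≡g ⟩
        c′ * g ²           ∎
        where
        h₁ : ∀ g a → g * a ≡ 1# * (g * a)
        h₁ = solve 2 (λ g a → g :* a := con 1# :* (g :* a)) refl
        h₂ : ∀ c c′ g a → c * c′ * (g * a) ≡ c′ * (g * (a * c))
        h₂ = solve 4 (λ c c′ g a → c :* c′ :* (g :* a) := c′ :* (g :* (a :* c))) refl

  record FourthPowers (A B t : ℤ[θ]) : Set where
    constructor fourthPowers
    field
      ε ε′ m n : ℤ[θ]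
      εε′≡1 : ε * ε′ ≡ 1#
      A≡ : A ≡ ε * m ² ²
      B≡ : B ≡ ε′ * n ² ²
      t≡ : t ≡ m * n

  coprime-roots : ∀ ε ε′ m n → Coprime (ε * m ²) (ε′ * n ²) → Coprime m n
  coprime-roots ε ε′ m n (u , v , eq) = u * ε * m , v * ε′ * n , trans
    (solve 6 (λ u v ε ε′ m n → u :* ε :* m :* m :+ v :* ε′ :* n :* n := u :* (ε :* m :²) :+ v :*
    (ε′ :* n :²)) refl u v ε ε′ m n) eq

  -- The roots m and n given by `coprime-squares` are coprime with product t², so the same lemma
  -- applies to them.
  coprime-fourthPowers : ∀ {A B t} → Coprime A B → t ≢ 0# → A * B ≡ t ² ² → FourthPowers A B t
  coprime-fourthPowers {A} {B} {t} cAB t≢0 AB≡t⁴ = step₁ (coprime-squares cAB t²≢0 AB≡t⁴)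
    where
    t²≢0 : t * t ≢ 0#
    t²≢0 eq = [ t≢0 , t≢0 ]′ (x*y≡0⇒x≡0∨y≡0 t t eq)

    h′ : ∀ ε δ m → ε * (δ * m ² * (δ * m ²)) ≡ ε * δ ² * m ² ²
    h′ = solve 3 (λ ε δ m → ε :* (δ :* m :² :* (δ :* m :²)) := ε :* δ :² :* m :² :²) refl

    step₂ : ∀ ε ε′ m n → ε * ε′ ≡ 1# → A ≡ ε * m ² → B ≡ ε′ * n ² → Squares m n t → FourthPowers A B
      t
    step₂ ε ε′ _ _ εε′≡1 A≡ B≡ (squares δ δ′ m n δδ′≡1 refl refl t≡) =
      fourthPowers (ε * δ ²) (ε′ * δ′ ²) m n
        (trans (solve 4 (λ ε ε′ δ δ′ → ε :* δ :² :* (ε′ :* δ′ :²) := ε :* ε′ :* (δ :* δ′) :²) refl ε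
          ε′ δ δ′) (cong₂ (λ s t → s * t ²) εε′≡1 δδ′≡1))
        (trans A≡ (h′ ε δ m)) (trans B≡ (h′ ε′ δ′ n)) t≡

    step₁ : Squares A B (t ²) → FourthPowers A B t
    step₁ (squares ε ε′ m n εε′≡1 A≡ B≡ t²≡mn) = step₂ ε ε′ m n εε′≡1 A≡ B≡
      (coprime-squares (coprime-roots ε ε′ m n (subst₂ Coprime A≡ B≡ cAB)) t≢0 (sym t²≡mn))

  -- After division by the gcd, the cofactor a of x divides b² and is coprime to it.
  x²∣y²⇒x∣y : ∀ x y → x ≢ 0# → x ² ∣ y ² → x ∣ y
  x²∣y²⇒x∣y x y x≢0 (k , y²≡x²k) with gcd x y
  ... | G@(bézout g a b u v refl refl _) = a′ * b , trans
    (solve 2 (λ g b → g :* b := g :* (con 1# :* b)) refl g b)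
    (trans (cong (λ s → g * (s * b)) (sym aa′≡1))
    (solve 4 (λ g a a′ b → g :* (a :* a′ :* b) := g :* a :* (a′ :* b)) refl g a a′ b))
    where
    g≢0 : g ≢ 0#
    g≢0 = factor≢0 g a x≢0
    b²≡ : b * b ≡ a * (a * k)
    b²≡ = *-cancelˡ g g≢0 (*-cancelˡ g g≢0 (trans
      (solve 2 (λ g b → g :* (g :* b :²) := (g :* b) :²) refl g b)
      (trans y²≡x²k (solve 3 (λ g a k → (g :* a) :² :* k := g :* (g :* (a :* (a :* k)))) refl g a
      k))))
    a-unit : IsUnit a
    a-unit = coprime∧∣⇒unit (coprime-² (cofactors-coprime G g≢0)) (a * k , b²≡)
    a′ = proj₁ a-unit
    aa′≡1 = proj₂ a-unit

  -- Units modulo squares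

  class : Fin 4 → ℤ[θ]
  class 0F = 1#
  class 1F = - 1#
  class 2F = θ
  class 3F = - θ

  UnitClass : ℤ[θ] → Set
  UnitClass u = ∃₂ λ i η → u ≡ class i * η ²

  unitClass-* : ∀ u c (s : Fin 4 → ℤ[θ]) (i : Fin 4 → Fin 4) →
    (∀ j → c * class j ≡ class (i j) * (s j * s j)) → UnitClass u → UnitClass (c * u)
  unitClass-* _ c s i eq (j , η , refl) = i j , s j * η ,
    trans (solve 3 (λ c d η → c :* (d :* η :²) := c :* d :* η :²) refl c (class j) η)
      (trans (cong (_* (η ²)) (eq j)) (solve 3 (λ d s η → d :* s :² :* η :² := d :* (s :* η) :²)
      refl (class (i j)) (s j) η))

  unitClass-neg : ∀ {u} → UnitClass u → UnitClass (- u)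
  unitClass-neg {u} c = subst UnitClass (solve 1 (λ u → (:- con 1#) :* u := :- u) refl u)
    (unitClass-* u (- 1#) (λ _ → 1#) flip′ eq c)
    where
    flip′ : Fin 4 → Fin 4
    flip′ 0F = 1F
    flip′ 1F = 0F
    flip′ 2F = 3F
    flip′ 3F = 2F
    eq : ∀ j → - 1# * class j ≡ class (flip′ j) * 1# ²
    eq 0F = refl
    eq 1F = refl
    eq 2F = refl
    eq 3F = refl

  unitClass-θ* : ∀ {u} → UnitClass u → UnitClass (θ * u)
  unitClass-θ* {u} = unitClass-* u θ root shift eq
    where
    shift : Fin 4 → Fin 4
    shift 0F = 2F
    shift 1F = 3F
    shift 2F = 0F
    shift 3F = 1F
    root : Fin 4 → ℤ[θ]
    root 0F = 1#
    root 1F = 1#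
    root 2F = θ
    root 3F = θ
    eq : ∀ j → θ * class j ≡ class (shift j) * (root j * root j)
    eq 0F = refl
    eq 1F = refl
    eq 2F = refl
    eq 3F = refl

  unitClass-*² : ∀ {u} k → UnitClass u → UnitClass (u * k ²)
  unitClass-*² k (i , η , refl) = i , η * k , h (class i) η k
    where
    h : ∀ c η k → c * η ² * k ² ≡ c * (η * k) ²
    h = solve 3 (λ c η k → c :* η :² :* k :² := c :* (η :* k) :²) refl

  unitClass-θ*⁻¹ : ∀ {u} → UnitClass (θ * u) → UnitClass u
  unitClass-θ*⁻¹ {u} c = subst UnitClass (solve 1 (λ u → con θ :* (con θ :* u) :* con ρ :² := u)
    refl u) (unitClass-*² ρ (unitClass-θ* c))

  -- The coefficients of θ² in u, θu, θ²u satisfy the Padovan recurrence, and u is recovered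
  -- from them; ⟦ x , y , z ⟧ is the element with these three coefficients.
  ⟦_,_,_⟧ : (x y z : ℤ) → ℤ[θ]
  ⟦ x , y , z ⟧ = ⟨ z ℤ.- x , y , x ⟩

  ⟦⟧-surjective : ∀ u → ∃ λ ((x , y , z) : ℤ × ℤ × ℤ) → u ≡ ⟦ x , y , z ⟧
  ⟦⟧-surjective ⟨ p , q , r ⟩ = (r , q , p ℤ.+ r) , ⟨⟩-cong
    (ℤ-solve 2 (λ p r → p ⊜ p ⊕ r ⊖ r) refl p r) refl refl

  θ*⟦⟧ : ∀ x y z → θ * ⟦ x , y , z ⟧ ≡ ⟦ y , z , x ℤ.+ y ⟧
  θ*⟦⟧ x y z = coordinatewise (θᵖ *ᵖ ⟪ var 2F ⊖ var 0F , var 1F , var 0F ⟫)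
    ⟪ var 0F ⊕ var 1F ⊖ var 1F , var 2F , var 1F ⟫ (x ∷ y ∷ z ∷ []) refl refl refl

  -‿⟦⟧ : ∀ x y z → - ⟦ x , y , z ⟧ ≡ ⟦ ℤ.- x , ℤ.- y , ℤ.- z ⟧
  -‿⟦⟧ x y z = ⟨⟩-cong (ℤ-solve 2 (λ x z → ⊝ (z ⊖ x) ⊜ ⊝ z ⊖ ⊝ x) refl x z) refl refl

  unit⇒∣norm∣≡1 : ∀ {u} → IsUnit u → abs (norm u) ≡ 1
  unit⇒∣norm∣≡1 {u} (v , uv≡1) = ℕₚ.m*n≡1⇒m≡1 (abs (norm u)) (abs (norm v))
    (trans (sym (ℤₚ.abs-* (norm u) (norm v))) (cong abs
      (trans (sym (norm-* u v)) (cong norm uv≡1))))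

  ∣norm∣≡1⇒unit : ∀ u → abs (norm u) ≡ 1 → IsUnit u
  ∣norm∣≡1⇒unit u eq with norm u | *-adj u
  ∣norm∣≡1⇒unit u refl | + 1      | e = adj u , e
  ∣norm∣≡1⇒unit u refl | -[1+ 0 ] | e = - adj u , trans
    (solve 2 (λ u v → u :* (:- v) := :- (u :* v)) refl u (adj u)) (cong (-_) e)

  -- A certificate of nonnegativity that can be assembled along the syntax of a polynomial.
  record Nonneg (i : ℤ) : Set where
    constructor nonneg
    field
      {value} : ℕ
      ≡+      : i ≡ + value

  pos : ∀ n → Nonneg (+ n)
  pos n = nonneg refl

  nonneg-+ : ∀ {i j} → Nonneg i → Nonneg j → Nonneg (i ℤ.+ j)
  nonneg-+ (nonneg refl) (nonneg refl) = nonneg refl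

  nonneg-* : ∀ {i j} → Nonneg i → Nonneg j → Nonneg (i ℤ.* j)
  nonneg-* (nonneg {m} refl) (nonneg {n} refl) = nonneg (sym (ℤₚ.pos-* m n))

  nonneg-² : ∀ i → Nonneg (i ℤ.* i)
  nonneg-² (+ n)    = nonneg-* (pos n) (pos n)
  nonneg-² -[1+ n ] = nonneg refl

  private
    infixl 6 _⊹_
    infixl 7 _⊛_

    _⊹_ : ∀ {i j} → Nonneg i → Nonneg j → Nonneg (i ℤ.+ j)
    _⊹_ = nonneg-+

    _⊛_ : ∀ {i j} → Nonneg i → Nonneg j → Nonneg (i ℤ.* j)
    _⊛_ = nonneg-*

  private
    y³+z³-yz² : ℤ → ℤ → ℤ
    y³+z³-yz² y z = y ℤ.* y ℤ.* y ℤ.+ z ℤ.* z ℤ.* z ℤ.- y ℤ.* z ℤ.* z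

    y³+z³-yz²-nonneg : ∀ y z → Nonneg (y³+z³-yz² (+ y) (+ z))
    y³+z³-yz²-nonneg y z with ℕₚ.≤-total y z
    ... | inj₁ y≤z with ℕₚ.m≤n⇒∃[o]m+o≡n y≤z
    ...   | k , refl = subst Nonneg (ℤ-solve 2 (λ y k → y ⊗ y ⊗ y ⊕ k ⊗ ((y ⊕ k) ⊗ (y ⊕ k)) ⊜ y ⊗ y
      ⊗ y ⊕ (y ⊕ k) ⊗ (y ⊕ k) ⊗ (y ⊕ k) ⊖ y ⊗ (y ⊕ k) ⊗ (y ⊕ k)) refl (+ y) (+ k))
      (pos y ⊛ pos y ⊛ pos y ⊹ pos k ⊛ ((pos y ⊹ pos k) ⊛ (pos y ⊹ pos k)))
    y³+z³-yz²-nonneg y z | inj₂ z≤y with ℕₚ.m≤n⇒∃[o]m+o≡n z≤y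
    ...   | k , refl = subst Nonneg (ℤ-solve 2 (λ z k → z ⊗ z ⊗ z ⊕ (z ⊕ k) ⊗ (k ⊗ (z ⊕ k ⊕ z)) ⊜
      (z ⊕ k) ⊗ (z ⊕ k) ⊗ (z ⊕ k) ⊕ z ⊗ z ⊗ z ⊖ (z ⊕ k) ⊗ z ⊗ z) refl (+ z) (+ k))
      (pos z ⊛ pos z ⊛ pos z ⊹ (pos z ⊹ pos k) ⊛ (pos k ⊛ (pos z ⊹ pos k ⊹ pos z)))

  -- On the cone x, y ≥ 0, x > z ≥ 0 the norm form is positive.
  norm-cone : ∀ d y z →
    ∃[ M ] Nonneg M × norm ⟦ + z ℤ.+ (+ 1 ℤ.+ + d) , + y , + z ⟧ ≡ + 1 ℤ.+ + d ℤ.+ + y ℤ.+ + z ℤ.+ M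
  norm-cone d y z = _ , rest (pos d) (pos y) (pos z) ⊹ y³+z³-yz²-nonneg y z , expand (+ d) (+ y)
    (+ z)
    where
    rest : ∀ {d y z} → Nonneg d → Nonneg y → Nonneg z → Nonneg
      (d ℤ.* d ℤ.* d ℤ.+ + 3 ℤ.* d ℤ.* d ℤ.+ + 2 ℤ.* d
       ℤ.+ (+ 2 ℤ.* z ℤ.+ + 6 ℤ.* d ℤ.* z ℤ.+ + 3 ℤ.* d ℤ.* d ℤ.* z)
       ℤ.+ (y ℤ.+ + 4 ℤ.* d ℤ.* y ℤ.+ + 2 ℤ.* d ℤ.* d ℤ.* y)
       ℤ.+ (+ 1 ℤ.+ d) ℤ.* (+ 2 ℤ.* z ℤ.* z ℤ.+ y ℤ.* y ℤ.+ y ℤ.* z))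
    rest d y z =
      d ⊛ d ⊛ d ⊹ pos 3 ⊛ d ⊛ d ⊹ pos 2 ⊛ d
      ⊹ (pos 2 ⊛ z ⊹ pos 6 ⊛ d ⊛ z ⊹ pos 3 ⊛ d ⊛ d ⊛ z)
      ⊹ (y ⊹ pos 4 ⊛ d ⊛ y ⊹ pos 2 ⊛ d ⊛ d ⊛ y)
      ⊹ (pos 1 ⊹ d) ⊛ (pos 2 ⊛ z ⊛ z ⊹ y ⊛ y ⊹ y ⊛ z)

    expand : ∀ d y z → norm ⟦ z ℤ.+ (+ 1 ℤ.+ d) , y , z ⟧ ≡ + 1 ℤ.+ d ℤ.+ y ℤ.+ z ℤ.+
      (d ℤ.* d ℤ.* d ℤ.+ + 3 ℤ.* d ℤ.* d ℤ.+ + 2 ℤ.* d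
       ℤ.+ (+ 2 ℤ.* z ℤ.+ + 6 ℤ.* d ℤ.* z ℤ.+ + 3 ℤ.* d ℤ.* d ℤ.* z)
       ℤ.+ (y ℤ.+ + 4 ℤ.* d ℤ.* y ℤ.+ + 2 ℤ.* d ℤ.* d ℤ.* y)
       ℤ.+ (+ 1 ℤ.+ d) ℤ.* (+ 2 ℤ.* z ℤ.* z ℤ.+ y ℤ.* y ℤ.+ y ℤ.* z)
       ℤ.+ y³+z³-yz² y z)
    expand = ℤ-solve 3 (λ d y z → normᵖ ⟪ z ⊖ (z ⊕ (# 1 ⊕ d)) , y , z ⊕ (# 1 ⊕ d) ⟫
      ⊜ # 1 ⊕ d ⊕ y ⊕ z ⊕
      (d ⊗ d ⊗ d ⊕ # 3 ⊗ d ⊗ d ⊕ # 2 ⊗ d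
       ⊕ (# 2 ⊗ z ⊕ # 6 ⊗ d ⊗ z ⊕ # 3 ⊗ d ⊗ d ⊗ z)
       ⊕ (y ⊕ # 4 ⊗ d ⊗ y ⊕ # 2 ⊗ d ⊗ d ⊗ y)
       ⊕ (# 1 ⊕ d) ⊗ (# 2 ⊗ z ⊗ z ⊕ y ⊗ y ⊕ y ⊗ z)
       ⊕ (y ⊗ y ⊗ y ⊕ z ⊗ z ⊗ z ⊖ y ⊗ z ⊗ z))) refl

  -- Norm 1 leaves only d = y = z = 0, and this element is ρ = θ ρ².
  unitClass-cone : ∀ d y z → IsUnit ⟦ + (z ℕ.+ suc d) , + y , + z ⟧ → UnitClass ⟦ + (z ℕ.+ suc d) ,
    + y , + z ⟧
  unitClass-cone d y z unit = conclude (norm-cone d y z)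
    where
    lemma : ∀ d y z {m} → suc d ℕ.+ y ℕ.+ z ℕ.+ m ≡ 1 → UnitClass ⟦ + (z ℕ.+ suc d) , + y , + z ⟧
    lemma zero zero zero _ = 2F , ρ , refl

    conclude : (∃[ M ] Nonneg M × norm ⟦ + (z ℕ.+ suc d) , + y , + z ⟧ ≡ + (suc d ℕ.+ y ℕ.+ z) ℤ.+
      M) →
      UnitClass ⟦ + (z ℕ.+ suc d) , + y , + z ⟧
    conclude (_ , nonneg refl , eq) = lemma d y z (trans (cong abs (sym eq)) (unit⇒∣norm∣≡1 unit))

  -- Division by θ runs the recurrence backwards, and the coordinates stay nonnegative until z < x,
  -- where the norm form decides. With the weights 3, 5, 4 the step from (x, y, x + k) to (k, x, y)
  -- decreases the measure by 2x + y + k.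
  unitClass-nonneg : ∀ x y z → IsUnit ⟦ + x , + y , + z ⟧ → UnitClass ⟦ + x , + y , + z ⟧
  unitClass-nonneg x y z = go x y z (<-wellFounded _)
    where
    smaller : ∀ x y k → 0 ℕ.< x ℕ.+ y ℕ.+ k →
      3 ℕ.* k ℕ.+ 5 ℕ.* x ℕ.+ 4 ℕ.* y ℕ.< 3 ℕ.* x ℕ.+ 5 ℕ.* y ℕ.+ 4 ℕ.* (x ℕ.+ k)
    smaller x y k 0< = subst (3 ℕ.* k ℕ.+ 5 ℕ.* x ℕ.+ 4 ℕ.* y ℕ.<_) (sym (h x y k))
      (ℕₚ.m<m+n _ (ℕₚ.<-≤-trans 0< (ℕₚ.m≤m+n _ x)))
      where
      h : ∀ x y k → 3 ℕ.* x ℕ.+ 5 ℕ.* y ℕ.+ 4 ℕ.* (x ℕ.+ k)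
        ≡ 3 ℕ.* k ℕ.+ 5 ℕ.* x ℕ.+ 4 ℕ.* y ℕ.+ (x ℕ.+ y ℕ.+ k ℕ.+ x)
      h = ℕ-solve 3 (λ x y k → κ 3 ⊠ x ⊞ κ 5 ⊠ y ⊞ κ 4 ⊠ (x ⊞ k)
        ≜ κ 3 ⊠ k ⊞ κ 5 ⊠ x ⊞ κ 4 ⊠ y ⊞ (x ⊞ y ⊞ k ⊞ x)) refl

    nonzero : ∀ x y k → IsUnit ⟦ + x , + y , + (x ℕ.+ k) ⟧ → 0 ℕ.< x ℕ.+ y ℕ.+ k
    nonzero zero    zero    zero    unit = contradiction refl (unit≢0 unit)
    nonzero zero    zero    (suc _) _    = s≤s z≤n
    nonzero zero    (suc _) _       _    = s≤s z≤n
    nonzero (suc _) _       _       _    = s≤s z≤n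

    back : ∀ x y k → θ * ⟦ + k , + x , + y ⟧ ≡ ⟦ + x , + y , + (x ℕ.+ k) ⟧
    back x y k = trans (θ*⟦⟧ (+ k) (+ x) (+ y)) (cong (λ t → ⟦ + x , + y , + t ⟧) (ℕₚ.+-comm k x))

    go : ∀ x y z → Acc ℕ._<_ (3 ℕ.* x ℕ.+ 5 ℕ.* y ℕ.+ 4 ℕ.* z) →
      IsUnit ⟦ + x , + y , + z ⟧ → UnitClass ⟦ + x , + y , + z ⟧
    go x y z (acc rs) unit with ℕₚ.<-≤-connex z x
    ... | inj₁ z<x with ℕₚ.m≤n⇒∃[o]m+o≡n z<x
    ...   | d , refl = subst (λ x → IsUnit ⟦ + x , + y , + z ⟧ → UnitClass ⟦ + x , + y , + z ⟧)
      (ℕₚ.+-suc z d) (unitClass-cone d y z) unit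
    go x y z (acc rs) unit | inj₂ x≤z with ℕₚ.m≤n⇒∃[o]m+o≡n x≤z
    ...   | k , refl = subst UnitClass (back x y k) (unitClass-θ*
      (go k x y (rs (smaller x y k (nonzero x y k unit)))
        (unit-∣ (θ , trans (sym (back x y k)) (*-comm θ ⟦ + k , + x , + y ⟧)) unit)))

  -- A Lyapunov function for the Padovan recurrence outside the octants x, y, z ≥ 0 and
  -- x, y, z ≤ 0: it is positive definite, and decreases by (x - z)² + y² - 2xy and by
  -- (x - y)² + z² - 2xz, one of which is positive there.
  energy : (x y z : ℤ) → ℤ
  energy x y z = + 6 ℤ.* x ℤ.* x ℤ.+ + 4 ℤ.* y ℤ.* y ℤ.+ + 5 ℤ.* z ℤ.* z ℤ.- + 6 ℤ.* y ℤ.* z ℤ.- + 8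
    ℤ.* x ℤ.* z

  private
    E : ∀ {n} (x y z : Polynomial n) → Polynomial n
    E x y z = # 6 ⊗ x ⊗ x ⊕ # 4 ⊗ y ⊗ y ⊕ # 5 ⊗ z ⊗ z ⊖ # 6 ⊗ y ⊗ z ⊖ # 8 ⊗ x ⊗ z

  -- Completing squares: 24 times the energy is 6 (4y - 3z)² + (12x - 8z)² + 2z².
  energy-nonneg : ∀ x y z → Nonneg (energy x y z)
  energy-nonneg x y z = nonneg (sym (ℤₚ.0≤i⇒+∣i∣≡i (ℤₚ.*-cancelˡ-≤-pos (+ 0) (energy x y z) (+ 24)
    (subst (+ 0 ℤ.≤_) (ℤ-solve 3 (λ x y z → # 6 ⊗ ((# 4 ⊗ y ⊖ # 3 ⊗ z) ⊗ (# 4 ⊗ y ⊖ # 3 ⊗ z)) ⊕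
      (# 12 ⊗ x ⊖ # 8 ⊗ z) ⊗ (# 12 ⊗ x ⊖ # 8 ⊗ z) ⊕ # 2 ⊗ (z ⊗ z) ⊜ # 24 ⊗
      (# 6 ⊗ x ⊗ x ⊕ # 4 ⊗ y ⊗ y ⊕ # 5 ⊗ z ⊗ z ⊖ # 6 ⊗ y ⊗ z ⊖ # 8 ⊗ x ⊗ z)) refl x y z) (nonneg⇒0≤
      (pos 6 ⊛ nonneg-² (+ 4 ℤ.* y ℤ.- + 3 ℤ.* z) ⊹ nonneg-² (+ 12 ℤ.* x ℤ.- + 8 ℤ.* z) ⊹ pos 2 ⊛
        nonneg-² z))))))
    where
    nonneg⇒0≤ : ∀ {i} → Nonneg i → + 0 ℤ.≤ i
    nonneg⇒0≤ (nonneg refl) = ℤ.+≤+ z≤n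

  decrease : ∀ {E E′ e} → Nonneg E′ → Nonneg e → E ≡ E′ ℤ.+ (+ 1 ℤ.+ e) → abs E′ ℕ.< abs E
  decrease (nonneg {m} refl) (nonneg refl) refl = ℕₚ.m<m+n m (s≤s z≤n)

  energy-<-y : ∀ x y z {e} → Nonneg e → y ℤ.* y ℤ.- + 2 ℤ.* (x ℤ.* y) ≡ + 1 ℤ.+ e →
    abs (energy y z (x ℤ.+ y)) ℕ.< abs (energy x y z)
  energy-<-y x y z {e} e≥0 eq = decrease (energy-nonneg y z (x ℤ.+ y)) (nonneg-² (x ℤ.- z) ⊹ e≥0)
    (trans (h x y z) (trans (cong (λ t → energy y z (x ℤ.+ y) ℤ.+ ((x ℤ.- z) ℤ.* (x ℤ.- z) ℤ.+ t))
      eq) (ℤ-solve 3 (λ a b e → a ⊕ (b ⊕ (# 1 ⊕ e)) ⊜ a ⊕ (# 1 ⊕ (b ⊕ e))) refl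
      (energy y z (x ℤ.+ y)) ((x ℤ.- z) ℤ.* (x ℤ.- z)) e)))
    where
    h : ∀ x y z → energy x y z ≡ energy y z (x ℤ.+ y) ℤ.+
      ((x ℤ.- z) ℤ.* (x ℤ.- z) ℤ.+ (y ℤ.* y ℤ.- + 2 ℤ.* (x ℤ.* y)))
    h = ℤ-solve 3 (λ x y z → E x y z ⊜ E y z (x ⊕ y) ⊕
      ((x ⊖ z) ⊗ (x ⊖ z) ⊕ (y ⊗ y ⊖ # 2 ⊗ (x ⊗ y)))) refl

  energy-<-z : ∀ x y z {e} → Nonneg e → z ℤ.* z ℤ.- + 2 ℤ.* (x ℤ.* z) ≡ + 1 ℤ.+ e →
    abs (energy y z (x ℤ.+ y)) ℕ.< abs (energy x y z)
  energy-<-z x y z {e} e≥0 eq = decrease (energy-nonneg y z (x ℤ.+ y)) (nonneg-² (x ℤ.- y) ⊹ e≥0)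
    (trans (h x y z) (trans (cong (λ t → energy y z (x ℤ.+ y) ℤ.+ ((x ℤ.- y) ℤ.* (x ℤ.- y) ℤ.+ t))
      eq) (ℤ-solve 3 (λ a b e → a ⊕ (b ⊕ (# 1 ⊕ e)) ⊜ a ⊕ (# 1 ⊕ (b ⊕ e))) refl
      (energy y z (x ℤ.+ y)) ((x ℤ.- y) ℤ.* (x ℤ.- y)) e)))
    where
    h : ∀ x y z → energy x y z ≡ energy y z (x ℤ.+ y) ℤ.+
      ((x ℤ.- y) ℤ.* (x ℤ.- y) ℤ.+ (z ℤ.* z ℤ.- + 2 ℤ.* (x ℤ.* z)))
    h = ℤ-solve 3 (λ x y z → E x y z ⊜ E y z (x ⊕ y) ⊕
      ((x ⊖ y) ⊗ (x ⊖ y) ⊕ (z ⊗ z ⊖ # 2 ⊗ (x ⊗ z)))) refl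

  -- With x = ± a and y = ∓ (1 + b), both sides are b² + 2b + 1 + 2a(1 + b).
  opposite-signs⁻ : ∀ a b → -[1+ b ] ℤ.* -[1+ b ] ℤ.- + 2 ℤ.* (+ a ℤ.* -[1+ b ])
    ≡ + 1 ℤ.+ (+ b ℤ.* + b ℤ.+ + 2 ℤ.* + b ℤ.+ + 2 ℤ.* (+ a ℤ.* (+ 1 ℤ.+ + b)))
  opposite-signs⁻ a b = h (+ a) (+ b)
    where
    h : ∀ a b → ℤ.- (+ 1 ℤ.+ b) ℤ.* ℤ.- (+ 1 ℤ.+ b) ℤ.- + 2 ℤ.* (a ℤ.* ℤ.- (+ 1 ℤ.+ b))
      ≡ + 1 ℤ.+ (b ℤ.* b ℤ.+ + 2 ℤ.* b ℤ.+ + 2 ℤ.* (a ℤ.* (+ 1 ℤ.+ b)))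
    h = ℤ-solve 2 (λ a b → ⊝ (# 1 ⊕ b) ⊗ ⊝ (# 1 ⊕ b) ⊖ # 2 ⊗ (a ⊗ ⊝ (# 1 ⊕ b)) ⊜ K
      (+ 1) ⊕ (b ⊗ b ⊕ # 2 ⊗ b ⊕ # 2 ⊗ (a ⊗ (# 1 ⊕ b)))) refl

  opposite-signs⁺ : ∀ a b → + suc b ℤ.* + suc b ℤ.- + 2 ℤ.* (-[1+ a ] ℤ.* + suc b)
    ≡ + 1 ℤ.+ (+ b ℤ.* + b ℤ.+ + 2 ℤ.* + b ℤ.+ + 2 ℤ.* (+ suc a ℤ.* (+ 1 ℤ.+ + b)))
  opposite-signs⁺ a b = h (+ suc a) (+ b)
    where
    h : ∀ a b → (+ 1 ℤ.+ b) ℤ.* (+ 1 ℤ.+ b) ℤ.- + 2 ℤ.* (ℤ.- a ℤ.* (+ 1 ℤ.+ b))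
      ≡ + 1 ℤ.+ (b ℤ.* b ℤ.+ + 2 ℤ.* b ℤ.+ + 2 ℤ.* (a ℤ.* (+ 1 ℤ.+ b)))
    h = ℤ-solve 2 (λ a b → (# 1 ⊕ b) ⊗ (# 1 ⊕ b) ⊖ # 2 ⊗ (⊝ a ⊗ (# 1 ⊕ b)) ⊜ # 1
      ⊕ (b ⊗ b ⊕ # 2 ⊗ b ⊕ # 2 ⊗ (a ⊗ (# 1 ⊕ b)))) refl

  opposite-signs-nonneg : ∀ a b → Nonneg (+ b ℤ.* + b ℤ.+ + 2 ℤ.* + b ℤ.+ + 2 ℤ.*
    (+ a ℤ.* (+ 1 ℤ.+ + b)))
  opposite-signs-nonneg a b = pos b ⊛ pos b ⊹ pos 2 ⊛ pos b ⊹ pos 2 ⊛ (pos a ⊛ (pos 1 ⊹ pos b))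

  -- Multiplication by θ is iterated until the three coordinates have one sign: θ exceeds 1 and its
  -- conjugates have absolute value below 1, so the real embedding finally dominates. The energy
  -- turns this into a well-founded recursion.
  unit⇒unitClass : ∀ {u} → IsUnit u → UnitClass u
  unit⇒unitClass {u} unit with ⟦⟧-surjective u
  ... | (x , y , z) , refl = go x y z (<-wellFounded _) unit
    where
    go : ∀ x y z → Acc ℕ._<_ (abs (energy x y z)) → IsUnit ⟦ x , y , z ⟧ → UnitClass ⟦ x , y , z ⟧
    next : ∀ x y z → Acc ℕ._<_ (abs (energy x y z)) → abs (energy y z (x ℤ.+ y)) ℕ.< abs
      (energy x y z) →
      IsUnit ⟦ x , y , z ⟧ → UnitClass ⟦ x , y , z ⟧

    nonpos : ∀ x y z a b c → ℤ.- x ≡ + a → ℤ.- y ≡ + b → ℤ.- z ≡ + c → IsUnit ⟦ x , y , z ⟧ →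
      UnitClass ⟦ x , y , z ⟧
    nonpos x y z a b c x≡ y≡ z≡ unit = subst UnitClass
      (solve 1 (λ x → :- (:- x) := x) refl (⟦ x , y , z ⟧))
      (unitClass-neg (subst UnitClass (sym eq) (unitClass-nonneg a b c
        (subst IsUnit eq (neg-unit unit)))))
      where
      eq : - ⟦ x , y , z ⟧ ≡ ⟦ + a , + b , + c ⟧
      eq = trans (-‿⟦⟧ x y z) (⟨⟩-cong (cong₂ ℤ._-_ z≡ x≡) y≡ x≡)
      neg-unit : ∀ {u} → IsUnit u → IsUnit (- u)
      neg-unit {u} (v , uv≡1) = - v , trans (solve 2 (λ u v → (:- u) :* (:- v) := u :* v) refl u v)
        uv≡1

    next x y z (acc rs) lt unit = unitClass-θ*⁻¹ (subst UnitClass (sym (θ*⟦⟧ x y z))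
      (go y z (x ℤ.+ y) (rs lt) (subst IsUnit (θ*⟦⟧ x y z)
        (unit-* {θ} {⟦ x , y , z ⟧} (ρ , refl) unit))))

    go x@(+ a) y@(-[1+ b ]) z r =
      next x y z r (energy-<-y x y z (opposite-signs-nonneg a b) (opposite-signs⁻ a b))
    go x@(+ a) y@(+ b) z@(-[1+ c ]) r =
      next x y z r (energy-<-z x y z (opposite-signs-nonneg a c) (opposite-signs⁻ a c))
    go (+ a) (+ b) (+ c) _ = unitClass-nonneg a b c
    go x@(-[1+ a ]) y@(+ suc b) z r =
      next x y z r (energy-<-y x y z (opposite-signs-nonneg (suc a) b) (opposite-signs⁺ a b))
    go x@(-[1+ a ]) y@(+ 0) z@(+ suc c) r =
      next x y z r (energy-<-z x y z (opposite-signs-nonneg (suc a) c) (opposite-signs⁺ a c))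
    go x@(-[1+ a ]) y@(-[1+ b ]) z@(+ suc c) r =
      next x y z r (energy-<-z x y z (opposite-signs-nonneg (suc a) c) (opposite-signs⁺ a c))
    go x@(-[1+ a ]) y@(+ 0) z@(+ 0) _ = nonpos x y z (suc a) 0 0 refl refl refl
    go x@(-[1+ a ]) y@(+ 0) z@(-[1+ c ]) _ = nonpos x y z (suc a) 0 (suc c) refl refl refl
    go x@(-[1+ a ]) y@(-[1+ b ]) z@(+ 0) _ = nonpos x y z (suc a) (suc b) 0 refl refl refl
    go x@(-[1+ a ]) y@(-[1+ b ]) z@(-[1+ c ]) _ = nonpos x y z (suc a) (suc b) (suc c) refl refl
      refl

  -- Elimination of hypotheses a ≡ b with explicit cofactors k, so that the remaining goal is an
  -- identity for the ring solver.
  use₁ : ∀ {a b x w} k → a ≡ b → x ≡ w + k * (a - b) → x ≡ w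
  use₁ {a} {w = w} k refl eq = trans eq (solve 3 (λ a w k → w :+ k :* (a :- a) := w) refl a w k)

  use₂ : ∀ {a b a′ b′ x w} k k′ → a ≡ b → a′ ≡ b′ → x ≡ w + k * (a - b) + k′ * (a′ - b′) → x ≡ w
  use₂ k k′ e e′ eq = use₁ k e (use₁ k′ e′ eq)

  use₃ : ∀ {a b a′ b′ a″ b″ x w} k k′ k″ → a ≡ b → a′ ≡ b′ → a″ ≡ b″ →
    x ≡ w + k * (a - b) + k′ * (a′ - b′) + k″ * (a″ - b″) → x ≡ w
  use₃ k k′ k″ e e′ e″ eq = use₂ k k′ e e′ (use₁ k″ e″ eq)

  -- Parity and squares modulo 4

  odd⇒coprime-2 : ∀ {x} → Odd x → Coprime x 2#
  odd⇒coprime-2 {x} odd with inverse-mod-2 x odd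
  ... | y , k , xy≡1+2k = y , - k , use₁ 1# xy≡1+2k
    (solve 3 (λ x y k → y :* x :+ (:- k) :* con 2# := con 1# :+ con 1# :*
    (x :* y :- (con 1# :+ con 2# :* k))) refl x y k)

  coprime-2⇒odd : ∀ {x} → Coprime x 2# → Odd x
  coprime-2⇒odd c 2∣x = contradiction (unit⇒∣norm∣≡1 (coprime∧∣⇒unit (coprime-sym c) 2∣x)) λ ()

  odd-* : ∀ {x y} → Odd x → Odd y → Odd (x * y)
  odd-* ox oy = coprime-2⇒odd (coprime-sym (coprime-* (coprime-sym (odd⇒coprime-2 ox))
    (coprime-sym (odd⇒coprime-2 oy))))

  odd-factor : ∀ {x} y → Odd (x * y) → Odd x
  odd-factor y oxy = oxy ∘ ∣-* y

  unit⇒odd : ∀ {x} → IsUnit x → Odd x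
  unit⇒odd u = coprime-2⇒odd (unit⇒coprime 2# u)

  even-cancel : ∀ {x y} → Odd x → 2# ∣ x * y → 2# ∣ y
  even-cancel odd = coprime∧∣*⇒∣ (coprime-sym (odd⇒coprime-2 odd))

  even-² : ∀ x → 2# ∣ x ² → 2# ∣ x
  even-² x 2∣x² with even? x
  ... | yes 2∣x = 2∣x
  ... | no  odd = even-cancel odd 2∣x²

  odd≢0 : ∀ {x} → Odd x → x ≢ 0#
  odd≢0 odd refl = odd (0# , refl)

  odd-resp : ∀ {x y} → 2# ∣ x - y → Odd y → Odd x
  odd-resp {x} {y} 2∣x-y odd 2∣x = odd (subst (2# ∣_)
    (solve 2 (λ x y → x :+ (:- (x :- y)) := y) refl x y) (∣-+ 2∣x (∣-neg 2∣x-y)))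

  -- The square of z / x modulo 4 depends only on z / x modulo 2, so finitely many residues remain
  -- to be tested.
  square-mod-4 : ∀ {c x z k} → Odd x → z ² ≡ c * x ² + 4# * k → ∃[ j ] 4# ∣ residue j * residue j
    - c
  square-mod-4 {c} {x} {z} {k} odd z²≡ = conclude (inverse-mod-2 x odd)
    where
    conclude : (∃₂ λ y m → x * y ≡ 1# + 2# * m) → ∃[ j ] 4# ∣ residue j * residue j - c
    conclude (y , m , xy≡) = result (residue-of (z * y))
      where
      result : (∃₂ λ j l → z * y ≡ residue j + 2# * l) → ∃[ j ] 4# ∣ residue j * residue j - c
      result (j , l , zy≡) = j , c * (m + m ²) + k * y * y - residue j * l - l ² ,
        use₃ (y ²) (- (z * y + (residue j + 2# * l))) (c * (x * y + (1# + 2# * m))) z²≡ zy≡ xy≡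
          (solve 8 (λ c x z k y m r l → r :² :- c := con 4# :*
          (c :* (m :+ m :²) :+ k :* y :* y :- r :* l :- l :²) :+ y :² :*
          (z :² :- (c :* x :² :+ con 4# :* k)) :+ (:- (z :* y :+ (r :+ con 2# :* l))) :*
          (z :* y :- (r :+ con 2# :* l)) :+ c :* (x :* y :+ (con 1# :+ con 2# :* m)) :*
          (x :* y :- (con 1# :+ con 2# :* m))) refl c x z k y m (residue j) l)

  record SquareUnit (ε : ℤ[θ]) : Set where
    constructor squareUnit
    field
      η η′ : ℤ[θ]
      ηη′≡1 : η * η′ ≡ 1#
      ε≡η² : ε ≡ η ²

  -- None of - 1, θ, - θ is a square modulo 4, by inspection of the eight residues; only the trivial
  -- class survives.
  square-mod-4⇒square : ∀ {ε x z k} → IsUnit ε → Odd x → z ² ≡ ε * x ² + 4# * k → SquareUnit ε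
  square-mod-4⇒square {ε} {x} {z} {k} unit odd z²≡ = conclude (unit⇒unitClass unit)
    where
    check : ∀ i → i ≡ 0F ⊎ (∀ j → ¬ 4# ∣ residue j * residue j - class i)
    check 0F = inj₁ refl
    check 1F = inj₂ (from-yes (all? λ j → ¬? (ι∣? (+ 4) (residue j * residue j - class 1F))))
    check 2F = inj₂ (from-yes (all? λ j → ¬? (ι∣? (+ 4) (residue j * residue j - class 2F))))
    check 3F = inj₂ (from-yes (all? λ j → ¬? (ι∣? (+ 4) (residue j * residue j - class 3F))))

    h₁ : ∀ c η → c * η ² ≡ η * (η * c)
    h₁ = solve 2 (λ c η → c :* η :² := η :* (η :* c)) refl

    conclude : UnitClass ε → SquareUnit ε
    conclude (i , η , refl) = result (check i)
      where
      η-unit : IsUnit η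
      η-unit = unit-∣ (η * class i , h₁ (class i) η) unit
      result : i ≡ 0F ⊎ (∀ j → ¬ 4# ∣ residue j * residue j - class i) → SquareUnit (class i * η ²)
      result (inj₁ refl) = squareUnit η (proj₁ η-unit) (proj₂ η-unit)
        (solve 1 (λ x → con 1# :* x := x) refl (η ²))
      result (inj₂ no-j) = ⊥-elim (refute (square-mod-4 (odd-* (unit⇒odd η-unit) odd)
        (trans z²≡ (solve 4 (λ c η x k → c :* η :² :* x :² :+ con 4# :* k := c :* (η :* x) :² :+
        con 4# :* k) refl (class i) η x k))))
        where
        refute : ¬ (∃[ j ] 4# ∣ residue j * residue j - class i)
        refute (j , d) = no-j j d

  -- Exclusion of the class of - π

  record FourNumbers (a₁ a₂ b₁ b₂ : ℤ[θ]) : Set where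
    constructor fourNumbers
    field
      i j k l : ℤ[θ]
      a₁≡ : a₁ ≡ i * j
      a₂≡ : a₂ ≡ k * l
      b₁≡ : b₁ ≡ i * k
      b₂≡ : b₂ ≡ j * l
      coprime : Coprime j k

  -- Euler's four number theorem, with i the gcd of a₁ and b₁.
  four-numbers : ∀ {a₁ a₂ b₁ b₂} → a₁ ≢ 0# → a₂ ≢ 0# → a₁ * a₂ ≡ b₁ * b₂ → FourNumbers a₁ a₂ b₁ b₂
  four-numbers {a₁} {a₂} {b₁} {b₂} a₁≢0 a₂≢0 eq = conclude (gcd a₁ b₁) a₁≢0 eq
    where
    conclude : Bézout a₁ b₁ → a₁ ≢ 0# → a₁ * a₂ ≡ b₁ * b₂ → FourNumbers a₁ a₂ b₁ b₂
    conclude B@(bézout i j k u v refl refl _) a₁≢0 eq =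
      result (coprime∧∣*⇒∣ (coprime-sym (cofactors-coprime B i≢0)) (b₂ , ja₂≡kb₂))
      where
      i≢0 : i ≢ 0#
      i≢0 = factor≢0 i j a₁≢0
      ja₂≡kb₂ : j * a₂ ≡ k * b₂
      ja₂≡kb₂ = *-cancelˡ i i≢0 (trans (sym (*-assoc i j a₂)) (trans eq (*-assoc i k b₂)))
      result : k ∣ a₂ → FourNumbers (i * j) a₂ (i * k) b₂
      result (l , a₂≡kl) = fourNumbers i j k l refl a₂≡kl refl
        (sym (*-cancelˡ k (factor≢0 k l (a₂≢0 ∘ trans a₂≡kl))
          (trans (solve 3 (λ j k l → k :* (j :* l) := j :* (k :* l)) refl j k l)
          (trans (cong (j *_) (sym a₂≡kl)) ja₂≡kb₂))))
        (cofactors-coprime B i≢0)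

  2≢0 : 2# ≢ 0#
  2≢0 ()

  -- The 2-covering given by 2 r² = h (j² + k²), 2 θ τ t² - ρ r² = h j (k + θ² j) has no 2-adic
  -- points with t even, or with τ t² ≡ θ² r² mod 2.
  pi-covering : ∀ {τ τ′ r t h j k} → τ * τ′ ≡ 1# → Coprime r t → Odd h → Odd j →
    2# * r ² ≡ h * (j ² + k ²) →
    2# * θ * τ * t ² - ρ * r ² ≡ h * (j * (k + θ² * j)) →
    2# ∣ t ⊎ 2# ∣ τ * t ² - θ² * r ² → ⊥
  pi-covering {τ} {τ′} {r} {t} {h} {j} {k} ττ′≡1 crt oh oj eq₁ eq₂ cond = go₁ k-j-even
    where
    k-j-even : 2# ∣ k - j
    k-j-even = even-² (k - j) (subst (2# ∣_) (solve 2
      (λ j k → (j :² :+ k :²) :+ (:- (con 2# :* (j :* k))) := (k :- j) :* (k :- j)) refl j k)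
      (∣-+ (even-cancel oh (r ² , sym eq₁)) (- (j * k) , e₁ j k)))
      where
      e₁ : ∀ j k → - (2# * (j * k)) ≡ 2# * (- (j * k))
      e₁ = solve 2 (λ j k → :- (con 2# :* (j :* k)) := con 2# :* (:- (j :* k))) refl

    go₁ : 2# ∣ k - j → ⊥
    go₁ (n , k-j≡2n) = go₂ (inverse-mod-2 j oj) (unit⇒unitClass h-unit)
      where
      -- With k = j + 2 n the first equation is divisible by 2, and so is the sum of the first
      -- equation and θ times the second, which gives the form `F`.
      r²≡ : r * r ≡ h * (j ² + 2# * (j * n) + 2# * n ²)
      r²≡ = *-cancelˡ 2# 2≢0 (use₂ 1# (h * (k + j + 2# * n)) eq₁ k-j≡2n
        (solve 5 (λ r h j k n → con 2# :* r :² := con 2# :*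
        (h :* (j :² :+ con 2# :* (j :* n) :+ con 2# :* n :²)) :+ con 1# :*
        (con 2# :* r :² :- h :* (j :² :+ k :²)) :+ h :* (k :+ j :+ con 2# :* n) :*
        (k :- j :- con 2# :* n)) refl r h j k n))

      F : ℤ[θ] → ℤ[θ] → ℤ[θ]
      F j n = (1# + θ) * j ² + (1# + θ) * (j * n) + n ²

      τt²≡ : θ * θ * τ * t ² ≡ h * F j n
      τt²≡ = *-cancelˡ 2# 2≢0 (use₃ θ 1# (θ * h * j) eq₂ r²≡ k-j≡2n
        (solve 7 (λ r t τ h j k n → con 2# :* (con θ² :* τ :* t :²) := con 2# :*
        (h :* ((con 1# :+ con θ) :* j :² :+ (con 1# :+ con θ) :* (j :* n) :+ n :²)) :+ con θ :*
        (con 2# :* con θ :* τ :* t :² :- con ρ :* r :² :- h :* (j :* (k :+ con θ² :* j))) :+ con 1#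
        :* (r :² :- h :* (j :² :+ con 2# :* (j :* n) :+ con 2# :* n :²)) :+ con θ :* h :* j :*
        (k :- j :- con 2# :* n)) refl r t τ h j k n))

      -- h divides both r² and θ² τ t², and these are coprime.
      h-unit : IsUnit h
      h-unit = coprime∧∣⇒unit (coprime-sym (coprime-factorʳ _
        (subst (Coprime (t ²)) r²≡ (coprime-² (coprime-sym (coprime-² crt))))))
        (F j n * ρ * ρ * τ′ , use₂ (ρ ² * τ′) (- (t ²)) τt²≡ ττ′≡1
          (solve 5 (λ τ τ′ t h f → t :² := h :* (f :* con ρ :* con ρ :* τ′) :+ con ρ :² :* τ′ :*
          (con θ² :* τ :* t :² :- h :* f) :+ (:- (t :²)) :* (τ :* τ′ :- con 1#)) refl τ τ′ t h
          (F j n)))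

      go₂ : (∃₂ λ y m → j * y ≡ 1# + 2# * m) → UnitClass h → ⊥
      go₂ (y , m , jy≡) (i , η , h≡) = go₃ (residue-of (n * y))
        where
        go₃ : (∃₂ λ e l → n * y ≡ residue e + 2# * l) → ⊥
        go₃ (e , l , ny≡) = [ even , odd ]′ cond
          where
          x = residue e
          G : ℤ[θ] → ℤ[θ]
          G x = 1# + 2# * x + 2# * x ²

          -- x is the residue of n / j modulo 2. Up to odd squares, `F` modulo 2 and r² modulo 4 now
          -- depend only on x and on the class of the unit h.
          n≡ : n ≡ x * j + 2# * (l * j - n * m)
          n≡ = use₂ (- n) j jy≡ ny≡ (solve 6 (λ n x j l m y → n := x :* j :+ con 2# :*
            (l :* j :- n :* m) :+ (:- n) :* (j :* y :- (con 1# :+ con 2# :* m)) :+ j :*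
            (n :* y :- (x :+ con 2# :* l))) refl n x j l m y)

          d = l * j - n * m

          F≡ : F j n ≡ j ² * F 1# x + 2# * ((1# + θ) * j * d + 2# * (x * j * d) + 2# * d ²)
          F≡ = use₁ ((1# + θ) * j + n + (x * j + 2# * d)) n≡
            (solve 4 (λ n x j d → (con 1# :+ con θ) :* j :² :+ (con 1# :+ con θ) :* (j :* n) :+ n :²
            := j :² :* ((con 1# :+ con θ) :* con 1# :² :+ (con 1# :+ con θ) :* (con 1# :* x) :+ x
            :²) :+ con 2# :* ((con 1# :+ con θ) :* j :* d :+ con 2# :* (x :* j :* d) :+ con 2# :* d
            :²) :+ ((con 1# :+ con θ) :* j :+ n :+ (x :* j :+ con 2# :* d)) :*
            (n :- (x :* j :+ con 2# :* d))) refl n x j d)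

          r²≡c : r * r ≡ class i * G x * (η * j) ² + 4# *
            (h * (j * d + 2# * (x * j * d) + 2# * d ²))
          r²≡c = use₃ 1# (h * (2# * j + 2# * (n + (x * j + 2# * d)))) (j ² * G x) r²≡ n≡ h≡
            (solve 8 (λ c r h j n x d η → r :² := c :* (con 1# :+ con 2# :* x :+ con 2# :* x :²) :*
            (η :* j) :² :+ con 4# :* (h :* (j :* d :+ con 2# :* (x :* j :* d) :+ con 2# :* d :²)) :+
            con 1# :* (r :² :- h :* (j :² :+ con 2# :* (j :* n) :+ con 2# :* n :²)) :+ h :*
            (con 2# :* j :+ con 2# :* (n :+ (x :* j :+ con 2# :* d))) :*
            (n :- (x :* j :+ con 2# :* d)) :+ j :² :* (con 1# :+ con 2# :* x :+ con 2# :* x :²) :*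
            (h :- c :* η :²)) refl (class i) r h j n x d η)

          η-unit : IsUnit η
          η-unit = unit-∣ (η * class i , trans h≡ (solve 2 (λ c η → c :* η :² := η :* (η :* c)) refl
            (class i) η)) h-unit

          even : 2# ∣ t → ⊥
          even (q , refl) = refute (square-mod-4 (odd-* (unit⇒odd η-unit) oj) r²≡c)
            where
            -- If t is even, x is a root of `F` modulo 2; at such x no unit class times `G` x is a
            -- square modulo 4.
            check : ∀ e i z → 2# ∣ F 1# (residue e) → ¬ 4# ∣ residue z * residue z - class i * G
              (residue e)
            check = from-yes (all? λ e → all? λ i → all? λ z → even? (F 1# (residue e)) →-dec
              ¬? (ι∣? (+ 4) (residue z * residue z - class i * G (residue e))))
            2∣ : 2# ∣ h * (j ² * F 1# x)
            2∣ = θ² * τ * (q * (2# * q)) - h * ((1# + θ) * j * d + 2# * (x * j * d) + 2# * d ²) ,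
              use₂ (- 1#) (- h) τt²≡ F≡ (solve 6 (λ τ q h f g w → h :* g := con 2# :*
                (con θ² :* τ :* (q :* (con 2# :* q)) :- h :* w) :+ (:- con 1#) :*
                (con θ² :* τ :* (con 2# :* q) :² :- h :* f) :+ (:- h) :* (f :- (g :+ con 2# :* w)))
                refl τ q h (F j n) (j ² * F 1# x) ((1# + θ) * j * d + 2# * (x * j * d) + 2# * d ²))

            refute : ¬ (∃[ z ] 4# ∣ residue z * residue z - class i * G x)
            refute (z , 4∣) = check e i z (even-cancel (odd-* oj oj) (even-cancel oh 2∣)) 4∣

          odd : 2# ∣ τ * t ² - θ² * r ² → ⊥
          odd (q , eq) = check e (even-cancel (odd-* oj oj) (even-cancel oh 2∣))
            where
            -- Here θ² τ t² ≡ θ⁴ r² ≡ θ⁴ h j² modulo 2, so `F` would take the value θ⁴ at (1, x).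
            check : ∀ e → ¬ 2# ∣ F 1# (residue e) - θ⁴
            check = from-yes (all? λ e → ¬? (even? (F 1# (residue e) - θ⁴)))
            w = (1# + θ) * j * d + 2# * (x * j * d) + 2# * d ²
            2∣ : 2# ∣ h * (j ² * (F 1# x - θ⁴))
            2∣ = θ² * q + θ⁴ * h * (j * n + n ²) - h * w , trans
              (solve 3 (λ h j f → h :* (j :² :* (f :- con θ⁴)) := h :* (j :² :* f) :- h :*
              (j :² :* con θ⁴)) refl h j (F 1# x))
              (use₂ (- h) θ² F≡ eq (use₂ (- 1#) θ⁴ τt²≡ r²≡
                (solve 10 (λ h j n τ t r q f g w → h :* g :- h :* (j :² :* con θ⁴) := con 2# :*
                (con θ² :* q :+ con θ⁴ :* h :* (j :* n :+ n :²) :- h :* w) :+ (:- h) :*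
                (f :- (g :+ con 2# :* w)) :+ con θ² :* (τ :* t :² :- con θ² :* r :² :- con 2# :* q)
                :+ (:- con 1#) :* (con θ² :* τ :* t :² :- h :* f) :+ con θ⁴ :*
                (r :² :- h :* (j :² :+ con 2# :* (j :* n) :+ con 2# :* n :²))) refl h j n τ t r q
                (F j n) (j ² * F 1# x) w)))

  -- Y² = - π r⁴ + 4 μ τ r² t² - 4 τ² t⁴ is the conic Y² + Z² = θ³ r⁴ with Z = 2 τ t² - μ r²,
  -- which is parametrised by means of 1 + θ⁴ = θ⁵.
  pi-impossible : ∀ {τ τ′ r t Y} → τ * τ′ ≡ 1# → Odd r → Coprime r t →
    Y ² ≡ (- π) * r ² ² + 4# * μ * τ * r ² * t ² - 4# * τ ² * t ² ² →
    2# ∣ t ⊎ 2# ∣ τ * t ² - θ² * r ² → ⊥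
  pi-impossible {τ} {τ′} {r} {t} {Y} ττ′≡1 or crt Y²≡ cond = conclude
    (four-numbers (odd≢0 oa₁) (odd≢0 oa₂) a₁a₂≡b₁b₂)
    where
    -- Multiplied by θ², the conic reads (θ Y)² - r⁴ = (θ² r²)² - (θ Z)², where both sides factor.
    a₁ = θ * Y - r ²
    a₂ = θ * Y + r ²
    b₁ = θ² * r ² - θ * (2# * τ * t ² - μ * r ²)
    b₂ = θ² * r ² + θ * (2# * τ * t ² - μ * r ²)

    a₁a₂≡b₁b₂ : a₁ * a₂ ≡ b₁ * b₂
    a₁a₂≡b₁b₂ = use₁ θ² Y²≡ (solve 4 (λ r t τ Y → (con θ :* Y :- r :²) :* (con θ :* Y :+ r :²) :=
      (con θ² :* r :² :- con θ :* (con 2# :* τ :* t :² :- con μ :* r :²)) :*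
      (con θ² :* r :² :+ con θ :* (con 2# :* τ :* t :² :- con μ :* r :²)) :+ con θ² :*
      (Y :² :- ((:- con π) :* r :² :² :+ con 4# :* con μ :* τ :* r :² :* t :² :- con 4# :* τ :² :* t
      :² :²))) refl r t τ Y)

    -- As π ≡ θ² modulo 2, Y ≡ θ r². Therefore a₁ and a₂ are both congruent to ρ r² and odd.
    2∣Y-θr² : 2# ∣ Y - θ * r ²
    2∣Y-θr² = even-² _ ((2# - θ²) * r ² ² + 2# * μ * τ * r ² * t ² - 2# * τ ² * t ² ² - θ * Y * r
      ² ,
      use₁ 1# Y²≡ (solve 4 (λ r t τ Y → (Y :- con θ :* r :²) :* (Y :- con θ :* r :²) := con 2# :*
        ((con 2# :- con θ²) :* r :² :² :+ con 2# :* con μ :* τ :* r :² :* t :² :- con 2# :* τ :² :*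
        t :² :² :- con θ :* Y :* r :²) :+ con 1# :*
        (Y :² :- ((:- con π) :* r :² :² :+ con 4# :* con μ :* τ :* r :² :* t :² :- con 4# :* τ :² :*
        t :² :²))) refl r t τ Y))

    oρr² : Odd (ρ * r ²)
    oρr² = odd-* (unit⇒odd (θ , refl)) (odd-* or or)

    oa₁ : Odd a₁
    oa₁ = odd-resp (subst (2# ∣_) (solve 2 (λ r Y → (Y :- con θ :* r :²) :* con θ := con θ :* Y :- r
      :² :- con ρ :* r :²) refl r Y) (∣-* θ 2∣Y-θr²)) oρr²

    oa₂ : Odd a₂
    oa₂ = odd-resp {y = a₁} (r ² , e r Y) oa₁
      where
      e : ∀ r Y → θ * Y + r ² - (θ * Y - r ²) ≡ 2# * r ²
      e = solve 2 (λ r Y → con θ :* Y :+ r :² :- (con θ :* Y :- r :²) := con 2# :* r :²) refl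

    conclude : FourNumbers a₁ a₂ b₁ b₂ → ⊥
    conclude (fourNumbers i j k l a₁≡ a₂≡ b₁≡ b₂≡ (u , v , uj+vk≡1)) =
      pi-covering ττ′≡1 crt oh oj eq₁ eq₂ cond
      where
      -- a₂ - a₁ = 2 r² and b₁ + b₂ = 2 θ² r² give `rel`. The substitution taking (j, k) to (θ² k -
      -- j, k + θ² j) has determinant - (1 + θ⁴) = - θ⁵, a unit, so the new pair is coprime too,
      -- with Bézout coefficients U and V. By `rel` the pair (i, l) is its multiple by h.
      ρ⁵ = ρ ² * ρ * ρ * ρ
      U = ρ⁵ * (v * θ² - u)
      V = ρ⁵ * (u * θ² + v)
      h = U * i + V * l

      oij : Odd (i * j)
      oij = subst Odd a₁≡ oa₁
      oj : Odd j
      oj = odd-factor i (subst Odd (*-comm i j) oij)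

      rel : l * (θ² * k - j) ≡ i * (k + θ² * j)
      rel = use₂ 1# 1# b₁≡ b₂≡ (use₂ (- θ²) θ² a₂≡ a₁≡
        (solve 7 (λ i j k l r Y Z → l :* (con θ² :* k :- j) := i :* (k :+ con θ² :* j) :+ con 1# :*
        (con θ² :* r :² :- Z :- i :* k) :+ con 1# :* (con θ² :* r :² :+ Z :- j :* l) :+ (:- con θ²)
        :* (con θ :* Y :+ r :² :- k :* l) :+ con θ² :* (con θ :* Y :- r :² :- i :* j)) refl i j k l
        r Y (θ * (2# * τ * t ² - μ * r ²))))

      i≡ : i ≡ h * (θ² * k - j)
      i≡ = use₂ (- i) (- V) uj+vk≡1 rel (solve 6 (λ i j k l u v → i :=
        (con ρ :² :* con ρ :* con ρ :* con ρ :* (v :* con θ² :- u) :* i :+ con ρ :² :* con ρ :*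
        con ρ :* con ρ :* (u :* con θ² :+ v) :* l) :* (con θ² :* k :- j) :+ (:- i) :*
        (u :* j :+ v :* k :- con 1#) :+ (:- (con ρ :² :* con ρ :* con ρ :* con ρ :*
        (u :* con θ² :+ v))) :* (l :* (con θ² :* k :- j) :- i :* (k :+ con θ² :* j))) refl i j k l u
        v)

      l≡ : l ≡ h * (k + θ² * j)
      l≡ = use₂ (- l) U uj+vk≡1 rel (solve 6 (λ i j k l u v → l :=
        (con ρ :² :* con ρ :* con ρ :* con ρ :* (v :* con θ² :- u) :* i :+ con ρ :² :* con ρ :*
        con ρ :* con ρ :* (u :* con θ² :+ v) :* l) :* (k :+ con θ² :* j) :+ (:- l) :*
        (u :* j :+ v :* k :- con 1#) :+ con ρ :² :* con ρ :* con ρ :* con ρ :* (v :* con θ² :- u) :*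
        (l :* (con θ² :* k :- j) :- i :* (k :+ con θ² :* j))) refl i j k l u v)

      oh : Odd h
      oh = odd-factor (θ² * k - j) (subst Odd i≡ (odd-factor j oij))

      eq₁ : 2# * r ² ≡ h * (j ² + k ²)
      eq₁ = use₂ 1# (- 1#) a₂≡ a₁≡ (use₂ k (- j) l≡ i≡
        (solve 7 (λ h i j k l r Y → con 2# :* r :² := h :* (j :² :+ k :²) :+ con 1# :*
        (con θ :* Y :+ r :² :- k :* l) :+ (:- con 1#) :* (con θ :* Y :- r :² :- i :* j) :+ k :*
        (l :- h :* (k :+ con θ² :* j)) :+ (:- j) :* (i :- h :* (con θ² :* k :- j))) refl h i j k l r
        Y))

      eq₂ : 2# * θ * τ * t ² - ρ * r ² ≡ h * (j * (k + θ² * j))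
      eq₂ = use₂ 1# j b₂≡ l≡ (solve 7 (λ h j k l r t τ → con 2# :* con θ :* τ :* t :² :- con ρ :* r
        :² := h :* (j :* (k :+ con θ² :* j)) :+ con 1# :*
        (con θ² :* r :² :+ con θ :* (con 2# :* τ :* t :² :- con μ :* r :²) :- j :* l) :+ j :*
        (l :- h :* (k :+ con θ² :* j))) refl h j k l r t τ)

  -- Elements of norm ± 23

  prime-23 : Prime 23
  prime-23 = from-yes (prime? 23)

  divisor-of-23 : ∀ m n → m ℕ.* n ≡ 23 → m ≡ 1 ⊎ n ≡ 1
  divisor-of-23 m n mn≡23 = Sum.map₂ (λ { refl → ℕₚ.*-cancelˡ-≡ n 1 23 mn≡23 })
    (prime⇒irreducible prime-23 (divides n (sym (trans (ℕₚ.*-comm n m) mn≡23))))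

  π-irreducible : ∀ {g a} → π ≡ g * a → IsUnit g ⊎ IsUnit a
  π-irreducible {g} {a} π≡ga = Sum.map (∣norm∣≡1⇒unit g) (∣norm∣≡1⇒unit a)
    (divisor-of-23 (abs (norm g)) (abs (norm a)) (begin
      abs (norm g) ℕ.* abs (norm a)  ≡⟨ ℤₚ.abs-* (norm g) (norm a) ⟨
      abs (norm g ℤ.* norm a)        ≡⟨ cong abs (norm-* g a) ⟨
      abs (norm (g * a))             ≡⟨ cong (abs ∘ norm) π≡ga ⟨
      23                             ∎))

  π-prime : ∀ x y → π ∣ x * y → π ∣ x ⊎ π ∣ y
  π-prime x y π∣xy = conclude (gcd π x)
    where
    conclude : Bézout π x → π ∣ x ⊎ π ∣ y
    conclude B@(bézout g a b u v π≡ga x≡gb _) = Sum.swap (Sum.map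
      (λ g-unit → coprime∧∣*⇒∣ (gcd-unit⇒coprime B g-unit) π∣xy)
      (λ (a′ , aa′≡1) → a′ * b , use₃ 1# (- (a′ * b)) (- (g * b)) x≡gb π≡ga aa′≡1
        (solve 6 (λ p x g a b a′ → x := p :* (a′ :* b) :+ con 1# :* (x :- g :* b) :+ (:- (a′ :* b))
        :* (p :- g :* a) :+ (:- (g :* b)) :* (a :* a′ :- con 1#)) refl π x g a b a′))
      (π-irreducible π≡ga))

  g²∣π⇒unit : ∀ g → g ² ∣ π → IsUnit g
  g²∣π⇒unit g (k , π≡) =
    [ id , unit-∣ {g} {g * k} (k , refl) ]′ (π-irreducible {g} {g * k} (trans π≡ (*-assoc g g k)))

  -- The descent

  pow2 : ℕ → ℤ[θ]
  pow2 zero    = 1#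
  pow2 (suc k) = 2# * pow2 k

  pow2-odd-coprime : ∀ k {x} → Odd x → Coprime (pow2 k) x
  pow2-odd-coprime zero    {x} _ = unit⇒coprime x (1# , refl)
  pow2-odd-coprime (suc k) odd = coprime-sym (coprime-* (odd⇒coprime-2 odd)
    (coprime-sym (pow2-odd-coprime k odd)))

  pow2≢0 : ∀ k → pow2 k ≢ 0#
  pow2≢0 zero    ()
  pow2≢0 (suc k) eq = [ 2≢0 , pow2≢0 k ]′ (x*y≡0⇒x≡0∨y≡0 2# (pow2 k) eq)

  -- The odd factor takes no part of the power of 2, so the exponent k passes to y undiminished.
  pow2-cofactor : ∀ k {s x y} → Odd x → x * y ≡ pow2 k * s → ∃[ y′ ] y ≡ pow2 k * y′ × x * y′ ≡ s
  pow2-cofactor k {s} {x} {y} odd xy≡ = cancel (coprime∧∣*⇒∣ (pow2-odd-coprime k odd) (s , xy≡))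
    where
    cancel : pow2 k ∣ y → ∃[ y′ ] y ≡ pow2 k * y′ × x * y′ ≡ s
    cancel (y′ , y≡) = y′ , y≡ ,
      *-cancelˡ (pow2 k) (pow2≢0 k) (trans (solve 3 (λ p x y → p :* (x :* y) := x :* (p :* y)) refl
        (pow2 k) x y′) (trans (cong (x *_) (sym y≡)) xy≡))

  *≢0 : ∀ {x y} → x ≢ 0# → y ≢ 0# → x * y ≢ 0#
  *≢0 {x} {y} x≢0 y≢0 eq = [ x≢0 , y≢0 ]′ (x*y≡0⇒x≡0∨y≡0 x y eq)

  module Descent (τ τ′ : ℤ[θ]) (ττ′≡1 : τ * τ′ ≡ 1#) where

    τ-unit : IsUnit τ
    τ-unit = τ′ , ττ′≡1

    -- M² = r⁴ + 4 μ τ r² t² + 4 π τ² t⁴ is equivalent to A + B = r² + 2 μ τ t², A B = θ³ τ² t⁴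
    -- with M = B - A; the last two hypotheses say that t / r is 2-adically close to 0 (or t is
    -- odd), in the direction of τ^(-1/2) modulo 2.
    record Solution (k : ℕ) : Set where
      constructor solution
      field
        r s A B : ℤ[θ]
      t : ℤ[θ]
      t = pow2 k * s
      field
        odd     : Odd r
        coprime : Coprime r t
        sum     : A + B ≡ r ² + 2# * μ * τ * t ²
        prod    : A * B ≡ τ ² * θ³ * t ² ²
        dir     : 2# ∣ τ * s ² - r ²

    dir⇒odd : ∀ {s r} → Odd r → 2# ∣ τ * s ² - r ² → Odd s
    dir⇒odd {s} or dir = odd-factor (s * τ) (subst Odd
      (solve 2 (λ τ s → τ :* s :² := s :* (s :* τ)) refl τ s) (odd-resp dir (odd-* or or)))

    -- For odd t, `dir` says τ t² ≡ r² modulo 2. Then A + B ≡ r² and A B ≡ θ³ r⁴, so A / r² is a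
    -- root of X² + X + θ³ over the field of 8 elements. There is none, because θ³ = θ + 1 has trace
    -- 1.
    base : ¬ Solution 0
    base (solution r s A B odd _ sum prod (q , dir)) = go₁ (inverse-mod-2 (r ²) (odd-* odd odd))
      where
      go₁ : (∃₂ λ y m → r ² * y ≡ 1# + 2# * m) → ⊥
      go₁ (y , m , r²y≡) = go₂ (residue-of (A * y))
        where
        w = A * r ² + μ * τ * s ² * A - 2# * θ³ * (q * r ² + q ²)

        e₁ : A * A + A * r ² + θ³ * r ² ² ≡ 2# * w
        e₁ = use₃ A (- 1#) (- θ³ * (τ * s ² + r ² + 2# * q)) sum prod dir
          (solve 6 (λ A B r s τ q → A :² :+ A :* r :² :+ con θ³ :* r :² :² := con 2# :*
          (A :* r :² :+ con μ :* τ :* s :² :* A :- con 2# :* con θ³ :* (q :* r :² :+ q :²)) :+ A :*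
          (A :+ B :- (r :² :+ con 2# :* con μ :* τ :* (con 1# :* s) :²)) :+ (:- con 1#) :*
          (A :* B :- τ :² :* con θ³ :* (con 1# :* s) :² :²) :+ (:- con θ³) :*
          (τ :* s :² :+ r :² :+ con 2# :* q) :* (τ :* s :² :- r :² :- con 2# :* q)) refl A B r s τ
          q)

        go₂ : (∃₂ λ e l → A * y ≡ residue e + 2# * l) → ⊥
        go₂ (e , l , Ay≡) = check e
          (w * y * y - m * (A * y) - θ³ * (2# * m + 2# * m ²) - 2# * (x * l) - 2# * l ² - l ,
           use₃ (y ²) (- (A * y) - θ³ * (r ² * y + 1# + 2# * m)) (- (A * y + x + 2# * l + 1#)) e₁
             r²y≡ Ay≡
            (solve 7 (λ A y x l r m w → x :² :+ x :+ con θ³ := con 2# :*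
              (w :* y :* y :- m :* (A :* y) :- con θ³ :* (con 2# :* m :+ con 2# :* m :²) :- con 2#
              :* (x :* l) :- con 2# :* l :² :- l) :+ y :² :*
              (A :² :+ A :* r :² :+ con θ³ :* r :² :² :- con 2# :* w) :+
              (:- (A :* y) :- con θ³ :* (r :² :* y :+ con 1# :+ con 2# :* m)) :*
              (r :² :* y :- (con 1# :+ con 2# :* m)) :+ (:- (A :* y :+ x :+ con 2# :* l :+ con 1#))
              :* (A :* y :- (x :+ con 2# :* l))) refl A y x l r m w))
          where
          x = residue e
          check : ∀ e → ¬ 2# ∣ residue e * residue e + residue e + θ³
          check = from-yes (all? λ e → ¬? (even? (residue e * residue e + residue e + θ³)))

    -- The second isogeny when the factor π falls on B
    case-trivial : ∀ k {R n′ r t ε ε′} → let n = pow2 k * n′ in ¬ Solution k →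
      Odd R → 2# ∣ τ * n′ ² - R ² → ε * ε′ ≡ 1# → Odd r → Coprime r t → n ≡ r * t →
      R ² ≡ ε * r ² ² + 4# * (π * τ ² * ε′ * t ² ² + μ * τ * n ²) → ⊥
    case-trivial k {R} {n′} {r} {t} {ε} {ε′} IH oR (q , dir) εε′≡1 or crt n≡rt R²≡ =
      -- Modulo 4 the equation is R² ≡ ε r⁴. The root η of ε is absorbed into R and r.
      go₁ (square-mod-4⇒square (ε′ , εε′≡1) (odd-* or or) R²≡)
      where
      go₁ : SquareUnit ε → ⊥
      go₁ (squareUnit η η′ ηη′≡1 ε≡) = go₂ (pow2-cofactor k or (sym n≡rt))
        where
        R₁ = η * R
        r₁ = η * r

        or₁ : Odd r₁
        or₁ = odd-* (unit⇒odd (η′ , ηη′≡1)) or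

        R₁²≡ : R₁ * R₁ ≡ r₁ ² ² + 4# * (μ * τ * r₁ ² * t ²) + 4# * (π * τ ² * t ² ²)
        R₁²≡ = use₃ ε (4# * (π * τ ² * t ² ²)) (4# * ε * μ * τ * (pow2 k * n′ + r * t)) R²≡ εε′≡1
          n≡rt
          (use₁ (4# * μ * τ * r ² * t ² + r ² ² * (ε + η ²) - R ²) ε≡
            (solve 8 (λ R r t τ ε ε′ η n → (η :* R) :² := (η :* r) :² :² :+ con 4# :*
            (con μ :* τ :* (η :* r) :² :* t :²) :+ con 4# :* (con π :* τ :² :* t :² :²) :+ ε :*
            (R :² :- (ε :* r :² :² :+ con 4# :* (con π :* τ :² :* ε′ :* t :² :² :+ con μ :* τ :* n
            :²))) :+ con 4# :* (con π :* τ :² :* t :² :²) :* (ε :* ε′ :- con 1#) :+ con 4# :* ε :*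
            con μ :* τ :* (n :+ r :* t) :* (n :- r :* t) :+
            (con 4# :* con μ :* τ :* r :² :* t :² :+ r :² :² :* (ε :+ η :²) :- R :²) :* (ε :- η :²))
            refl R r t τ ε ε′ η (pow2 k * n′)))

        2∣R₁-r₁² : 2# ∣ R₁ - r₁ ²
        2∣R₁-r₁² = even-² _ (r₁ ² ² + 2# * (μ * τ * r₁ ² * t ²) + 2# * (π * τ ² * t ² ²) - R₁ * r₁
          ² ,
          use₁ 1# R₁²≡ (solve 4 (λ R r t τ → (R :- r :²) :* (R :- r :²) := con 2# :*
            (r :² :² :+ con 2# :* (con μ :* τ :* r :² :* t :²) :+ con 2# :*
            (con π :* τ :² :* t :² :²) :- R :* r :²) :+ con 1# :*
            (R :² :- (r :² :² :+ con 4# :* (con μ :* τ :* r :² :* t :²) :+ con 4# :*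
            (con π :* τ :² :* t :² :²)))) refl R₁ r₁ t τ))

        go₂ : (∃[ t′ ] t ≡ pow2 k * t′ × r * t′ ≡ n′) → ⊥
        go₂ (t′ , refl , refl) = go₃ 2∣R₁-r₁²
          where
          go₃ : 2# ∣ R₁ - r₁ ² → ⊥
          -- The new A and B are (r₁² + 2 μ τ t² ∓ R₁) / 2, so R₁ plays the role of M in the next
          -- solution.
          go₃ (g , R₁-r₁²≡) = IH (solution r₁ t′ (μ * τ * t ² - g) (r₁ ² + μ * τ * t ² + g) or₁
            (coprime-sym (coprime-* (coprime-sym (unit⇒coprime t (η′ , ηη′≡1))) (coprime-sym crt)))
            (solve 5 (λ u τ r t g → u :* τ :* t :² :- g :+ (r :² :+ u :* τ :* t :² :+ g) := r :² :+
              con 2# :* u :* τ :* t :²) refl μ τ r₁ t g) prod′ dir′)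
            where
            prod′ : (μ * τ * t ² - g) * (r₁ ² + μ * τ * t ² + g) ≡ τ ² * θ³ * t ² ²
            prod′ = *-cancelˡ 4# (λ ()) (use₂ (- 1#) (R₁ + r₁ ² + 2# * g) R₁²≡ R₁-r₁²≡
              (solve 5 (λ R r t τ g → con 4# :* ((con μ :* τ :* t :² :- g) :*
              (r :² :+ con μ :* τ :* t :² :+ g)) := con 4# :* (τ :² :* con θ³ :* t :² :²) :+
              (:- con 1#) :* (R :² :- (r :² :² :+ con 4# :* (con μ :* τ :* r :² :* t :²) :+ con 4#
              :* (con π :* τ :² :* t :² :²))) :+ (R :+ r :² :+ con 2# :* g) :*
              (R :- r :² :- con 2# :* g)) refl R₁ r₁ t τ g))
            -- n′ = r t′ and R² ≡ ε r⁴ = r² r₁², so the odd factor r² cancels from τ n′² ≡ R² and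
            -- the direction is unchanged.
            dir′ : 2# ∣ τ * t′ ² - r₁ ²
            dir′ = even-cancel (odd-* or or) (q + 2# * (π * τ ² * ε′ * t ² ² + μ * τ * n ²) ,
              use₃ 1# 1# (r ² ²) dir R²≡ ε≡ (solve 8 (λ R r t τ ε η q X → r :² :*
                (τ :* t :² :- (η :* r) :²) := con 2# :* (q :+ con 2# :* X) :+ con 1# :*
                (τ :* (r :* t) :² :- R :² :- con 2# :* q) :+ con 1# :*
                (R :² :- (ε :* r :² :² :+ con 4# :* X)) :+ r :² :² :* (ε :- η :²)) refl R r t′ τ ε η
                q (π * τ ² * ε′ * t ² ² + μ * τ * n ²)))
              where
              n = pow2 k * n′

    -- The second isogeny when the factor π falls on A
    case-π : ∀ k {R n′ r t ε ε′} → let n = pow2 k * n′ in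
      2# ∣ τ * n′ ² - R ² → ε * ε′ ≡ 1# → Odd r → Coprime r t → n ≡ r * t →
      R ² ≡ π * ε * r ² ² + 4# * (τ ² * ε′ * t ² ² + μ * τ * n ²) → ⊥
    case-π k {R} {n′} {r} {t} {ε} {ε′} (q , dir) εε′≡1 or crt n≡rt R²≡ =
      -- π + θ² = 4 ρ, so modulo 4 the equation is R² ≡ - ε (θ r²)².
      go₁ (square-mod-4⇒square {k = ρ * ε * r ² ² + X}
        (- ε′ , trans (solve 2 (λ ε ε′ → (:- ε) :* (:- ε′) := ε :* ε′) refl ε ε′) εε′≡1)
        (odd-* (unit⇒odd (ρ , refl)) (odd-* or or))
          (trans R²≡ (solve 3 (λ ε r X → con π :* ε :* r :² :² :+ con 4# :* X := (:- ε) :*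
          (con θ :* r :² :* (con θ :* r :²)) :+ con 4# :* (con ρ :* ε :* r :² :² :+ X)) refl ε r
          X)))
      where
      X = τ ² * ε′ * t ² ² + μ * τ * (pow2 k * n′ * (pow2 k * n′))


      go₁ : SquareUnit (- ε) → ⊥
      go₁ (squareUnit η η′ ηη′≡1 -ε≡) = go₂ (pow2-cofactor k or (sym n≡rt))
        where
        r₁ = η * r
        Y = η * R

        or₁ : Odd r₁
        or₁ = odd-* (unit⇒odd (η′ , ηη′≡1)) or

        cr₁t : Coprime r₁ t
        cr₁t = coprime-sym (coprime-* (coprime-sym (unit⇒coprime t (η′ , ηη′≡1))) (coprime-sym crt))

        Y²≡ : Y * Y ≡ (- π) * r₁ ² ² + 4# * μ * τ * r₁ ² * t ² - 4# * τ ² * t ² ²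
        Y²≡ = use₃ (- ε) (- (4# * τ ² * t ² ²)) (- (4# * ε * μ * τ * (pow2 k * n′ + r * t))) R²≡
          εε′≡1 n≡rt
          (use₁ (4# * μ * τ * r ² * t ² - π * r ² ² * ((- ε) + η ²) - R ²) -ε≡
            (solve 8 (λ R r t τ ε ε′ η n → (η :* R) :² := (:- con π) :* (η :* r) :² :² :+ con 4# :*
            con μ :* τ :* (η :* r) :² :* t :² :- con 4# :* τ :² :* t :² :² :+ (:- ε) :*
            (R :² :- (con π :* ε :* r :² :² :+ con 4# :*
            (τ :² :* ε′ :* t :² :² :+ con μ :* τ :* n :²))) :+ (:- (con 4# :* τ :² :* t :² :²)) :*
            (ε :* ε′ :- con 1#) :+ (:- (con 4# :* ε :* con μ :* τ :* (n :+ r :* t))) :*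
            (n :- r :* t) :+ (con 4# :* con μ :* τ :* r :² :* t :² :- con π :* r :² :² :*
            ((:- ε) :+ η :²) :- R :²) :* (:- ε :- η :²)) refl R r t τ ε ε′ η (pow2 k * n′)))

        go₂ : (∃[ t′ ] t ≡ pow2 k * t′ × r * t′ ≡ n′) → ⊥
        go₂ (t′ , t≡ , rt′≡n′) = pi-impossible ττ′≡1 or₁ cr₁t Y²≡ (cond k t≡)
          where
          -- Here R² ≡ θ² r² r₁² modulo 2, so the direction is turned by θ. For k = 0 this is the
          -- second alternative of `pi-impossible`; for larger k, t is even.
          2∣ : 2# ∣ τ * t′ ² - θ² * r₁ ²
          2∣ = even-cancel (odd-* or or) (q + 2# * (ρ * ε * r ² ² + X) ,
            use₃ 1# 1# (θ² * r ² ²) dir R²≡ -ε≡ (use₁ (τ * (r * t′ + n′)) rt′≡n′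
              (solve 9 (λ R r t τ ε η q n X → r :² :* (τ :* t :² :- con θ² :* (η :* r) :²) := con 2#
              :* (q :+ con 2# :* (con ρ :* ε :* r :² :² :+ X)) :+ con 1# :*
              (τ :* n :² :- R :² :- con 2# :* q) :+ con 1# :*
              (R :² :- (con π :* ε :* r :² :² :+ con 4# :* X)) :+ con θ² :* r :² :² :*
              (:- ε :- η :²) :+ τ :* (r :* t :+ n) :* (r :* t :- n)) refl R r t′ τ ε η q n′ X)))

          cond : ∀ k → t ≡ pow2 k * t′ → 2# ∣ t ⊎ 2# ∣ τ * t ² - θ² * r₁ ²
          cond zero    t≡ = inj₂ (subst (λ t → 2# ∣ τ * t ² - θ² * r₁ ²)
            (sym (trans t≡ (*-identityˡ t′))) 2∣)
          cond (suc k) t≡ = inj₁ (pow2 k * t′ , trans t≡ (*-assoc 2# (pow2 k) t′))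

    -- A common divisor g of A and B is prime to 2 and to n, so g² divides π and g is a unit. Hence
    -- B takes the whole factor 4, exactly one factor takes π, and what remains are units times
    -- fourth powers. The place of π is the class of the point.
    second-isogeny′ : ∀ k {R n′ A B} → let n = pow2 k * n′ in ¬ Solution k →
      Odd R → Odd n′ → Coprime R n → 2# ∣ τ * n′ ² - R ² → Odd A →
      A + B ≡ R ² - 4# * μ * τ * n ² → A * B ≡ 4# * (π * τ ² * n ² ²) → ⊥
    second-isogeny′ k {R} {n′} {A} {B} IH oR on′ cRn dir oA sum prod =
      go₁ (coprime∧∣*⇒∣ (coprime-sym (coprime-* oA⊥2 oA⊥2)) (π * τ ² * n ² ² , prod))
      where
      n = pow2 k * n′

      n≢0 : n ≢ 0#
      n≢0 = *≢0 (pow2≢0 k) (odd≢0 on′)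

      oA⊥2 : Coprime A 2#
      oA⊥2 = odd⇒coprime-2 oA

      cAB : Coprime A B
      cAB = coprime-by A B λ g (a , A≡ga) (b , B≡gb) → g²∣π⇒unit g (coprime∧∣*⇒∣
        (g²⊥ g a A≡ga (b , B≡gb))
        (a * b , use₃ (- 1#) B (g * a) prod A≡ga B≡gb
          (solve 7 (λ A B g a b τ n → con 2# :² :* (τ :² :* n :² :²) :* con π := g :² :* (a :* b) :+
          (:- con 1#) :* (A :* B :- con 4# :* (con π :* τ :² :* n :² :²)) :+ B :* (A :- g :* a) :+ g
          :* a :* (B :- g :* b)) refl A B g a b τ n)))
        where
        g²⊥ : ∀ g a → A ≡ g * a → g ∣ B → Coprime (g ²) (2# ² * (τ ² * n ² ²))
        g²⊥ g a A≡ga g∣B = coprime-sym (coprime-² (coprime-sym (coprime-* (coprime-² g⊥2)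
          (coprime-* (coprime-² (coprime-sym (unit⇒coprime g τ-unit)))
            (coprime-² (coprime-² g⊥n))))))
          where
          g⊥2 : Coprime g 2#
          g⊥2 = coprime-factorˡ a (subst (λ A → Coprime A 2#) A≡ga oA⊥2)
          g⊥n : Coprime g n
          g⊥n = coprime-by g n λ d d∣g d∣n → coprime∧∣⇒unit
            (coprime-² (coprime-sym (d⊥R d d∣n)))
            (subst (d ∣_) (trans (cong (_+ 4# * μ * τ * n ²) sum) (e R n τ))
              (∣-+ (∣-+ (∣-trans d∣g (a , A≡ga)) (∣-trans d∣g g∣B))
                (subst (d ∣_) (solve 2 (λ n τ → n :* (n :* (con 4# :* con μ :* τ)) := con 4# :*
                con μ :* τ :* n :²) refl n τ) (∣-* (n * (4# * μ * τ)) d∣n))))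
            where
            e : ∀ R n τ → R ² - 4# * μ * τ * n ² + 4# * μ * τ * n ² ≡ R ²
            e = solve 3 (λ R n τ → R :² :- con 4# :* con μ :* τ :* n :² :+ con 4# :* con μ :* τ :* n
              :² := R :²) refl
            d⊥R : ∀ d → d ∣ n → Coprime R d
            d⊥R d (c , n≡dc) = coprime-factorʳ c (subst (Coprime R) n≡dc cRn)

      go₁ : 2# * 2# ∣ B → ⊥
      go₁ (B₁ , B≡4B₁) = [ case-A , case-B ]′ (π-prime A B₁
        (τ ² * n ² ² , trans AB₁≡ (*-assoc π (τ ²) _)))
        where
        AB₁≡ : A * B₁ ≡ π * τ ² * n ² ²
        AB₁≡ = *-cancelˡ 4# (λ ()) (use₂ 1# (- A) prod B≡4B₁
          (solve 4 (λ A B B₁ X → con 4# :* (A :* B₁) := con 4# :* X :+ con 1# :*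
          (A :* B :- con 4# :* X) :+ (:- A) :* (B :- con 2# :² :* B₁)) refl A B B₁
          (π * τ ² * n ² ²)))

        τ′-unit : IsUnit (τ′ ²)
        τ′-unit = unit-* (τ , trans (*-comm τ′ τ) ττ′≡1) (τ , trans (*-comm τ′ τ) ττ′≡1)

        cAB₁ : Coprime A B₁
        cAB₁ = coprime-factorʳ (2# ²) (subst (Coprime A) (trans B≡4B₁ (*-comm (2# ²) B₁)) cAB)

        case-A : π ∣ A → ⊥
        case-A (A₁ , A≡πA₁) = conclude (coprime-fourthPowers cA₁ n≢0 eq)
          where
          cA₁ : Coprime A₁ (B₁ * τ′ ²)
          cA₁ = coprime-* (coprime-factorˡ π (subst (λ A → Coprime A B₁) (trans A≡πA₁ (*-comm π A₁))
            cAB₁))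
            (coprime-sym (unit⇒coprime A₁ τ′-unit))
          eq : A₁ * (B₁ * τ′ ²) ≡ n ² ²
          eq = *-cancelˡ π (λ ()) (use₃ (τ′ ²) (- (B₁ * τ′ ²)) (π * n ² ² * (τ * τ′ + 1#)) AB₁≡
            A≡πA₁ ττ′≡1
            (solve 7 (λ p A A₁ B₁ τ τ′ X → p :* (A₁ :* (B₁ :* τ′ :²)) := p :* X :+ τ′ :² :*
              (A :* B₁ :- p :* τ :² :* X) :+ (:- (B₁ :* τ′ :²)) :* (A :- p :* A₁) :+ p :* X :*
              (τ :* τ′ :+ con 1#) :* (τ :* τ′ :- con 1#)) refl π A A₁ B₁ τ τ′ (n ² ²)))
          conclude : FourthPowers A₁ (B₁ * τ′ ²) n → ⊥
          conclude (fourthPowers ε ε′ r t εε′≡1 A₁≡ B₁≡ n≡) = case-π k dir εε′≡1 or crt n≡ R²≡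
            where
            or : Odd r
            or 2∣r = oA (subst (2# ∣_) (sym (trans A≡πA₁
              (trans (cong (π *_) A₁≡) (solve 3 (λ p ε r → p :* (ε :* r :² :²) := r :*
              (p :* ε :* (r :² :* r))) refl π ε r)))) (∣-* (π * ε * (r ² * r)) 2∣r))
            crt : Coprime r t
            crt = coprime-factorˡ r (coprime-factorʳ t
              (coprime-roots ε ε′ (r ²) (t ²) (subst₂ Coprime A₁≡ B₁≡ cA₁)))
            R²≡ : R * R ≡ π * ε * r ² ² + 4# * (τ ² * ε′ * t ² ² + μ * τ * n ²)
            R²≡ = use₃ (- 1#) 1# 1# sum A≡πA₁ B≡4B₁ (use₃ π (4# * τ ²) (- (4# * B₁ * (τ * τ′ + 1#)))
              A₁≡ B₁≡ ττ′≡1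
              (solve 13 (λ p A A₁ B B₁ R τ τ′ n ε r⁴ ε′ t⁴ → R :² := p :* ε :* r⁴ :+ con 4# :*
                (τ :² :* ε′ :* t⁴ :+ con μ :* τ :* n :²) :+ (:- con 1#) :*
                (A :+ B :- (R :² :- con 4# :* con μ :* τ :* n :²)) :+ con 1# :* (A :- p :* A₁) :+
                con 1# :* (B :- con 2# :² :* B₁) :+ p :* (A₁ :- ε :* r⁴) :+ con 4# :* τ :² :*
                (B₁ :* τ′ :² :- ε′ :* t⁴) :+ (:- (con 4# :* B₁ :* (τ :* τ′ :+ con 1#))) :*
                (τ :* τ′ :- con 1#)) refl π A A₁ B B₁ R τ τ′ n ε (r ² ²) ε′ (t ² ²)))

        case-B : π ∣ B₁ → ⊥
        case-B (B₂ , B₁≡πB₂) = conclude (coprime-fourthPowers cA₁ n≢0 eq)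
          where
          cA₁ : Coprime A (B₂ * τ′ ²)
          cA₁ = coprime-* (coprime-factorʳ π (subst (Coprime A) (trans B₁≡πB₂ (*-comm π B₂)) cAB₁))
            (coprime-sym (unit⇒coprime A τ′-unit))
          eq : A * (B₂ * τ′ ²) ≡ n ² ²
          eq = *-cancelˡ π (λ ()) (use₃ (τ′ ²) (- (A * τ′ ²)) (π * n ² ² * (τ * τ′ + 1#)) AB₁≡
            B₁≡πB₂ ττ′≡1
            (solve 7 (λ p A B₁ B₂ τ τ′ X → p :* (A :* (B₂ :* τ′ :²)) := p :* X :+ τ′ :² :*
              (A :* B₁ :- p :* τ :² :* X) :+ (:- (A :* τ′ :²)) :* (B₁ :- p :* B₂) :+ p :* X :*
              (τ :* τ′ :+ con 1#) :* (τ :* τ′ :- con 1#)) refl π A B₁ B₂ τ τ′ (n ² ²)))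
          conclude : FourthPowers A (B₂ * τ′ ²) n → ⊥
          conclude (fourthPowers ε ε′ r t εε′≡1 A≡ B₂≡ n≡) = case-trivial k IH oR dir εε′≡1 or crt
            n≡ R²≡
            where
            or : Odd r
            or 2∣r = oA (subst (2# ∣_) (sym (trans A≡
              (solve 2 (λ ε r → ε :* r :² :² := r :* (ε :* (r :² :* r))) refl ε r)))
              (∣-* (ε * (r ² * r)) 2∣r))
            crt : Coprime r t
            crt = coprime-factorˡ r (coprime-factorʳ t
              (coprime-roots ε ε′ (r ²) (t ²) (subst₂ Coprime A≡ B₂≡ cA₁)))
            R²≡ : R * R ≡ ε * r ² ² + 4# * (π * τ ² * ε′ * t ² ² + μ * τ * n ²)
            R²≡ = use₃ (- 1#) 1# 4# sum B≡4B₁ B₁≡πB₂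
              (use₃ 1# (4# * π * τ ²) (- (4# * π * B₂ * (τ * τ′ + 1#))) A≡ B₂≡ ττ′≡1
              (solve 13 (λ p A B B₁ B₂ R τ τ′ n ε r⁴ ε′ t⁴ → R :² := ε :* r⁴ :+ con 4# :*
                (p :* τ :² :* ε′ :* t⁴ :+ con μ :* τ :* n :²) :+ (:- con 1#) :*
                (A :+ B :- (R :² :- con 4# :* con μ :* τ :* n :²)) :+ con 1# :*
                (B :- con 2# :² :* B₁) :+ con 4# :* (B₁ :- p :* B₂) :+ con 1# :* (A :- ε :* r⁴) :+
                con 4# :* p :* τ :² :* (B₂ :* τ′ :² :- ε′ :* t⁴) :+
                (:- (con 4# :* p :* B₂ :* (τ :* τ′ :+ con 1#))) :* (τ :* τ′ :- con 1#)) refl π A B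
                B₁ B₂ R τ τ′ n ε (r ² ²) ε′ (t ² ²)))

    -- For n = 2 n₁, A and B are the halves of R² - 4 μ τ n₁² ± N; their product is 4 π τ² n₁⁴
    -- because μ² - θ³ = π. Their sum is odd and the conditions are symmetric, so A may be taken to
    -- be odd.
    second-isogeny : ∀ k {R n′ N} → let n = 2# * (pow2 k * n′) in ¬ Solution k →
      Odd R → Odd n′ → Coprime R n → 2# ∣ τ * n′ ² - R ² →
      N ² ≡ R ² ² - 2# * μ * τ * R ² * n ² + τ ² * θ³ * n ² ² → ⊥
    second-isogeny k {R} {n′} {N} IH oR on′ cRn dir N²≡ = conclude 2∣N-R²
      where
      n₁ = pow2 k * n′

      2∣N-R² : 2# ∣ N - R ²
      2∣N-R² = even-² _ (R ² ² - 4# * μ * τ * R ² * n₁ ² + 2# * 4# * τ ² * θ³ * n₁ ² ² - N * R ² ,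
        use₁ 1# N²≡ (solve 4 (λ N R τ n → (N :- R :²) :* (N :- R :²) := con 2# :*
          (R :² :² :- con 4# :* con μ :* τ :* R :² :* n :² :+ con 2# :* con 4# :* τ :² :* con θ³ :*
          n :² :² :- N :* R :²) :+ con 1# :* (N :² :-
          (R :² :² :- con 2# :* con μ :* τ :* R :² :* (con 2# :* n) :² :+ τ :² :* con θ³ :*
          (con 2# :* n) :² :²))) refl N R τ n₁))

      conclude : 2# ∣ N - R ² → ⊥
      conclude (g , N-R²≡2g) = split (even? B)
        where
        A = R ² - 2# * μ * τ * n₁ ² + g
        B = - (2# * μ * τ * n₁ ²) - g

        sum : A + B ≡ R ² - 4# * μ * τ * n₁ ²
        sum = h R τ n₁ g
          where
          h : ∀ R τ n g → R ² - 2# * μ * τ * n ² + g + (- (2# * μ * τ * n ²) - g) ≡ R ² - 4# * μ * τ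
            * n ²
          h = solve 4 (λ R τ n g → R :² :- con 2# :* con μ :* τ :* n :² :+ g :+ (:- (con 2# :* con μ
            :* τ :* n :²) :- g) := R :² :- con 4# :* con μ :* τ :* n :²) refl

        prod : A * B ≡ 4# * (π * τ ² * n₁ ² ²)
        prod = *-cancelˡ 4# (λ ()) (use₂ (- 1#) (N + R ² + 2# * g) N²≡ N-R²≡2g
          (solve 5 (λ N R τ n g → con 4# :* ((R :² :- con 2# :* con μ :* τ :* n :² :+ g) :*
          (:- (con 2# :* con μ :* τ :* n :²) :- g)) := con 4# :*
          (con 4# :* (con π :* τ :² :* n :² :²)) :+ (:- con 1#) :*
          (N :² :- (R :² :² :- con 2# :* con μ :* τ :* R :² :* (con 2# :* n) :² :+ τ :² :* con θ³ :*
          (con 2# :* n) :² :²)) :+ (N :+ R :² :+ con 2# :* g) :* (N :- R :² :- con 2# :* g)) refl N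
          R τ n₁ g))

        cRn₁ : Coprime R n₁
        cRn₁ = coprime-factorʳ 2# (subst (Coprime R) (*-comm 2# n₁) cRn)

        split : Dec (2# ∣ B) → ⊥
        split (no  oB) = second-isogeny′ k IH oR on′ cRn₁ dir oB (trans (+-comm B A) sum)
          (trans (*-comm B A) prod)
        split (yes 2∣B) = second-isogeny′ k IH oR on′ cRn₁ dir oA sum prod
          where
          oA : Odd A
          oA 2∣A = odd-* oR oR (subst (2# ∣_) (solve 4
            (λ R τ n g → R :² :- con 2# :* con μ :* τ :* n :² :+ g :+
            (:- (con 2# :* con μ :* τ :* n :²) :- g) :+ con 2# :* (con 2# :* con μ :* τ :* n :²) :=
            R :²) refl R τ n₁ g)
            (∣-+ (∣-+ 2∣A 2∣B) (2# * μ * τ * n₁ ² , refl)))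

    -- With n even the equation modulo 4 is r² ≡ ε m⁴, so ε is a square η². All factors 2 of t lie
    -- in n, and for R = η m the congruences s = m n′ and r² ≡ m² R² carry the direction over to n′
    -- and R.
    first-isogeny′ : ∀ k {r s m n ε ε′} → ¬ Solution k →
      Odd r → 2# ∣ τ * s ² - r ² → ε * ε′ ≡ 1# → Coprime m n → m * n ≡ pow2 (suc k) * s → 2# ∣ n →
      r ² ≡ ε * m ² ² - 2# * μ * τ * m ² * n ² + ε′ * (τ ² * θ³) * n ² ² → ⊥
    first-isogeny′ k {r} {s} {m} {n} {ε} {ε′} IH or dir εε′≡1 cmn mn≡ 2∣n r²≡ =
      go₁ (pow2-cofactor (suc k) om mn≡)
      where
      om : Odd m
      om 2∣m = contradiction (unit⇒∣norm∣≡1 (coprime∧∣⇒unit (2⊥n 2∣m) 2∣n)) λ ()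
        where
        2⊥n : 2# ∣ m → Coprime 2# n
        2⊥n (c , m≡2c) = coprime-factorˡ c (subst (λ m → Coprime m n) m≡2c cmn)

      go₁ : (∃[ n′ ] n ≡ pow2 (suc k) * n′ × m * n′ ≡ s) → ⊥
      go₁ (n′ , n≡ , mn′≡s) = go₂ dir (square-mod-4⇒square {k = X} (ε′ , εε′≡1) (odd-* om om) r²≡′)
        where
        n₁ = pow2 k * n′

        n≡2n₁ : n ≡ 2# * n₁
        n≡2n₁ = trans n≡ (*-assoc 2# (pow2 k) n′)

        X = 4# * (ε′ * (τ ² * θ³) * n₁ ² ²) - 2# * μ * τ * m ² * n₁ ²

        r²≡₁ : r * r ≡ ε * m ² ² - 2# * μ * τ * m ² * (2# * n₁) ²
          + ε′ * (τ ² * θ³) * (2# * n₁) ² ²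
        r²≡₁ = subst (λ n → r ² ≡ ε * m ² ² - 2# * μ * τ * m ² * n ² + ε′ * (τ ² * θ³) * n ² ²)
          n≡2n₁ r²≡

        r²≡′ : r * r ≡ ε * m ² ² + 4# * X
        r²≡′ = trans r²≡₁ (solve 5 (λ ε ε′ m n τ → ε :* m :² :² :- con 2# :* con μ :* τ :* m :² :*
          (con 2# :* n) :² :+ ε′ :* (τ :² :* con θ³) :* (con 2# :* n) :² :² := ε :* m :² :² :+
          con 4# :* (con 4# :* (ε′ :* (τ :² :* con θ³) :* n :² :²) :- con 2# :* con μ :* τ :* m :²
          :* n :²)) refl ε ε′ m n₁ τ)

        go₂ : 2# ∣ τ * s ² - r ² → SquareUnit ε → ⊥
        go₂ (q , dir) (squareUnit η η′ ηη′≡1 ε≡) = second-isogeny k {N = η * r} IH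
          (odd-* (unit⇒odd (η′ , ηη′≡1)) om) on′ cRn dir′ N²≡
          where
          R = η * m

          on′ : Odd n′
          on′ = odd-factor m (subst Odd (trans (sym mn′≡s) (*-comm m n′)) (dir⇒odd or (q , dir)))

          cRn : Coprime R (2# * n₁)
          cRn = coprime-sym (coprime-* (coprime-sym (unit⇒coprime _ (η′ , ηη′≡1)))
            (coprime-sym (subst (Coprime m) n≡2n₁ cmn)))

          dir′ : 2# ∣ τ * n′ ² - R ²
          dir′ = even-cancel (odd-* om om) (q + 2# * X ,
            use₃ 1# 1# (m ² ²) dir r²≡′ ε≡ (use₁ (τ * (m * n′ + s)) mn′≡s
              (solve 9 (λ τ m n s r q X ε η → m :² :* (τ :* n :² :- (η :* m) :²) := con 2# :*
              (q :+ con 2# :* X) :+ con 1# :* (τ :* s :² :- r :² :- con 2# :* q) :+ con 1# :*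
              (r :² :- (ε :* m :² :² :+ con 4# :* X)) :+ m :² :² :* (ε :- η :²) :+ τ :*
              (m :* n :+ s) :* (m :* n :- s)) refl τ m n′ s r q X ε η)))

          N²≡ : η * r * (η * r) ≡ R ² ² - 2# * μ * τ * R ² * (2# * n₁) ²
            + τ ² * θ³ * (2# * n₁) ² ²
          N²≡ = use₃ ε (τ ² * θ³ * (2# * n₁) ² ²)
            (m ² ² * (ε + η ²) - 2# * μ * τ * m ² * (2# * n₁) ² - r ²) r²≡₁ εε′≡1 ε≡
              (solve 7 (λ ε ε′ η m n τ r → (η :* r) :² := (η :* m) :² :² :- con 2# :* con μ :* τ :*
              (η :* m) :² :* n :² :+ τ :² :* con θ³ :* n :² :² :+ ε :*
              (r :² :- (ε :* m :² :² :- con 2# :* con μ :* τ :* m :² :* n :² :+ ε′ :*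
              (τ :² :* con θ³) :* n :² :²)) :+ τ :² :* con θ³ :* n :² :² :* (ε :* ε′ :- con 1#) :+
              (m :² :² :* (ε :+ η :²) :- con 2# :* con μ :* τ :* m :² :* n :² :- r :²) :*
              (ε :- η :²)) refl ε ε′ η m (2# * n₁) τ r)

    -- A B is t⁴ up to a unit and A, B are coprime, so A = ε m⁴ and B = ε′ τ² θ³ n⁴ with t = m n;
    -- the sum A + B then gives the quartic of the isogenous curve.
    first-isogeny : ∀ k → ¬ Solution k → ¬ Solution (suc k)
    first-isogeny k IH (solution r s A B or crt sum prod dir) =
      conclude (coprime-fourthPowers cAB′ (*≢0 (pow2≢0 (suc k)) (odd≢0 (dir⇒odd or dir))) eq)
      where
      t = pow2 (suc k) * s
      ρ³ = ρ ² * ρ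

      τ²θ³-unit : IsUnit (τ ² * θ³)
      τ²θ³-unit = unit-* (unit-* τ-unit τ-unit) (ρ³ , refl)

      cAB : Coprime A B
      cAB = coprime-by A B λ g g∣A g∣B → unit-∣ (coprime∧∣*⇒∣
        (coprime-² (coprime-² (g⊥t g g∣A g∣B)))
        (subst (g ∣_) (trans prod (*-comm (τ ² * θ³) _)) (∣-* B g∣A))) τ²θ³-unit
        where
        g⊥t : ∀ g → g ∣ A → g ∣ B → Coprime g t
        g⊥t g g∣A g∣B = coprime-by g t λ d d∣g d∣t → coprime∧∣⇒unit (coprime-² (d⊥r d d∣t))
          (subst (d ∣_) (trans (cong (_- 2# * μ * τ * t ²) sum)
            (solve 3 (λ r t τ → r :² :+ con 2# :* con μ :* τ :* t :² :- con 2# :* con μ :* τ :* t :²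
            := r :²) refl r t τ))
            (∣-+ (∣-+ (∣-trans d∣g g∣A) (∣-trans d∣g g∣B))
              (subst (d ∣_) (solve 2 (λ t τ → t :* (:- (t :* (con 2# :* con μ :* τ))) := :-
              (con 2# :* con μ :* τ :* t :²)) refl t τ) (∣-* (- (t * (2# * μ * τ))) d∣t))))
          where
          d⊥r : ∀ d → d ∣ t → Coprime d r
          d⊥r d (c , t≡dc) = coprime-sym (coprime-factorʳ c (subst (Coprime r) t≡dc crt))

      cAB′ : Coprime A (B * (τ′ ² * ρ³))
      cAB′ = coprime-* cAB (coprime-sym (unit⇒coprime A
        (τ ² * θ³ , use₁ (τ * τ′ + 1#) ττ′≡1 (solve 2
        (λ τ τ′ → τ′ :² :* (con ρ :² :* con ρ) :* (τ :² :* con θ³) := con 1# :+ (τ :* τ′ :+ con 1#)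
        :* (τ :* τ′ :- con 1#)) refl τ τ′))))

      eq : A * (B * (τ′ ² * ρ³)) ≡ t ² ²
      eq = use₂ (τ′ ² * ρ³) (t ² ² * (τ * τ′ + 1#)) prod ττ′≡1
        (solve 5 (λ A B τ τ′ X → A :* (B :* (τ′ :² :* (con ρ :² :* con ρ))) := X :+ τ′ :² :*
        (con ρ :² :* con ρ) :* (A :* B :- τ :² :* con θ³ :* X) :+ X :* (τ :* τ′ :+ con 1#) :*
        (τ :* τ′ :- con 1#)) refl A B τ τ′ (t ² ²))

      conclude : FourthPowers A (B * (τ′ ² * ρ³)) t → ⊥
      conclude (fourthPowers ε ε′ m n εε′≡1 A≡ B≡ t≡mn) = split (even? n)
        where
        cmn : Coprime m n
        cmn = coprime-factorˡ m (coprime-factorʳ n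
          (coprime-roots ε ε′ (m ²) (n ²) (subst₂ Coprime A≡ B≡ cAB′)))

        r²≡ : r * r ≡ ε * m ² ² - 2# * μ * τ * m ² * n ² + ε′ * (τ ² * θ³) * n ² ²
        r²≡ = use₃ (- 1#) 1# (τ ² * θ³) sum A≡ B≡ (use₂ (- (2# * μ * τ * (t + m * n)))
          (- (B * (τ * τ′ + 1#))) t≡mn ττ′≡1
          (solve 10 (λ r A B τ τ′ t m n ε ε′ → r :² := ε :* m :² :² :- con 2# :* con μ :* τ :* m :²
            :* n :² :+ ε′ :* (τ :² :* con θ³) :* n :² :² :+ (:- con 1#) :*
            (A :+ B :- (r :² :+ con 2# :* con μ :* τ :* t :²)) :+ con 1# :* (A :- ε :* m :² :²) :+ τ
            :² :* con θ³ :* (B :* (τ′ :² :* (con ρ :² :* con ρ)) :- ε′ :* n :² :²) :+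
            (:- (con 2# :* con μ :* τ :* (t :+ m :* n))) :* (t :- m :* n) :+
            (:- (B :* (τ :* τ′ :+ con 1#))) :* (τ :* τ′ :- con 1#)) refl r A B τ τ′ t m n ε ε′))

        -- Exchanging m and n replaces ε by ε′ τ² θ³.
        split : Dec (2# ∣ n) → ⊥
        split (yes 2∣n) = first-isogeny′ k IH or dir εε′≡1 cmn (sym t≡mn) 2∣n r²≡
        split (no on) = first-isogeny′ k {ε = ε′ * (τ ² * θ³)} {ε′ = ε * (τ′ ² * ρ³)} IH or dir
          (use₂ 1# (ε * ε′ * (τ * τ′ + 1#)) εε′≡1 ττ′≡1
            (solve 4 (λ ε ε′ τ τ′ → ε′ :* (τ :² :* con θ³) :* (ε :* (τ′ :² :* (con ρ :² :* con ρ)))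
            := con 1# :+ con 1# :* (ε :* ε′ :- con 1#) :+ ε :* ε′ :* (τ :* τ′ :+ con 1#) :*
            (τ :* τ′ :- con 1#)) refl ε ε′ τ τ′)) (coprime-sym cmn)
          (trans (*-comm n m) (sym t≡mn))
          (even-cancel on (pow2 k * s , trans (*-comm n m)
            (trans (sym t≡mn) (*-assoc 2# (pow2 k) s))))
          (use₂ 1# (- (ε * m ² ² * (τ * τ′ + 1#))) r²≡ ττ′≡1
            (solve 7 (λ r ε ε′ τ τ′ m n → r :² := ε′ :* (τ :² :* con θ³) :* n :² :² :- con 2# :*
            con μ :* τ :* n :² :* m :² :+ ε :* (τ′ :² :* (con ρ :² :* con ρ)) :* (τ :² :* con θ³) :*
            m :² :² :+ con 1# :* (r :² :- (ε :* m :² :² :- con 2# :* con μ :* τ :* m :² :* n :² :+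
            ε′ :* (τ :² :* con θ³) :* n :² :²)) :+ (:- (ε :* m :² :² :* (τ :* τ′ :+ con 1#))) :*
            (τ :* τ′ :- con 1#)) refl r ε ε′ τ τ′ m n))

    no-solution : ∀ k → ¬ Solution k
    no-solution zero    = base
    no-solution (suc k) = first-isogeny k (no-solution k)

  -- Solutions whose t is a rational integer

  two-adic : ∀ n → n ≢ + 0 → ∃₂ λ k s → ι n ≡ pow2 k * (1# + 2# * ι s)
  two-adic n = go n (<-wellFounded (abs n))
    where
    go : ∀ n → Acc ℕ._<_ (abs n) → n ≢ + 0 → ∃₂ λ k s → ι n ≡ pow2 k * (1# + 2# * ι s)
    go n (acc rs) n≢0 with parity n
    ... | inj₂ (s , refl) = 0 , s , trans (cong (λ x → 1# + x) (ι-* (+ 2) s))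
      (solve 1 (λ x → x := con 1# :* x) refl (1# + 2# * ι s))
    ... | inj₁ (m , refl) = extend (go m (rs smaller) m≢0)
      where
      m≢0 : m ≢ + 0
      m≢0 refl = n≢0 refl
      smaller : abs m ℕ.< abs (+ 0 ℤ.+ + 2 ℤ.* m)
      smaller = subst (abs m ℕ.<_) (sym (trans (cong abs (ℤₚ.+-identityˡ (+ 2 ℤ.* m)))
        (ℤₚ.abs-* (+ 2) m)))
        (ℕₚ.m<m+n (abs m) (ℕₚ.<-≤-trans (ℕₚ.n≢0⇒n>0 (m≢0 ∘ ℤₚ.∣i∣≡0⇒i≡0)) (ℕₚ.m≤m+n (abs m) 0)))
      extend : (∃₂ λ k s → ι m ≡ pow2 k * (1# + 2# * ι s)) → ∃₂ λ k s → ι (+ 0 ℤ.+ + 2 ℤ.* m) ≡ pow2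
        k * (1# + 2# * ι s)
      extend (k , s , eq) = suc k , s , trans (cong ι (ℤₚ.+-identityˡ (+ 2 ℤ.* m)))
        (trans (ι-* (+ 2) m)
        (trans (cong (2# *_) eq) (sym (*-assoc 2# (pow2 k) (1# + 2# * ι s)))))

  module Conclusion (τ τ′ : ℤ[θ]) (ττ′≡1 : τ * τ′ ≡ 1#) where
    open Descent τ τ′ ττ′≡1

    -- Solutions are not assumed primitive here: a common factor g of r and t is odd, and g²
    -- divides B - A because g⁴ divides its square.
    no-imprimitive-solution : ∀ k {r s A B} → let t = pow2 k * s in Odd r →
      A + B ≡ r ² + 2# * μ * τ * t ² → A * B ≡ τ ² * θ³ * t ² ² →
      2# ∣ τ * s ² - r ² → ⊥
    no-imprimitive-solution k {r} {s} {A} {B} or sum prod dir = go₁ (gcd r (pow2 k * s))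
      where
      t = pow2 k * s
      go₁ : Bézout r t → ⊥
      go₁ G@(bézout g a b _ _ r≡ga t≡gb _) =
        go₂ (pow2-cofactor k og (sym t≡gb)) (x²∣y²⇒x∣y (g ²) (B - A) (*≢0 (odd≢0 og) (odd≢0 og))
          g⁴∣)
        where
        og : Odd g
        og = odd-factor a (subst Odd r≡ga or)
        oa : Odd a
        oa = odd-factor g (subst Odd (trans r≡ga (*-comm g a)) or)

        S = a ² + 2# * μ * τ * b ²

        sum′ : A + B ≡ g ² * S
        sum′ = use₃ 1# (r + g * a) (2# * μ * τ * (t + g * b)) sum r≡ga t≡gb
          (solve 8 (λ A B r t τ g a b → A :+ B := g :² :* (a :² :+ con 2# :* con μ :* τ :* b :²) :+
          con 1# :* (A :+ B :- (r :² :+ con 2# :* con μ :* τ :* t :²)) :+ (r :+ g :* a) :*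
          (r :- g :* a) :+ con 2# :* con μ :* τ :* (t :+ g :* b) :* (t :- g :* b)) refl A B r t τ g
          a b)

        prod′ : A * B ≡ g ² ² * (τ ² * θ³ * b ² ²)
        prod′ = trans prod (trans (cong (λ t → τ ² * θ³ * t ² ²) t≡gb)
          (solve 3 (λ τ g b → τ :² :* con θ³ :* (g :* b) :² :² := g :² :² :*
          (τ :² :* con θ³ :* b :² :²)) refl τ g b))

        D = S ² - 4# * (τ ² * θ³ * b ² ²)

        g⁴∣ : g * g * g ² ∣ (B - A) * (B - A)
        g⁴∣ = D , use₂ (A + B + g ² * S) (- 4#) sum′ prod′
          (solve 5 (λ A B g S X → (B :- A) :* (B :- A) := g :² :² :* (S :² :- con 4# :* X) :+
          (A :+ B :+ g :² :* S) :* (A :+ B :- g :² :* S) :+ (:- con 4#) :* (A :* B :- g :² :² :* X))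
          refl A B g S (τ ² * θ³ * b ² ²))

        go₂ : (∃[ b′ ] b ≡ pow2 k * b′ × g * b′ ≡ s) → g ² ∣ B - A → ⊥
        go₂ (b′ , b≡ , gb′≡s) (M , B-A≡g²M) = go₃ (even-cancel (odd-* og og) (A , 2A≡))
          where
          2A≡ : g * g * (S - M) ≡ 2# * A
          2A≡ = use₂ (- 1#) 1# sum′ B-A≡g²M (solve 5
            (λ A B g S M → g :² :* (S :- M) := con 2# :* A :+ (:- con 1#) :* (A :+ B :- g :² :* S)
            :+ con 1# :* (B :- A :- g :² :* M)) refl A B g S M)

          M²≡ : M * M ≡ D
          M²≡ = *-cancelˡ (g ²) (*≢0 (odd≢0 og) (odd≢0 og))
            (*-cancelˡ (g ²) (*≢0 (odd≢0 og) (odd≢0 og))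
            (use₂ 1# (- (B - A + g ² * M)) (proj₂ g⁴∣) B-A≡g²M
              (solve 5 (λ A B g M D → g :² :* (g :² :* M :²) := g :² :* (g :² :* D) :+ con 1# :*
              ((B :- A) :* (B :- A) :- g :² :² :* D) :+ (:- (B :- A :+ g :² :* M)) :*
              (B :- A :- g :² :* M)) refl A B g M D)))

          go₃ : 2# ∣ S - M → ⊥
          go₃ (A₁ , S-M≡2A₁) = no-solution k (solution a b′ A₁ (A₁ + M) oa
            (subst (Coprime a) b≡ (cofactors-coprime G (odd≢0 og)))
            (trans (use₁ (- 1#) S-M≡2A₁ (solve 3 (λ S M A → A :+ (A :+ M) := S :+ (:- con 1#) :*
              (S :- M :- con 2# :* A)) refl S M A₁)) (cong (λ b → a ² + 2# * μ * τ * b ²) b≡))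
            (trans (*-cancelˡ 4# (λ ()) (use₂ (- (S + M + 2# * A₁)) (- 1#) S-M≡2A₁ M²≡
              (solve 4 (λ S M A X → con 4# :* (A :* (A :+ M)) := con 4# :* X :+
              (:- (S :+ M :+ con 2# :* A)) :* (S :- M :- con 2# :* A) :+ (:- con 1#) :*
              (M :² :- (S :² :- con 4# :* X))) refl S M A₁ (τ ² * θ³ * b ² ²))))
              (cong (λ b → τ ² * θ³ * b ² ²) b≡))
            (even-cancel (odd-* og og) (subst (2# ∣_) dir-eq dir)))
            where
            dir-eq : τ * s ² - r ² ≡ g ² * (τ * b′ ² - a ²)
            dir-eq = use₂ (- (τ * (s + g * b′))) (- (r + g * a)) gb′≡s r≡ga
              (solve 6 (λ s r τ g b a → τ :* s :² :- r :² := g :² :* (τ :* b :² :- a :²) :+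
              (:- (τ :* (s :+ g :* b))) :* (g :* b :- s) :+ (:- (r :+ g :* a)) :* (r :- g :* a))
              refl s r τ g b′ a)

    -- The place where rationality is used. An odd element of ℤ[θ] may have any of seven residues
    -- modulo 2, but the odd part s of a rational integer has residue 1, so L² ≡ τ already gives the
    -- direction τ s² ≡ L².
    Δ≡0 : ∀ {A B L} n → A + B ≡ L ² + 2# * μ * τ * (ι n * ι n) →
      A * B ≡ τ ² * θ³ * (ι n * ι n * (ι n * ι n)) → 2# ∣ L ² - τ → n ≡ + 0
    Δ≡0 {A} {B} {L} n sum prod (c , L²≡) with n ℤₚ.≟ + 0
    ... | yes n≡0 = n≡0
    ... | no  n≢0 = ⊥-elim (conclude (two-adic n n≢0))
      where
      oL : Odd L
      oL = odd-factor L (odd-resp (c , L²≡) (unit⇒odd τ-unit))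
      conclude : (∃₂ λ k s → ι n ≡ pow2 k * (1# + 2# * ι s)) → ⊥
      conclude (k , s , eq) = no-imprimitive-solution k oL
        (subst (λ t → A + B ≡ L ² + 2# * μ * τ * t ²) eq sum)
        (subst (λ t → A * B ≡ τ ² * θ³ * t ² ²) eq prod)
        (2# * τ * (ι s + ι s * ι s) - c , use₁ (- 1#) L²≡
          (solve 4 (λ τ s L c → τ :* ((con 1# :+ con 2# :* s) :* (con 1# :+ con 2# :* s)) :- L :² :=
          con 2# :* (con 2# :* τ :* (s :+ s :²) :- c) :+ (:- con 1#) :* (L :² :- τ :- con 2# :* c))
          refl τ (ι s) L c))

  -- The factorisation f = norm G

  G : ℤ → ℤ → ℤ[θ]
  G a b = ⟨ b ℤ.* b , + 2 ℤ.* (a ℤ.* a) , + 2 ℤ.* (a ℤ.* b) ⟩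

  sextic : ℤ → ℤ → ℤ
  sextic a b = + 8 ℤ.* (a ℤ.* a ℤ.* a ℤ.* a ℤ.* a ℤ.* a) ℤ.- + 12 ℤ.*
    (a ℤ.* a ℤ.* a ℤ.* a ℤ.* b ℤ.* b)
    ℤ.- + 4 ℤ.* (a ℤ.* a ℤ.* a ℤ.* b ℤ.* b ℤ.* b) ℤ.+ + 4 ℤ.* (a ℤ.* a ℤ.* b ℤ.* b ℤ.* b ℤ.* b)
    ℤ.+ + 4 ℤ.* (a ℤ.* b ℤ.* b ℤ.* b ℤ.* b ℤ.* b) ℤ.+ b ℤ.* b ℤ.* b ℤ.* b ℤ.* b ℤ.* b

  norm-G : ∀ a b → norm (G a b) ≡ sextic a b
  norm-G = ℤ-solve 2 (λ a b → normᵖ ⟪ b ⊗ b , # 2 ⊗ (a ⊗ a) , # 2 ⊗ (a ⊗ b) ⟫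
    ⊜ # 8 ⊗ (a ⊗ a ⊗ a ⊗ a ⊗ a ⊗ a) ⊖ # 12 ⊗ (a ⊗ a ⊗ a ⊗ a ⊗ b ⊗ b)
      ⊖ # 4 ⊗ (a ⊗ a ⊗ a ⊗ b ⊗ b ⊗ b) ⊕ # 4 ⊗ (a ⊗ a ⊗ b ⊗ b ⊗ b ⊗ b)
      ⊕ # 4 ⊗ (a ⊗ b ⊗ b ⊗ b ⊗ b ⊗ b) ⊕ b ⊗ b ⊗ b ⊗ b ⊗ b ⊗ b) refl

  λ[_,_] : ℤ → ℤ → ℤ[θ]
  λ[ a , b ] = ⟨ a , b , + 0 ⟩

  Gᵖ λᵖ : Triple 2
  Gᵖ = let a = var 0F ; b = var 1F in ⟪ b ⊗ b , # 2 ⊗ (a ⊗ a) , # 2 ⊗ (a ⊗ b) ⟫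
  λᵖ = ⟪ var 0F , var 1F , # 0 ⟫

  λ-expand : ∀ a b → λ[ a , b ] ≡ ι a + θ * ι b
  λ-expand a b = coordinatewise λᵖ (ιᵖ (var 0F) +ᵖ θᵖ *ᵖ ιᵖ (var 1F)) (a ∷ b ∷ []) refl refl refl

  G-expand : ∀ a b → G a b ≡ ι b * ι b + 2# * (θ * (ι a * λ[ a , b ]))
  G-expand a b = coordinatewise Gᵖ
    (ιᵖ (var 1F) *ᵖ ιᵖ (var 1F) +ᵖ ιᵖ (# 2) *ᵖ (θᵖ *ᵖ (ιᵖ (var 0F) *ᵖ λᵖ))) (a ∷ b ∷ []) refl refl
      refl

  -- θ³ - θ - 1 has derivative f′ = 3θ² - 1 at θ.
  f′ : ℤ[θ]
  f′ = ⟨ -[1+ 0 ] , + 0 , + 3 ⟩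

  -- Modulo G a conjugate G′ equals G′ - G = (θ′ - θ) (2 a² + 2 a b (θ + θ′)). Since the conjugates
  -- of θ have sum 0 and product 1, the two such factors multiply to 4 a² `f′` (a² + a b θ + b² ρ),
  -- and b² ρ ≡ - 2 a (a + θ b) modulo G.
  adj-G : ∀ a b → ∃[ q ] 4# * f′ * (ι a * ι a) * (ι a * λ[ a , b ]) + adj (G a b) ≡ G a b * q
  adj-G a b = evalᵗ qᵖ (a ∷ b ∷ []) , coordinatewise
    (ιᵖ (# 4) *ᵖ ⟪ K -[1+ 0 ] , # 0 , # 3 ⟫ *ᵖ (ιᵖ (var 0F) *ᵖ ιᵖ (var 0F)) *ᵖ (ιᵖ (var 0F) *ᵖ λᵖ)
      +ᵖ adjᵖ Gᵖ)
    (Gᵖ *ᵖ qᵖ) (a ∷ b ∷ []) refl refl refl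
    where
    qᵖ : Triple 2
    qᵖ = let a = var 0F ; b = var 1F ; c = # 4 ⊗ a ⊗ (a ⊕ b) in ⟪ b ⊗ b ⊕ c , # 8 ⊗ a ⊗ a , ⊝ c ⟫

  -- f′ generates the ramified prime above 23; its residue field is obtained by θ ↦ 10.
  private
    ev : ℤ[θ] → ℤ
    ev ⟨ p , q , r ⟩ = p ℤ.+ q ℤ.* + 10 ℤ.+ r ℤ.* + 100

    ev-f′* : ∀ k → + 23 ℤ∣.∣ ev (f′ * k)
    ev-f′* ⟨ p , q , r ⟩ = ℤ∣.divides (p ℤ.* + 13 ℤ.+ q ℤ.+ r ℤ.* + 10)
      (ℤ-solve 3 (λ p q r → let k = ⟪ K -[1+ 0 ] , # 0 , # 3 ⟫ *ᵖ ⟪ p , q , r ⟫ in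
        #₀ k ⊕ #₁ k ⊗ # 10 ⊕ #₂ k ⊗ # 100 ⊜ (p ⊗ # 13 ⊕ q ⊕ r ⊗ # 10) ⊗ # 23) refl p q r)

    form : ℤ → ℤ → ℤ
    form a b = b ℤ.* b ℤ.+ a ℤ.* a ℤ.* + 20 ℤ.+ a ℤ.* b ℤ.* + 200

    -- - 2 is not a square modulo 23.
    form-anisotropic : ∀ a b → + 23 ℤ∣.∣ form a b → (+ 23 ℤ∣.∣ a) × (+ 23 ℤ∣.∣ b)
    form-anisotropic a b 23∣ = conclude (check (residue23 a) (residue23 b)
        (subst (+ 23 ℤ∣.∣_) (cong₂ (λ i j → form (+ i) (+ j)) (sym (toℕ-fromℕ< (n%ℕd<d a 23)))
          (sym (toℕ-fromℕ< (n%ℕd<d b 23)))) 23∣′))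
      where
      residue23 : ℤ → Fin 23
      residue23 n = fromℕ< (n%ℕd<d n 23)

      check : ∀ (i j : Fin 23) → + 23 ℤ∣.∣ form (+ toℕ i) (+ toℕ j) → toℕ i ≡ 0 × toℕ j ≡ 0
      check = from-yes (all? λ (i : Fin 23) → all? λ (j : Fin 23) →
        (+ 23 ℤ∣.∣? form (+ toℕ i) (+ toℕ j)) →-dec
        ((toℕ i ℕₚ.≟ 0) ×-dec (toℕ j ℕₚ.≟ 0)))

      23∣′ : + 23 ℤ∣.∣ form (+ (a %ℕ 23)) (+ (b %ℕ 23))
      23∣′ = ℤ∣.∣m+n∣n⇒∣m (subst (+ 23 ℤ∣.∣_)
        (trans (cong₂ form (a≡a%ℕn+[a/ℕn]*n a 23) (a≡a%ℕn+[a/ℕn]*n b 23))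
          (h (+ (a %ℕ 23)) (a /ℕ 23) (+ (b %ℕ 23)) (b /ℕ 23))) 23∣)
        (ℤ∣.divides (carry (+ (a %ℕ 23)) (a /ℕ 23) (+ (b %ℕ 23)) (b /ℕ 23)) refl)
        where
        carry : (i a j b : ℤ) → ℤ
        carry i a j b = j ℤ.* b ℤ.* + 2 ℤ.+ b ℤ.* b ℤ.* + 23 ℤ.+
          (i ℤ.* a ℤ.* + 2 ℤ.+ a ℤ.* a ℤ.* + 23) ℤ.* + 20
          ℤ.+ (i ℤ.* b ℤ.+ a ℤ.* j ℤ.+ a ℤ.* b ℤ.* + 23) ℤ.* + 200
        h : ∀ i a j b → form (i ℤ.+ a ℤ.* + 23) (j ℤ.+ b ℤ.* + 23) ≡ form i j ℤ.+ carry i a j b ℤ.*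
          + 23
        h = ℤ-solve 4 (λ i a j b → let form = λ a b → b ⊗ b ⊕ a ⊗ a ⊗ # 20 ⊕ a ⊗ b ⊗ # 200 in
          form (i ⊕ a ⊗ # 23) (j ⊕ b ⊗ # 23) ⊜ form i j ⊕
          (j ⊗ b ⊗ # 2 ⊕ b ⊗ b ⊗ # 23 ⊕ (i ⊗ a ⊗ # 2 ⊕ a ⊗ a ⊗ # 23) ⊗ # 20
           ⊕ (i ⊗ b ⊕ a ⊗ j ⊕ a ⊗ b ⊗ # 23) ⊗ # 200) ⊗ # 23) refl

      conclude : toℕ (residue23 a) ≡ 0 × toℕ (residue23 b) ≡ 0 → (+ 23 ℤ∣.∣ a) × (+ 23 ℤ∣.∣ b)
      conclude (a≡0 , b≡0) = divisible a a≡0 , divisible b b≡0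
        where
        divisible : ∀ n → toℕ (residue23 n) ≡ 0 → + 23 ℤ∣.∣ n
        divisible n eq = ℤ∣.divides (n /ℕ 23) (trans (a≡a%ℕn+[a/ℕn]*n n 23)
          (trans (cong (λ r → + r ℤ.+ n /ℕ 23 ℤ.* + 23) (trans (sym (toℕ-fromℕ< (n%ℕd<d n 23))) eq))
            (ℤₚ.+-identityˡ _)))

  -- Coprimality of G and its adjugate

  odd⇒norm-odd : ∀ {z} → Odd z → Odd (ι (norm z))
  odd⇒norm-odd {z} odd = conclude (inverse-mod-2 z odd)
    where
    conclude : (∃₂ λ y k → z * y ≡ 1# + 2# * k) → Odd (ι (norm z))
    conclude (y , k , zy≡) = finish (norm-1+2k k)
      where
      finish : (∃[ m ] norm (1# + 2# * k) ≡ + 1 ℤ.+ + 2 ℤ.* m) → Odd (ι (norm z))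
      finish (m , eq) = odd-factor (ι (norm y)) (odd-resp {y = 1#} (ι m , (begin
        ι (norm z) * ι (norm y) - 1#     ≡⟨ cong (_- 1#) (ι-* (norm z) (norm y)) ⟨
        ι (norm z ℤ.* norm y) - 1#       ≡⟨ cong (λ n → ι n - 1#)
          (trans (sym (norm-* z y)) (trans (cong norm zy≡) eq)) ⟩
        1# + ι (+ 2 ℤ.* m) - 1#          ≡⟨ cong (λ x → 1# + x - 1#) (ι-* (+ 2) m) ⟩
        1# + 2# * ι m - 1#               ≡⟨ h (ι m) ⟩
        2# * ι m                         ∎)) (unit⇒odd (1# , refl)))
        where
        h : ∀ x → 1# + 2# * x - 1# ≡ 2# * x
        h = solve 1 (λ x → con 1# :+ con 2# :* x :- con 1# := con 2# :* x) refl

  -- Here ϕ stands for f′ and δ for adj γ.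
  module _ {α β l γ : ℤ[θ]} (α⊥β : Coprime α β) (l≡ : l ≡ α + θ * β)
    (γ≡ : γ ≡ β ² + 2# * (θ * (α * l))) where

    even-β⇒γ≡2odd : 2# ∣ β → ∃[ γ₁ ] Odd γ₁ × γ ≡ 2# * γ₁
    even-β⇒γ≡2odd (c , β≡2c) = θ * (α * l) + 2# * c ² ,
      odd-resp (θ * α * θ * c + c ² , use₂ (θ * α) (θ * α * θ) l≡ β≡2c
        (solve 4 (λ α β c l → con θ :* (α :* l) :+ con 2# :* c :² :- con θ :* α :² := con 2# :*
        (con θ :* α :* con θ :* c :+ c :²) :+ con θ :* α :* (l :- (α :+ con θ :* β)) :+ con θ :* α
        :* con θ :* (β :- con 2# :* c)) refl α β c l)) (odd-* (unit⇒odd (ρ , refl)) (odd-* oα oα)) ,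
      use₂ 1# (β + 2# * c) γ≡ β≡2c (solve 4 (λ γ β c X → γ := con 2# :* (X :+ con 2# :* c :²) :+
        con 1# :* (γ :- (β :² :+ con 2# :* X)) :+ (β :+ con 2# :* c) :* (β :- con 2# :* c)) refl γ β
        c (θ * (α * l)))
      where
      oα : Odd α
      oα 2∣α = contradiction (unit⇒∣norm∣≡1 (coprime∧∣⇒unit (coprime-sym (β⊥2 2∣α)) (c , β≡2c)))
        λ ()
        where
        β⊥2 : 2# ∣ α → Coprime β 2#
        β⊥2 (k , α≡) = coprime-factorʳ k (subst (Coprime β) α≡ (coprime-sym α⊥β))

    module _ (oβ : Odd β) where

      odd-β⇒odd-γ : Odd γ
      odd-β⇒odd-γ = odd-resp {y = β * β} (θ * (α * l) , use₁ 1# γ≡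
        (solve 3 (λ γ β X → γ :- β :² := con 2# :* X :+ con 1# :* (γ :- (β :² :+ con 2# :* X))) refl
        γ β (θ * (α * l)))) (odd-* oβ oβ)

      γ⊥α : Coprime γ α
      γ⊥α = combine (coprime-sym (coprime-² α⊥β))
        where
        combine : Coprime (β ²) α → Coprime γ α
        combine (u , v , eq) = u , v - 2# * (u * (θ * l)) , use₂ u 1# γ≡ eq
          (solve 6 (λ u v α β l γ → u :* γ :+ (v :- con 2# :* (u :* (con θ :* l))) :* α := con 1# :+
          u :* (γ :- (β :² :+ con 2# :* (con θ :* (α :* l)))) :+ con 1# :*
          (u :* β :² :+ v :* α :- con 1#)) refl u v α β l γ)

      γ⊥β : Coprime γ β
      γ⊥β = combine (coprime-sym (coprime-* (odd⇒coprime-2 oβ)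
        (coprime-* (coprime-sym (unit⇒coprime β (ρ , refl)))
        (coprime-* (coprime-sym α⊥β) (coprime-sym (l⊥β α⊥β))))))
        where
        l⊥β : Coprime α β → Coprime l β
        l⊥β (u , v , eq) = u , v - u * θ , use₂ u 1# l≡ eq
          (solve 5 (λ u v α β l → u :* l :+ (v :- u :* con θ) :* β := con 1# :+ u :*
          (l :- (α :+ con θ :* β)) :+ con 1# :* (u :* α :+ v :* β :- con 1#)) refl u v α β l)
        combine : Coprime (2# * (θ * (α * l))) β → Coprime γ β
        combine (u , v , eq) = u , v - u * β , use₂ u 1# γ≡ eq
          (solve 5 (λ u v β γ X → u :* γ :+ (v :- u :* β) :* β := con 1# :+ u :* (γ :- (β :² :+ X))
          :+ con 1# :* (u :* X :+ v :* β :- con 1#)) refl u v β γ (2# * (θ * (α * l))))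

      γ⊥δ : ∀ {ϕ δ q} → Coprime γ ϕ → 4# * ϕ * α ² * (α * l) + δ ≡ γ * q → Coprime γ δ
      γ⊥δ {ϕ} {δ} {q} γ⊥ϕ eq = combine (coprime-* (coprime-* γ⊥ϕ (coprime-² γ⊥α)) (coprime-² γ⊥β))
        where
        -- 2 θ δ ≡ - 8 θ ϕ α³ l ≡ 4 ϕ α² β² modulo γ.
        combine : Coprime γ (ϕ * α ² * β ²) → Coprime γ δ
        combine c = coprime-factorʳ (2# * θ) (transfer
          (coprime-* (coprime-* (odd⇒coprime-2 odd-β⇒odd-γ) (odd⇒coprime-2 odd-β⇒odd-γ)) c))
          where
          transfer : Coprime γ (2# ² * (ϕ * α ² * β ²)) → Coprime γ (δ * (2# * θ))
          transfer (u , v , eq′) = u + v * (4# * ϕ * α ² - 2# * θ * q) , v ,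
            use₃ (v * (4# * ϕ * α ²)) (2# * θ * v) 1# γ≡ eq eq′
              (solve 9 (λ u v α β l γ ϕ δ q → (u :+ v :*
              (con 4# :* ϕ :* α :² :- con 2# :* con θ :* q)) :* γ :+ v :* (δ :* (con 2# :* con θ))
              := con 1# :+ v :* (con 4# :* ϕ :* α :²) :*
              (γ :- (β :² :+ con 2# :* (con θ :* (α :* l)))) :+ con 2# :* con θ :* v :*
              (con 4# :* ϕ :* α :² :* (α :* l) :+ δ :- γ :* q) :+ con 1# :*
              (u :* γ :+ v :* (con 2# :² :* (ϕ :* α :² :* β :²)) :- con 1#)) refl u v α β l γ ϕ δ q)

  module Curve (a b Y u v : ℤ) (ua+vb≡1 : u ℤ.* a ℤ.+ v ℤ.* b ≡ + 1) (Y²≡ : Y ℤ.* Y ≡ sextic a b)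
    where

    γ : ℤ[θ]
    γ = G a b

    α⊥β : Coprime (ι a) (ι b)
    α⊥β = ι u , ι v , trans (cong₂ _+_ (sym (ι-* u a)) (sym (ι-* v b))) (cong ι ua+vb≡1)

    norm-γ : norm γ ≡ Y ℤ.* Y
    norm-γ = trans (norm-G a b) (sym Y²≡)

    -- The exponent of the prime 2 in a square is not 3.
    Y²≢8odd : ∀ {y n} → Odd n → y ² ≢ ι (+ 8) * n
    Y²≢8odd {y} {n} on y²≡8n = step₁ (even-² y (4# * n , trans y²≡8n
      (solve 1 (λ n → con (ι (+ 8)) :* n := con 2# :* (con 4# :* n)) refl n)))
      where
      step₁ : 2# ∣ y → ⊥
      step₁ (y₁ , y≡2y₁) = step₂ (even-² y₁ (n , y₁²≡))
        where
        y₁²≡ : y₁ * y₁ ≡ 2# * n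
        y₁²≡ = *-cancelˡ 4# (λ ()) (use₂ 1# (- (y + 2# * y₁)) y²≡8n y≡2y₁
          (solve 3 (λ y y₁ n → con 4# :* y₁ :² := con 4# :* (con 2# :* n) :+ con 1# :*
          (y :² :- con (ι (+ 8)) :* n) :+ (:- (y :+ con 2# :* y₁)) :* (y :- con 2# :* y₁)) refl y y₁
          n))
        step₂ : 2# ∣ y₁ → ⊥
        step₂ (y₂ , y₁≡2y₂) = on (y₂ ² , *-cancelˡ 2# 2≢0
          (use₂ (- 1#) (y₁ + 2# * y₂) y₁²≡ y₁≡2y₂ (solve 3
          (λ n y₁ y₂ → con 2# :* n := con 2# :* (con 2# :* y₂ :²) :+ (:- con 1#) :*
          (y₁ :² :- con 2# :* n) :+ (y₁ :+ con 2# :* y₂) :* (y₁ :- con 2# :* y₂)) refl n y₁ y₂)))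

    -- If b is even, then γ = 2 × odd, and Y² = 8 × odd.
    oβ : Odd (ι b)
    oβ 2∣β = conclude (even-β⇒γ≡2odd α⊥β (λ-expand a b) (G-expand a b) 2∣β)
      where
      conclude : (∃[ γ₁ ] Odd γ₁ × γ ≡ 2# * γ₁) → ⊥
      conclude (γ₁ , oγ₁ , γ≡2γ₁) = Y²≢8odd {ι Y} {ι (norm γ₁)} (odd⇒norm-odd oγ₁) (begin
        ι Y * ι Y                ≡⟨ ι-* Y Y ⟨
        ι (Y ℤ.* Y)              ≡⟨ cong ι (trans (sym norm-γ)
          (trans (cong norm γ≡2γ₁) (norm-* 2# γ₁))) ⟩
        ι (+ 8 ℤ.* norm γ₁)      ≡⟨ ι-* (+ 8) (norm γ₁) ⟩
        ι (+ 8) * ι (norm γ₁)    ∎)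

    γ⊥f′ : Coprime γ f′
    γ⊥f′ = conclude (gcd f′ γ)
      where
      -- Under θ ↦ 10, γ becomes the value of a quadratic form anisotropic modulo 23, so `f′` could
      -- divide γ only if 23 divided both a and b.
      f′∤γ : ¬ f′ ∣ γ
      f′∤γ (k , γ≡) = from-no (+ 23 ℤ∣.∣? + 1) (23∣1
        (form-anisotropic a b (subst (+ 23 ℤ∣.∣_) (trans (cong ev (sym γ≡)) (h a b)) (ev-f′* k))))
        where
        h : ∀ a b → ev (G a b) ≡ form a b
        h = ℤ-solve 2 (λ a b → b ⊗ b ⊕ # 2 ⊗ (a ⊗ a) ⊗ # 10 ⊕ # 2 ⊗ (a ⊗ b) ⊗ # 100
          ⊜ b ⊗ b ⊕ a ⊗ a ⊗ # 20 ⊕ a ⊗ b ⊗ # 200) refl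
        23∣1 : (+ 23 ℤ∣.∣ a) × (+ 23 ℤ∣.∣ b) → + 23 ℤ∣.∣ + 1
        23∣1 (23∣a , 23∣b) = subst (+ 23 ℤ∣.∣_) ua+vb≡1
          (ℤ∣.∣m∣n⇒∣m+n (ℤ∣.∣n⇒∣m*n u 23∣a) (ℤ∣.∣n⇒∣m*n v 23∣b))
      conclude : Bézout f′ γ → Coprime γ f′
      conclude B@(bézout g c d _ _ f′≡gc γ≡gd _) =
        [ (λ g-unit → coprime-sym (gcd-unit⇒coprime B g-unit)) ,
        (λ (c′ , cc′≡1) → ⊥-elim (f′∤γ (c′ * d , use₃ 1# (- (c′ * d)) (- (g * d)) γ≡gd f′≡gc cc′≡1
          (solve 6 (λ f γ g c d c′ → γ := f :* (c′ :* d) :+ con 1# :* (γ :- g :* d) :+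
          (:- (c′ :* d)) :* (f :- g :* c) :+ (:- (g :* d)) :* (c :* c′ :- con 1#)) refl f′ γ g c d
          c′)))) ]′
        (Sum.map (∣norm∣≡1⇒unit g) (∣norm∣≡1⇒unit c)
          (divisor-of-23 (abs (norm g)) (abs (norm c)) (begin
          abs (norm g) ℕ.* abs (norm c)  ≡⟨ ℤₚ.abs-* (norm g) (norm c) ⟨
          abs (norm g ℤ.* norm c)        ≡⟨ cong abs (norm-* g c) ⟨
          abs (norm (g * c))             ≡⟨ cong (abs ∘ norm) f′≡gc ⟨
          23                             ∎)))

    γ⊥adj : Coprime γ (adj γ)
    γ⊥adj = γ⊥δ α⊥β (λ-expand a b) (G-expand a b) oβ γ⊥f′ (proj₂ (adj-G a b))

  -- The quartic attached to each known point

  ℤ-use₃ : ∀ {a b a′ b′ a″ b″ x w} k k′ k″ → a ≡ b → a′ ≡ b′ → a″ ≡ b″ →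
    x ≡ w ℤ.+ k ℤ.* (a ℤ.- b) ℤ.+ k′ ℤ.* (a′ ℤ.- b′) ℤ.+ k″ ℤ.* (a″ ℤ.- b″) → x ≡ w
  ℤ-use₃ {a} {a′ = a′} {a″ = a″} {w = w} k k′ k″ refl refl refl eq = trans eq
    (ℤ-solve 7 (λ a a′ a″ w k k′ k″ → w ⊕ k ⊗ (a ⊖ a) ⊕ k′ ⊗ (a′ ⊖ a′) ⊕ k″ ⊗ (a″ ⊖ a″) ⊜ w) refl a
    a′ a″ w k k′ k″)

  -- For the known point (x₀ : 1) and w₀ with G(x₀, 1) = τ w₀², let g be the polar form of G at
  -- (a, b) and (x₀, 1). Then g² - (τ w w₀)² = ρ³ (a - x₀ b)², and 2 β± = g ± τ w w₀.
  module Origin (τ τ′ : ℤ[θ]) (ττ′≡1 : τ * τ′ ≡ 1#) where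

    adj-ι : ∀ n → adj (ι n) ≡ ι n * ι n
    adj-ι n = coordinatewise (adjᵖ (ιᵖ (var 0F))) (ιᵖ (var 0F) *ᵖ ιᵖ (var 0F)) (n ∷ []) refl refl
      refl

    -- A = τ adj β₋ and B = τ adj β₊ satisfy A B = τ² θ³ n⁴, because `adj` is multiplicative, takes
    -- ρ to θ and squares the rational integer n.
    vanishes : ∀ β₋ β₊ L n → β₋ * β₊ ≡ ρ * ρ * ρ * (ι n * ι n) →
      τ * adj β₋ + τ * adj β₊ ≡ L * L + 2# * μ * τ * (ι n * ι n) → 2# ∣ L * L - τ → n ≡ + 0
    vanishes β₋ β₊ L n prod sum L²≡τ = Conclusion.Δ≡0 τ τ′ ττ′≡1 {L = L} n sum (begin
      τ * adj β₋ * (τ * adj β₊)                ≡⟨ h₁ τ (adj β₋) (adj β₊) ⟩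
      τ * τ * (adj β₋ * adj β₊)                ≡⟨ cong (τ * τ *_) (adj-* β₋ β₊) ⟨
      τ * τ * adj (β₋ * β₊)                    ≡⟨ cong (λ x → τ * τ * adj x) prod ⟩
      τ * τ * adj (ρ * ρ * ρ * (ι n * ι n))    ≡⟨ cong (τ * τ *_)
        (trans (adj-* (ρ * ρ * ρ) (ι n * ι n)) (cong (θ * θ * θ *_) (adj-* (ι n) (ι n)))) ⟩
      τ * τ * (θ * θ * θ * (adj (ι n) * adj (ι n)))
        ≡⟨ cong (λ x → τ * τ * (θ * θ * θ * (x * x))) (adj-ι n) ⟩
      τ * τ * (θ * θ * θ * (ι n * ι n * (ι n * ι n))) ≡⟨ h₂ τ (ι n * ι n * (ι n * ι n)) ⟩
      τ * τ * (θ * θ * θ) * (ι n * ι n * (ι n * ι n)) ∎) L²≡τ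
      where
      h₁ : ∀ τ x y → τ * x * (τ * y) ≡ τ * τ * (x * y)
      h₁ = solve 3 (λ τ x y → τ :* x :* (τ :* y) := τ :* τ :* (x :* y)) refl
      h₂ : ∀ τ x → τ * τ * (θ * θ * θ * x) ≡ τ * τ * (θ * θ * θ) * x
      h₂ = solve 2 (λ τ x → τ :* τ :* (con θ :* con θ :* con θ :* x) := τ :* τ :* (con θ :* con θ :*
        con θ) :* x) refl

  private
    prodʳ : ∀ {n} → Polynomial n → Triple n
    prodʳ d = ρᵖ *ᵖ ρᵖ *ᵖ ρᵖ *ᵖ (ιᵖ d *ᵖ ιᵖ d)

    sumˡ : ∀ {n} → (τ β₋ β₊ : Triple n) → Triple n
    sumˡ τ β₋ β₊ = τ *ᵖ adjᵖ β₋ +ᵖ τ *ᵖ adjᵖ β₊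

    sumʳ : ∀ {n} → (τ L : Triple n) → Polynomial n → Triple n
    sumʳ τ L d = L *ᵖ L +ᵖ ιᵖ (# 2) *ᵖ ⟪ # 1 , # 2 , K -[1+ 0 ] ⟫ *ᵖ τ *ᵖ (ιᵖ d *ᵖ ιᵖ d)

  -- The three equations are the coordinates of G(a, b) = w² divided by 4, for a = 2c, b = p + 2e
  -- and w = p + 2q θ + 2r θ².
  module Origins₁ (p e q r c : ℤ)
    (E₁ : e ℤ.* (e ℤ.+ p) ≡ + 2 ℤ.* (q ℤ.* r))
    (E₂ : + 2 ℤ.* (c ℤ.* c) ≡ p ℤ.* q ℤ.+ + 2 ℤ.* (q ℤ.* r) ℤ.+ r ℤ.* r)
    (E₃ : c ℤ.* (p ℤ.+ + 2 ℤ.* e) ≡ q ℤ.* q ℤ.+ p ℤ.* r ℤ.+ r ℤ.* r) where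

    private
      pᵖ eᵖ qᵖ rᵖ cᵖ : Polynomial 5
      pᵖ = var 0F
      eᵖ = var 1F
      qᵖ = var 2F
      rᵖ = var 3F
      cᵖ = var 4F

      env : Vec ℤ 5
      env = p ∷ e ∷ q ∷ r ∷ c ∷ []

      plus : (c₁ c₂ c₃ : ℤ) → Polynomial 5 → Polynomial 5
      plus c₁ c₂ c₃ w = w
        ⊕ K c₁ ⊗ (eᵖ ⊗ (eᵖ ⊕ pᵖ) ⊖ (# 2 ⊗ (qᵖ ⊗ rᵖ)))
        ⊕ K c₂ ⊗ (# 2 ⊗ (cᵖ ⊗ cᵖ) ⊖ (pᵖ ⊗ qᵖ ⊕ # 2 ⊗ (qᵖ ⊗ rᵖ) ⊕ rᵖ ⊗ rᵖ))
        ⊕ K c₃ ⊗ (cᵖ ⊗ (pᵖ ⊕ # 2 ⊗ eᵖ) ⊖ (qᵖ ⊗ qᵖ ⊕ pᵖ ⊗ rᵖ ⊕ rᵖ ⊗ rᵖ))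

      -- The identities needed hold only modulo the three equations; c₁, c₂, c₃ are the multipliers.
      by : ∀ c₁ c₂ c₃ x w → eval↓ x env ≡ eval↓ (plus c₁ c₂ c₃ w) env → eval x env ≡ eval w env
      by c₁ c₂ c₃ x w eq = ℤ-use₃ c₁ c₂ c₃ E₁ E₂ E₃ (ℤ-prove env x (plus c₁ c₂ c₃ w) eq)

    at-0 : 2# ∣ ⟨ p ℤ.+ + 2 ℤ.* r , ℤ.- q , ℤ.- r ⟩ ² - 1# → c ≡ + 0
    at-0 = Origin.vanishes 1# 1# refl (evalᵗ β₋ env) (evalᵗ β₊ env) (evalᵗ L env) (eval n env)
      (⟨⟩-cong
        (by (+ 1) (+ 0) (+ 0) (#₀ (β₋ *ᵖ β₊)) (#₀ (prodʳ n)) refl)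
        (by (+ 0) (+ 1) (+ 0) (#₁ (β₋ *ᵖ β₊)) (#₁ (prodʳ n)) refl)
        (by (+ 0) (+ 0) (+ 1) (#₂ (β₋ *ᵖ β₊)) (#₂ (prodʳ n)) refl))
      (⟨⟩-cong
        (by (+ 2) (+ 0) (+ 2) (#₀ (sumˡ 1ᵖ β₋ β₊)) (#₀ (sumʳ 1ᵖ L n)) refl)
        (by (+ 0) -[1+ 0 ] (+ 0) (#₁ (sumˡ 1ᵖ β₋ β₊)) (#₁ (sumʳ 1ᵖ L n)) refl)
        (by (+ 0) (+ 0) -[1+ 0 ] (#₂ (sumˡ 1ᵖ β₋ β₊)) (#₂ (sumʳ 1ᵖ L n)) refl))
      where
      -- x₀ = 0 and w₀ = 1, with g = b + a θ². As in the other cases, n is (a - x₀ b) / 2.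
      β₋ β₊ L : Triple 5
      β₋ = ⟪ eᵖ , ⊝ qᵖ , cᵖ ⊖ rᵖ ⟫
      β₊ = ⟪ eᵖ ⊕ pᵖ , qᵖ , cᵖ ⊕ rᵖ ⟫
      L = ⟪ pᵖ ⊕ # 2 ⊗ rᵖ , ⊝ qᵖ , ⊝ rᵖ ⟫
      n : Polynomial 5
      n = cᵖ

    at-[-2] : 2# ∣ ⟨ p ℤ.- + 2 ℤ.* q , ℤ.- p ℤ.- + 3 ℤ.* q ℤ.- + 4 ℤ.* r , p ℤ.+ + 4 ℤ.* q ℤ.+ r ⟩ ²
      - 1# → c ℤ.+ + 2 ℤ.* e ℤ.+ p ≡ + 0
    at-[-2] = Origin.vanishes 1# 1# refl (evalᵗ β₋ env) (evalᵗ β₊ env) (evalᵗ L env) (eval n env)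
      (⟨⟩-cong
        (by (+ 1) -[1+ 3 ] (+ 8) (#₀ (β₋ *ᵖ β₊)) (#₀ (prodʳ n)) refl)
        (by (+ 8) -[1+ 2 ] (+ 4) (#₁ (β₋ *ᵖ β₊)) (#₁ (prodʳ n)) refl)
        (by -[1+ 3 ] (+ 8) -[1+ 2 ] (#₂ (β₋ *ᵖ β₊)) (#₂ (prodʳ n)) refl))
      (⟨⟩-cong
        (by -[1+ 5 ] -[1+ 11 ] -[1+ 13 ] (#₀ (sumˡ 1ᵖ β₋ β₊)) (#₀ (sumʳ 1ᵖ L n)) refl)
        (by -[1+ 7 ] -[1+ 0 ] -[1+ 7 ] (#₁ (sumˡ 1ᵖ β₋ β₊)) (#₁ (sumʳ 1ᵖ L n)) refl)
        (by (+ 4) (+ 16) (+ 7) (#₂ (sumˡ 1ᵖ β₋ β₊)) (#₂ (sumʳ 1ᵖ L n)) refl))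
      where
      -- x₀ = - 2 and w₀ = 3 + 2θ - 2θ², with g = b - 4a θ + (a - 2b) θ².
      β₋ β₊ L : Triple 5
      β₋ = ⟪ eᵖ ⊕ # 2 ⊗ qᵖ ⊖ pᵖ ⊖ # 2 ⊗ rᵖ , ⊝ (# 4 ⊗ cᵖ) ⊖ pᵖ ⊖ qᵖ , cᵖ ⊖ # 2 ⊗ eᵖ ⊖ # 2 ⊗ qᵖ ⊖ rᵖ
        ⟫
      β₊ = ⟪ eᵖ ⊕ # 2 ⊗ pᵖ ⊕ # 2 ⊗ rᵖ ⊖ # 2 ⊗ qᵖ , pᵖ ⊕ qᵖ ⊖ # 4 ⊗ cᵖ , cᵖ ⊕ # 2 ⊗ qᵖ ⊕ rᵖ ⊖ # 2 ⊗
        eᵖ ⊖ # 2 ⊗ pᵖ ⟫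
      L = ⟪ pᵖ ⊖ # 2 ⊗ qᵖ , ⊝ pᵖ ⊖ # 3 ⊗ qᵖ ⊖ # 4 ⊗ rᵖ , pᵖ ⊕ # 4 ⊗ qᵖ ⊕ rᵖ ⟫
      n : Polynomial 5
      n = cᵖ ⊕ # 2 ⊗ eᵖ ⊕ pᵖ

  -- The coordinates of G(a, b) = θ w², less their terms in q² and divided by 4, for b = q + 2h, a =
  -- b + 2d and w = (q + 2x) + q θ + 4r θ².
  module Origins-θ (q h x d r : ℤ)
    (E₁ : q ℤ.* h ℤ.+ h ℤ.* h ≡ + 2 ℤ.* ((q ℤ.+ + 2 ℤ.* x) ℤ.* r) ℤ.+ + 4 ℤ.* (r ℤ.* r))
    (E₂ : + 2 ℤ.* (q ℤ.* (h ℤ.+ d)) ℤ.+ + 2 ℤ.* ((h ℤ.+ d) ℤ.* (h ℤ.+ d)) ≡ q ℤ.* x ℤ.+ x ℤ.* x ℤ.+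
      + 4 ℤ.* (r ℤ.* r) ℤ.+ + 4 ℤ.* ((q ℤ.+ x) ℤ.* r))
    (E₃ : + 2 ℤ.* (q ℤ.* h) ℤ.+ + 2 ℤ.* (h ℤ.* h) ℤ.+ d ℤ.* q ℤ.+ + 2 ℤ.* (d ℤ.* h) ≡ q ℤ.* x ℤ.+
      + 2 ℤ.* (q ℤ.* r) ℤ.+ + 4 ℤ.* (r ℤ.* r)) where

    private
      qᵖ hᵖ xᵖ dᵖ rᵖ : Polynomial 5
      qᵖ = var 0F
      hᵖ = var 1F
      xᵖ = var 2F
      dᵖ = var 3F
      rᵖ = var 4F

      env : Vec ℤ 5
      env = q ∷ h ∷ x ∷ d ∷ r ∷ []

      plus : (c₁ c₂ c₃ : ℤ) → Polynomial 5 → Polynomial 5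
      plus c₁ c₂ c₃ w = w
        ⊕ K c₁ ⊗ (qᵖ ⊗ hᵖ ⊕ hᵖ ⊗ hᵖ ⊖ (# 2 ⊗ ((qᵖ ⊕ # 2 ⊗ xᵖ) ⊗ rᵖ) ⊕ # 4 ⊗ (rᵖ ⊗ rᵖ)))
        ⊕ K c₂ ⊗ (# 2 ⊗ (qᵖ ⊗ (hᵖ ⊕ dᵖ)) ⊕ # 2 ⊗ ((hᵖ ⊕ dᵖ) ⊗ (hᵖ ⊕ dᵖ)) ⊖
          (qᵖ ⊗ xᵖ ⊕ xᵖ ⊗ xᵖ ⊕ # 4 ⊗ (rᵖ ⊗ rᵖ) ⊕ # 4 ⊗ ((qᵖ ⊕ xᵖ) ⊗ rᵖ)))
        ⊕ K c₃ ⊗ (# 2 ⊗ (qᵖ ⊗ hᵖ) ⊕ # 2 ⊗ (hᵖ ⊗ hᵖ) ⊕ dᵖ ⊗ qᵖ ⊕ # 2 ⊗ (dᵖ ⊗ hᵖ) ⊖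
          (qᵖ ⊗ xᵖ ⊕ # 2 ⊗ (qᵖ ⊗ rᵖ) ⊕ # 4 ⊗ (rᵖ ⊗ rᵖ)))

      by : ∀ c₁ c₂ c₃ x w → eval↓ x env ≡ eval↓ (plus c₁ c₂ c₃ w) env → eval x env ≡ eval w env
      by c₁ c₂ c₃ x w eq = ℤ-use₃ c₁ c₂ c₃ E₁ E₂ E₃ (ℤ-prove env x (plus c₁ c₂ c₃ w) eq)

    at-1 : 2# ∣ ⟨ + 2 ℤ.* r ℤ.+ + 2 ℤ.* x , ℤ.- q ℤ.- x , q ℤ.- + 2 ℤ.* r ⟩ ² - θ → d ≡ + 0
    at-1 = Origin.vanishes θ ρ refl (evalᵗ β₋ env) (evalᵗ β₊ env) (evalᵗ L env) (eval n env)
      (⟨⟩-cong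
        (by (+ 1) (+ 2) (+ 2) (#₀ (β₋ *ᵖ β₊)) (#₀ (prodʳ n)) refl)
        (by (+ 2) (+ 3) (+ 4) (#₁ (β₋ *ᵖ β₊)) (#₁ (prodʳ n)) refl)
        (by (+ 2) (+ 2) (+ 3) (#₂ (β₋ *ᵖ β₊)) (#₂ (prodʳ n)) refl))
      (⟨⟩-cong
        (by -[1+ 1 ] (+ 4) -[1+ 4 ] (#₀ (sumˡ θᵖ β₋ β₊)) (#₀ (sumʳ θᵖ L n)) refl)
        (by (+ 4) -[1+ 1 ] -[1+ 0 ] (#₁ (sumˡ θᵖ β₋ β₊)) (#₁ (sumʳ θᵖ L n)) refl)
        (by -[1+ 1 ] -[1+ 0 ] (+ 4) (#₂ (sumˡ θᵖ β₋ β₊)) (#₂ (sumʳ θᵖ L n)) refl))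
      where
      -- x₀ = 1 and w₀ = 1 + θ, with g = b + 2a θ + (a + b) θ².
      β₋ β₊ L : Triple 5
      β₋ = ⟪ hᵖ ⊖ # 2 ⊗ rᵖ , # 2 ⊗ dᵖ ⊕ # 2 ⊗ hᵖ ⊖ # 4 ⊗ rᵖ ⊖ xᵖ , dᵖ ⊕ # 2 ⊗ hᵖ ⊖ # 2 ⊗ rᵖ ⊖ xᵖ ⟫
      β₊ = ⟪ hᵖ ⊕ qᵖ ⊕ # 2 ⊗ rᵖ , # 2 ⊗ dᵖ ⊕ # 2 ⊗ hᵖ ⊕ # 2 ⊗ qᵖ ⊕ # 4 ⊗ rᵖ ⊕ xᵖ , dᵖ ⊕ # 2 ⊗ hᵖ ⊕
        # 2 ⊗ qᵖ ⊕ # 2 ⊗ rᵖ ⊕ xᵖ ⟫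
      L = ⟪ # 2 ⊗ rᵖ ⊕ # 2 ⊗ xᵖ , ⊝ qᵖ ⊖ xᵖ , qᵖ ⊖ # 2 ⊗ rᵖ ⟫
      n : Polynomial 5
      n = dᵖ

    at-[-1] : 2# ∣ ⟨ ℤ.- (+ 2 ℤ.* q) ℤ.- + 6 ℤ.* r ℤ.- + 2 ℤ.* x , ℤ.- x , q ℤ.+ + 2 ℤ.* r ⟩ ² - θ →
      d ℤ.+ + 2 ℤ.* h ℤ.+ q ≡ + 0
    at-[-1] = Origin.vanishes θ ρ refl (evalᵗ β₋ env) (evalᵗ β₊ env) (evalᵗ L env) (eval n env)
      (⟨⟩-cong
        (by (+ 1) -[1+ 1 ] (+ 2) (#₀ (β₋ *ᵖ β₊)) (#₀ (prodʳ n)) refl)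
        (by (+ 2) -[1+ 0 ] (+ 0) (#₁ (β₋ *ᵖ β₊)) (#₁ (prodʳ n)) refl)
        (by -[1+ 1 ] (+ 2) -[1+ 0 ] (#₂ (β₋ *ᵖ β₊)) (#₂ (prodʳ n)) refl))
      (⟨⟩-cong
        (by (+ 2) (+ 4) (+ 3) (#₀ (sumˡ θᵖ β₋ β₊)) (#₀ (sumʳ θᵖ L n)) refl)
        (by (+ 0) (+ 2) -[1+ 0 ] (#₁ (sumˡ θᵖ β₋ β₊)) (#₁ (sumʳ θᵖ L n)) refl)
        (by -[1+ 1 ] -[1+ 0 ] -[1+ 3 ] (#₂ (sumˡ θᵖ β₋ β₊)) (#₂ (sumʳ θᵖ L n)) refl))
      where
      -- x₀ = - 1 and w₀ = θ - 1, with g = b - 2a θ + (a - b) θ².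
      β₋ β₊ L : Triple 5
      β₋ = ⟪ hᵖ ⊕ # 2 ⊗ rᵖ , xᵖ ⊖ # 2 ⊗ dᵖ ⊖ # 2 ⊗ hᵖ ⊖ qᵖ , dᵖ ⊖ # 2 ⊗ rᵖ ⊖ xᵖ ⟫
      β₊ = ⟪ hᵖ ⊕ qᵖ ⊖ # 2 ⊗ rᵖ , ⊝ (# 2 ⊗ dᵖ) ⊖ # 2 ⊗ hᵖ ⊖ qᵖ ⊖ xᵖ , dᵖ ⊕ # 2 ⊗ rᵖ ⊕ xᵖ ⟫
      L = ⟪ ⊝ (# 2 ⊗ qᵖ) ⊖ # 6 ⊗ rᵖ ⊖ # 2 ⊗ xᵖ , ⊝ xᵖ , qᵖ ⊕ # 2 ⊗ rᵖ ⟫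
      n : Polynomial 5
      n = dᵖ ⊕ # 2 ⊗ hᵖ ⊕ qᵖ

  -- Choice of the known point by parities

  ⟨⟩-injective : ∀ {a b c p q r} → ⟨ a , b , c ⟩ ≡ ⟨ p , q , r ⟩ → a ≡ p × b ≡ q × c ≡ r
  ⟨⟩-injective refl = refl , refl , refl

  2+4k≢0 : ∀ k → ¬ + 2 ℤ.* (+ 1 ℤ.+ + 2 ℤ.* k) ≡ + 0
  2+4k≢0 k eq = [ (λ ()) , 1+2k≢0 k ]′ (ℤₚ.i*j≡0⇒i≡0∨j≡0 (+ 2) eq)

  ℤ-use₁ : ∀ {a b x w} k → a ≡ b → x ≡ w ℤ.+ k ℤ.* (a ℤ.- b) → x ≡ w
  ℤ-use₁ {a} {w = w} k refl eq = trans eq (ℤ-solve 3 (λ a w k → w ⊕ k ⊗ (a ⊖ a) ⊜ w) refl a w k)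

  1+2[_] : ℤ → ℤ
  1+2[ k ] = + 1 ℤ.+ + 2 ℤ.* k

  G≡w² : ∀ a b p q r → G a b ≡ ⟨ p , q , r ⟩ * ⟨ p , q , r ⟩ →
    (b ℤ.* b ≡ p ℤ.* p ℤ.+ + 2 ℤ.* (q ℤ.* r)) ×
    (+ 2 ℤ.* (a ℤ.* a) ≡ + 2 ℤ.* (p ℤ.* q) ℤ.+ + 2 ℤ.* (q ℤ.* r) ℤ.+ r ℤ.* r) ×
    (+ 2 ℤ.* (a ℤ.* b) ≡ q ℤ.* q ℤ.+ + 2 ℤ.* (p ℤ.* r) ℤ.+ r ℤ.* r)
  G≡w² a b p q r eq = let e₁ , e₂ , e₃ = ⟨⟩-injective eq in
    trans e₁ (ℤ-solve 3 (λ p q r → #₀ (w² p q r) ⊜ p ⊗ p ⊕ # 2 ⊗ (q ⊗ r)) refl p q r) ,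
    trans e₂ (ℤ-solve 3 (λ p q r → #₁ (w² p q r) ⊜ # 2 ⊗ (p ⊗ q) ⊕ # 2 ⊗ (q ⊗ r) ⊕ r ⊗ r) refl p q
      r) ,
    trans e₃ (ℤ-solve 3 (λ p q r → #₂ (w² p q r) ⊜ q ⊗ q ⊕ # 2 ⊗ (p ⊗ r) ⊕ r ⊗ r) refl p q r)
    where
    w² : (p q r : Polynomial 3) → Triple 3
    w² p q r = ⟪ p , q , r ⟫ *ᵖ ⟪ p , q , r ⟫

  G≡θw² : ∀ a b p q r → G a b ≡ θ * (⟨ p , q , r ⟩ * ⟨ p , q , r ⟩) →
    (b ℤ.* b ≡ q ℤ.* q ℤ.+ + 2 ℤ.* (p ℤ.* r) ℤ.+ r ℤ.* r) ×
    (+ 2 ℤ.* (a ℤ.* a) ≡ p ℤ.* p ℤ.+ q ℤ.* q ℤ.+ r ℤ.* r ℤ.+ + 2 ℤ.* (q ℤ.* r) ℤ.+ + 2 ℤ.*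
      (p ℤ.* r)) ×
    (+ 2 ℤ.* (a ℤ.* b) ≡ + 2 ℤ.* (p ℤ.* q) ℤ.+ + 2 ℤ.* (q ℤ.* r) ℤ.+ r ℤ.* r)
  G≡θw² a b p q r eq = let e₁ , e₂ , e₃ = ⟨⟩-injective eq in
    trans e₁ (ℤ-solve 3 (λ p q r → #₀ (θw² p q r) ⊜ q ⊗ q ⊕ # 2 ⊗ (p ⊗ r) ⊕ r ⊗ r) refl p q r) ,
    trans e₂ (ℤ-solve 3 (λ p q r → #₁ (θw² p q r) ⊜ p ⊗ p ⊕ q ⊗ q ⊕ r ⊗ r ⊕ # 2 ⊗ (q ⊗ r) ⊕ # 2 ⊗
      (p ⊗ r)) refl p q r) ,
    trans e₃ (ℤ-solve 3 (λ p q r → #₂ (θw² p q r) ⊜ # 2 ⊗ (p ⊗ q) ⊕ # 2 ⊗ (q ⊗ r) ⊕ r ⊗ r) refl p q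
      r)
    where
    θw² : (p q r : Polynomial 3) → Triple 3
    θw² p q r = ⟪ # 0 , # 1 , # 0 ⟫ *ᵖ (⟪ p , q , r ⟫ *ᵖ ⟪ p , q , r ⟫)

  2∣⟨⟩ : ∀ x y z {u} → u ≡ ⟨ + 2 ℤ.* x , + 2 ℤ.* y , + 2 ℤ.* z ⟩ → 2# ∣ u
  2∣⟨⟩ x y z eq = ⟨ x , y , z ⟩ , trans eq (sym (ι-*-⟨⟩ (+ 2) x y z))

  square-cong-2 : ∀ L M τ → 2# ∣ L - M → 2# ∣ M ² - τ → 2# ∣ L ² - τ
  square-cong-2 L M τ 2∣L-M 2∣ = subst (2# ∣_) (solve 3
    (λ L M τ → (L :- M) :* (L :+ M) :+ (M :² :- τ) := L :² :- τ) refl L M τ)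
    (∣-+ (∣-* (L + M) 2∣L-M) 2∣)

  -- The θ-coordinate makes 2a² divisible by 4, so a is even; halving it makes q and r congruent
  -- modulo 2. Both are even for w₀ = 1, both odd for w₀ = 3 + 2θ - 2θ², and in either case this
  -- parity is what gives L² ≡ 1 modulo 2 at the corresponding known point.
  case-1 : ∀ a b p q r → let w = ⟨ 1+2[ p ] , + 2 ℤ.* q , + 2 ℤ.* r ⟩ in
    G a 1+2[ b ] ≡ w ² → a ≡ + 0 ⊎ a ≡ -[1+ 1 ] ℤ.* 1+2[ b ]
  case-1 a b p q r G≡ = go (parity a) (G≡w² a 1+2[ b ] 1+2[ p ] (+ 2 ℤ.* q) (+ 2 ℤ.* r) G≡)
    where
    Eqs : Set
    Eqs = (1+2[ b ] ℤ.* 1+2[ b ] ≡ 1+2[ p ] ℤ.* 1+2[ p ] ℤ.+ + 2 ℤ.* (+ 2 ℤ.* q ℤ.* (+ 2 ℤ.* r))) ×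
      (+ 2 ℤ.* (a ℤ.* a) ≡ + 2 ℤ.* (1+2[ p ] ℤ.* (+ 2 ℤ.* q)) ℤ.+ + 2 ℤ.*
        (+ 2 ℤ.* q ℤ.* (+ 2 ℤ.* r)) ℤ.+ + 2 ℤ.* r ℤ.* (+ 2 ℤ.* r)) ×
      (+ 2 ℤ.* (a ℤ.* 1+2[ b ]) ≡ + 2 ℤ.* q ℤ.* (+ 2 ℤ.* q) ℤ.+ + 2 ℤ.* (1+2[ p ] ℤ.* (+ 2 ℤ.* r))
        ℤ.+ + 2 ℤ.* r ℤ.* (+ 2 ℤ.* r))
    go : (∃[ k ] a ≡ + 0 ℤ.+ + 2 ℤ.* k) ⊎ (∃[ k ] a ≡ 1+2[ k ]) → Eqs → a ≡ + 0 ⊎ a ≡ -[1+ 1 ]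
      ℤ.* 1+2[ b ]
    go (inj₂ (k , refl)) (_ , e₂ , _) = ⊥-elim (2+4k≢0
      (+ 2 ℤ.* (k ℤ.+ k ℤ.* k) ℤ.- 1+2[ p ] ℤ.* q ℤ.- + 2 ℤ.* (q ℤ.* r) ℤ.- r ℤ.* r)
      (ℤ-use₁ (+ 1) e₂ (ℤ-solve 4 (λ p q r k → # 2 ⊗
      (# 1 ⊕ # 2 ⊗ (# 2 ⊗ (k ⊕ k ⊗ k) ⊖ oddᵖ p ⊗ q ⊖ # 2 ⊗ (q ⊗ r) ⊖ r ⊗ r)) ⊜ # 0 ⊕ # 1 ⊗
      (# 2 ⊗ (oddᵖ k ⊗ oddᵖ k) ⊖ (# 2 ⊗ (oddᵖ p ⊗ (# 2 ⊗ q)) ⊕ # 2 ⊗ (# 2 ⊗ q ⊗ (# 2 ⊗ r)) ⊕ # 2 ⊗ r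
      ⊗ (# 2 ⊗ r)))) refl p q r k)))
    go (inj₁ (c , refl)) (e₁ , e₂ , e₃) = go′ (parity q) (parity r)
      where
      P = 1+2[ p ]
      e = b ℤ.- p

      E₁ : e ℤ.* (e ℤ.+ P) ≡ + 2 ℤ.* (q ℤ.* r)
      E₁ = ℤₚ.*-cancelˡ-≡ (+ 4) _ _ (ℤ-use₁ (+ 1) e₁
        (ℤ-solve 4 (λ b p q r → # 4 ⊗ ((b ⊖ p) ⊗ (b ⊖ p ⊕ oddᵖ p)) ⊜ # 4 ⊗ (# 2 ⊗ (q ⊗ r)) ⊕ # 1 ⊗
        (oddᵖ b ⊗ oddᵖ b ⊖ (oddᵖ p ⊗ oddᵖ p ⊕ # 2 ⊗ (# 2 ⊗ q ⊗ (# 2 ⊗ r))))) refl b p q r))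

      E₂ : + 2 ℤ.* (c ℤ.* c) ≡ P ℤ.* q ℤ.+ + 2 ℤ.* (q ℤ.* r) ℤ.+ r ℤ.* r
      E₂ = ℤₚ.*-cancelˡ-≡ (+ 4) _ _ (ℤ-use₁ (+ 1) e₂
        (ℤ-solve 4 (λ c p q r → # 4 ⊗ (# 2 ⊗ (c ⊗ c)) ⊜ # 4 ⊗ (oddᵖ p ⊗ q ⊕ # 2 ⊗ (q ⊗ r) ⊕ r ⊗ r) ⊕
        # 1 ⊗ (# 2 ⊗ (evenᵖ c ⊗ evenᵖ c) ⊖ (# 2 ⊗ (oddᵖ p ⊗ (# 2 ⊗ q)) ⊕ # 2 ⊗ (# 2 ⊗ q ⊗ (# 2 ⊗ r))
        ⊕ # 2 ⊗ r ⊗ (# 2 ⊗ r)))) refl c p q r))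

      E₃ : c ℤ.* (P ℤ.+ + 2 ℤ.* e) ≡ q ℤ.* q ℤ.+ P ℤ.* r ℤ.+ r ℤ.* r
      E₃ = ℤₚ.*-cancelˡ-≡ (+ 4) _ _ (ℤ-use₁ (+ 1) e₃
        (ℤ-solve 5 (λ b c p q r → # 4 ⊗ (c ⊗ (oddᵖ p ⊕ # 2 ⊗ (b ⊖ p))) ⊜ # 4 ⊗
        (q ⊗ q ⊕ oddᵖ p ⊗ r ⊕ r ⊗ r) ⊕ # 1 ⊗ (# 2 ⊗ (evenᵖ c ⊗ oddᵖ b) ⊖
        (# 2 ⊗ q ⊗ (# 2 ⊗ q) ⊕ # 2 ⊗ (oddᵖ p ⊗ (# 2 ⊗ r)) ⊕ # 2 ⊗ r ⊗ (# 2 ⊗ r)))) refl b c p q r))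

      go′ : (∃[ k ] q ≡ + 0 ℤ.+ + 2 ℤ.* k) ⊎ (∃[ k ] q ≡ 1+2[ k ]) → (∃[ l ] r ≡ + 0 ℤ.+ + 2 ℤ.* l)
        ⊎ (∃[ l ] r ≡ 1+2[ l ]) →
        + 0 ℤ.+ + 2 ℤ.* c ≡ + 0 ⊎ + 0 ℤ.+ + 2 ℤ.* c ≡ -[1+ 1 ] ℤ.* 1+2[ b ]
      go′ (inj₁ (k , q≡)) (inj₁ (l , r≡)) = inj₁ (cong (λ c → + 0 ℤ.+ + 2 ℤ.* c)
        (Origins₁.at-0 P e q r c E₁ E₂ E₃
        (square-cong-2 ⟨ P ℤ.+ + 2 ℤ.* r , ℤ.- q , ℤ.- r ⟩ 1# 1#
          (2∣⟨⟩ (p ℤ.+ r) (ℤ.- k) (ℤ.- l) (⟨⟩-cong (ℤ-solve 2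
          (λ p r → (oddᵖ p) ⊕ # 2 ⊗ r ⊕ K (-[1+ 0 ]) ⊜ # 2 ⊗ (p ⊕ r)) refl p r)
          (trans (cong (λ q → ℤ.- q ℤ.+ + 0) q≡) (h₁ k))
          (trans (cong (λ r → ℤ.- r ℤ.+ + 0) r≡) (h₁ l)))) (0# , refl))))
        where
        h₁ : ∀ k → ℤ.- (+ 0 ℤ.+ + 2 ℤ.* k) ℤ.+ + 0 ≡ + 2 ℤ.* ℤ.- k
        h₁ = ℤ-solve 1 (λ k → ⊝ (evenᵖ k) ⊕ # 0 ⊜ # 2 ⊗ ⊝ k) refl
      go′ (inj₂ (k , q≡)) (inj₂ (l , r≡)) = inj₂ (ℤ-use₁ (+ 2) (Origins₁.at-[-2] P e q r c E₁ E₂ E₃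
        (square-cong-2 ⟨ P ℤ.- + 2 ℤ.* q , ℤ.- P ℤ.- + 3 ℤ.* q ℤ.- + 4 ℤ.* r , P ℤ.+ + 4 ℤ.* q ℤ.+ r
          ⟩ 1# 1# (2∣⟨⟩ (p ℤ.- q) (ℤ.- p ℤ.- + 3 ℤ.* k ℤ.- + 2 ℤ.- + 2 ℤ.* r)
          (p ℤ.+ + 1 ℤ.+ + 2 ℤ.* q ℤ.+ l)
          (⟨⟩-cong (ℤ-solve 2 (λ p q → (oddᵖ p) ⊖ # 2 ⊗ q ⊕ K (-[1+ 0 ]) ⊜ # 2 ⊗ (p ⊖ q)) refl p q)
            (trans (cong (λ q → ℤ.- P ℤ.- + 3 ℤ.* q ℤ.- + 4 ℤ.* r ℤ.+ + 0) q≡)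
            (ℤ-solve 3 (λ p k r → ⊝ (oddᵖ p) ⊖ # 3 ⊗ oddᵖ k ⊖ # 4 ⊗ r ⊕ # 0 ⊜ # 2 ⊗
            (⊝ p ⊖ # 3 ⊗ k ⊖ # 2 ⊖ # 2 ⊗ r)) refl p k r))
            (trans (cong (λ r → P ℤ.+ + 4 ℤ.* q ℤ.+ r ℤ.+ + 0) r≡)
            (ℤ-solve 3 (λ p q l → (oddᵖ p) ⊕ # 4 ⊗ q ⊕ oddᵖ l ⊕ # 0 ⊜ # 2 ⊗ (p ⊕ # 1 ⊕ # 2 ⊗ q ⊕ l))
            refl p q l)))) (0# , refl))) (ℤ-solve 3 (λ b c p → # 0 ⊕ # 2 ⊗ c ⊜ K (-[1+ 1 ]) ⊗ oddᵖ b
            ⊕ # 2 ⊗ (c ⊕ # 2 ⊗ (b ⊖ p) ⊕ oddᵖ p ⊖ # 0)) refl b c p))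
      go′ (inj₂ (k , refl)) (inj₁ (l , refl)) = ⊥-elim
        (1+2k≢0 (k ℤ.+ p ℤ.+ + 2 ℤ.* p ℤ.* k ℤ.+ + 2 ℤ.* (+ 1 ℤ.+ + 2 ℤ.* k) ℤ.* l ℤ.+ + 2 ℤ.* l ℤ.*
        l ℤ.- c ℤ.* c) (ℤ-use₁ -[1+ 0 ] E₂ (ℤ-solve 4
        (λ c p k l → # 1 ⊕ # 2 ⊗ (k ⊕ p ⊕ # 2 ⊗ p ⊗ k ⊕ # 2 ⊗ oddᵖ k ⊗ l ⊕ # 2 ⊗ l ⊗ l ⊖ c ⊗ c) ⊜
        # 0 ⊕ K (-[1+ 0 ]) ⊗ (# 2 ⊗ (c ⊗ c) ⊖ (oddᵖ p ⊗ oddᵖ k ⊕ # 2 ⊗ (oddᵖ k ⊗ evenᵖ l) ⊕ evenᵖ l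
        ⊗ evenᵖ l))) refl c p k l)))
      go′ (inj₁ (k , refl)) (inj₂ (l , refl)) = ⊥-elim
        (1+2k≢0 (k ℤ.+ + 2 ℤ.* p ℤ.* k ℤ.+ + 2 ℤ.* k ℤ.* (+ 1 ℤ.+ + 2 ℤ.* l) ℤ.+ + 2 ℤ.* l ℤ.+ + 2
        ℤ.* l ℤ.* l ℤ.- c ℤ.* c) (ℤ-use₁ -[1+ 0 ] E₂
        (ℤ-solve 4 (λ c p k l → # 1 ⊕ # 2 ⊗ (k ⊕ # 2 ⊗ p ⊗ k ⊕ # 2 ⊗ k ⊗ oddᵖ l ⊕ # 2 ⊗ l ⊕ # 2 ⊗ l
        ⊗ l ⊖ c ⊗ c) ⊜ # 0 ⊕ K (-[1+ 0 ]) ⊗ (# 2 ⊗ (c ⊗ c) ⊖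
        (oddᵖ p ⊗ evenᵖ k ⊕ # 2 ⊗ (evenᵖ k ⊗ oddᵖ l) ⊕ oddᵖ l ⊗ oddᵖ l))) refl c p k l)))

  -- The θ²-coordinate makes a odd, the θ-coordinate makes r even. The difference p - q is even for
  -- w₀ = 1 + θ and odd for w₀ = θ - 1; with the matching known point, L ≡ θ + θ² modulo 2, which is
  -- the square root of θ there.
  case-θ : ∀ a b p q r → let w = ⟨ 1+2[ p ] , 1+2[ q ] , + 2 ℤ.* r ⟩ in
    G a 1+2[ b ] ≡ θ * w ² → a ≡ 1+2[ b ] ⊎ a ≡ -[1+ 0 ] ℤ.* 1+2[ b ]
  case-θ a b p q r G≡ = go (parity a) (G≡θw² a 1+2[ b ] 1+2[ p ] 1+2[ q ] (+ 2 ℤ.* r) G≡)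
    where
    Eqs : Set
    Eqs = (1+2[ b ] ℤ.* 1+2[ b ] ≡ 1+2[ q ] ℤ.* 1+2[ q ] ℤ.+ + 2 ℤ.* (1+2[ p ] ℤ.* (+ 2 ℤ.* r)) ℤ.+
      + 2 ℤ.* r ℤ.* (+ 2 ℤ.* r)) ×
      (+ 2 ℤ.* (a ℤ.* a) ≡ 1+2[ p ] ℤ.* 1+2[ p ] ℤ.+ 1+2[ q ] ℤ.* 1+2[ q ] ℤ.+ + 2 ℤ.* r ℤ.*
        (+ 2 ℤ.* r)
        ℤ.+ + 2 ℤ.* (1+2[ q ] ℤ.* (+ 2 ℤ.* r)) ℤ.+ + 2 ℤ.* (1+2[ p ] ℤ.* (+ 2 ℤ.* r))) ×
      (+ 2 ℤ.* (a ℤ.* 1+2[ b ]) ≡ + 2 ℤ.* (1+2[ p ] ℤ.* 1+2[ q ]) ℤ.+ + 2 ℤ.*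
        (1+2[ q ] ℤ.* (+ 2 ℤ.* r)) ℤ.+ + 2 ℤ.* r ℤ.* (+ 2 ℤ.* r))
    go : (∃[ k ] a ≡ + 0 ℤ.+ + 2 ℤ.* k) ⊎ (∃[ k ] a ≡ 1+2[ k ]) → Eqs → a ≡ 1+2[ b ] ⊎ a ≡ -[1+ 0 ]
      ℤ.* 1+2[ b ]
    go (inj₁ (k , refl)) (_ , _ , e₃) = ⊥-elim (2+4k≢0
      (p ℤ.+ q ℤ.+ + 2 ℤ.* (p ℤ.* q) ℤ.+ 1+2[ q ] ℤ.* r ℤ.+ r ℤ.* r ℤ.- k ℤ.* 1+2[ b ])
      (ℤ-use₁ -[1+ 0 ] e₃ (ℤ-solve 5 (λ b k p q r → # 2 ⊗
      (# 1 ⊕ # 2 ⊗ (p ⊕ q ⊕ # 2 ⊗ (p ⊗ q) ⊕ oddᵖ q ⊗ r ⊕ r ⊗ r ⊖ k ⊗ oddᵖ b)) ⊜ # 0 ⊕ K (-[1+ 0 ]) ⊗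
      (# 2 ⊗ (evenᵖ k ⊗ oddᵖ b) ⊖ (# 2 ⊗ (oddᵖ p ⊗ oddᵖ q) ⊕ # 2 ⊗ (oddᵖ q ⊗ (# 2 ⊗ r)) ⊕ # 2 ⊗ r ⊗
      (# 2 ⊗ r)))) refl b k p q r)))
    go (inj₂ (k , refl)) (e₁ , e₂ , e₃) = go′ (parity x) (parity r)
      where
      Q = 1+2[ q ]
      x = p ℤ.- q
      h = b ℤ.- q
      d = k ℤ.- b

      e₂′ : + 2 ℤ.* (Q ℤ.* (k ℤ.- q)) ℤ.+ + 2 ℤ.* ((k ℤ.- q) ℤ.* (k ℤ.- q)) ≡ (Q ℤ.+ x) ℤ.* x ℤ.+ r
        ℤ.* r ℤ.+ + 2 ℤ.* ((Q ℤ.+ x) ℤ.* r)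
      e₂′ = ℤₚ.*-cancelˡ-≡ (+ 4) _ _ (ℤ-use₁ (+ 1) e₂
        (ℤ-solve 4 (λ k p q r → # 4 ⊗ (# 2 ⊗ (oddᵖ q ⊗ (k ⊖ q)) ⊕ # 2 ⊗ ((k ⊖ q) ⊗ (k ⊖ q))) ⊜ # 4 ⊗
        ((# 1 ⊕ # 2 ⊗ q ⊕ (p ⊖ q)) ⊗ (p ⊖ q) ⊕ r ⊗ r ⊕ # 2 ⊗ ((# 1 ⊕ # 2 ⊗ q ⊕ (p ⊖ q)) ⊗ r)) ⊕ # 1
        ⊗ (# 2 ⊗ (oddᵖ k ⊗ oddᵖ k) ⊖ (oddᵖ p ⊗ oddᵖ p ⊕ oddᵖ q ⊗ oddᵖ q ⊕ # 2 ⊗ r ⊗ (# 2 ⊗ r) ⊕ # 2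
        ⊗ (oddᵖ q ⊗ (# 2 ⊗ r)) ⊕ # 2 ⊗ (oddᵖ p ⊗ (# 2 ⊗ r))))) refl k p q r))

      go′ : (∃[ j ] x ≡ + 0 ℤ.+ + 2 ℤ.* j) ⊎ (∃[ j ] x ≡ 1+2[ j ]) → (∃[ l ] r ≡ + 0 ℤ.+ + 2 ℤ.* l)
        ⊎ (∃[ l ] r ≡ 1+2[ l ]) →
        1+2[ k ] ≡ 1+2[ b ] ⊎ 1+2[ k ] ≡ -[1+ 0 ] ℤ.* 1+2[ b ]
      -- Q is odd, so (Q + x) x is even whatever the parity of x, and `e₂′` then makes r² even.
      go′ x-parity (inj₂ (l , refl)) = ⊥-elim (1+2k≢0
        (proj₁ half ℤ.+ + 2 ℤ.* l ℤ.+ + 2 ℤ.* (l ℤ.* l) ℤ.+ (Q ℤ.+ x) ℤ.* 1+2[ l ] ℤ.- Q ℤ.*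
        (k ℤ.- q) ℤ.- (k ℤ.- q) ℤ.* (k ℤ.- q))
        (ℤ-use₁ -[1+ 0 ] e₂′ (ℤ-use₁ -[1+ 0 ] (proj₂ half)
          (ℤ-solve 6 (λ y x m l u v → # 1 ⊕ # 2 ⊗ (m ⊕ # 2 ⊗ l ⊕ # 2 ⊗ (l ⊗ l) ⊕ y ⊗ oddᵖ l ⊖ u ⊖ v)
          ⊜ # 0 ⊕ K (-[1+ 0 ]) ⊗ (# 2 ⊗ u ⊕ # 2 ⊗ v ⊖
          (y ⊗ x ⊕ oddᵖ l ⊗ oddᵖ l ⊕ # 2 ⊗ (y ⊗ oddᵖ l))) ⊕ K (-[1+ 0 ]) ⊗ (y ⊗ x ⊖ # 2 ⊗ m)) refl
          (Q ℤ.+ x) x (proj₁ half) l (Q ℤ.* (k ℤ.- q)) ((k ℤ.- q) ℤ.* (k ℤ.- q))))))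
        where
        half : ∃[ m ] (Q ℤ.+ x) ℤ.* x ≡ + 2 ℤ.* m
        half = [ (λ (j , x≡) → (Q ℤ.+ x) ℤ.* j , trans (cong ((Q ℤ.+ x) ℤ.*_) x≡)
          (ℤ-solve 2 (λ y j → y ⊗ evenᵖ j ⊜ # 2 ⊗ (y ⊗ j)) refl (Q ℤ.+ x) j)) ,
                 (λ (j , x≡) → (+ 1 ℤ.+ q ℤ.+ j) ℤ.* x , trans (cong (λ y → (Q ℤ.+ y) ℤ.* x) x≡)
                   (ℤ-solve 3 (λ q j x → (# 1 ⊕ # 2 ⊗ q ⊕ oddᵖ j) ⊗ x ⊜ # 2 ⊗ ((# 1 ⊕ q ⊕ j) ⊗ x))
                   refl q j x)) ]′ x-parity
      go′ x-parity (inj₁ (l , refl)) = [ even , odd ]′ x-parity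
        where
        E₁ : Q ℤ.* h ℤ.+ h ℤ.* h ≡ + 2 ℤ.* ((Q ℤ.+ + 2 ℤ.* x) ℤ.* l) ℤ.+ + 4 ℤ.* (l ℤ.* l)
        E₁ = ℤₚ.*-cancelˡ-≡ (+ 4) _ _ (ℤ-use₁ (+ 1) e₁
          (ℤ-solve 4 (λ b p q l → # 4 ⊗ (oddᵖ q ⊗ (b ⊖ q) ⊕ (b ⊖ q) ⊗ (b ⊖ q)) ⊜ # 4 ⊗
          (# 2 ⊗ ((# 1 ⊕ # 2 ⊗ q ⊕ # 2 ⊗ (p ⊖ q)) ⊗ l) ⊕ # 4 ⊗ (l ⊗ l)) ⊕ # 1 ⊗
          (oddᵖ b ⊗ oddᵖ b ⊖ (oddᵖ q ⊗ oddᵖ q ⊕ # 2 ⊗ (oddᵖ p ⊗ (# 2 ⊗ evenᵖ l)) ⊕ # 2 ⊗ evenᵖ l ⊗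
          (# 2 ⊗ evenᵖ l)))) refl b p q l))

        E₂ : + 2 ℤ.* (Q ℤ.* (h ℤ.+ d)) ℤ.+ + 2 ℤ.* ((h ℤ.+ d) ℤ.* (h ℤ.+ d)) ≡ Q ℤ.* x ℤ.+ x ℤ.* x
          ℤ.+ + 4 ℤ.* (l ℤ.* l) ℤ.+ + 4 ℤ.* ((Q ℤ.+ x) ℤ.* l)
        E₂ = ℤ-use₁ (+ 1) e₂′ (ℤ-solve 5 (λ b k p q l → # 2 ⊗ (oddᵖ q ⊗ (b ⊖ q ⊕ (k ⊖ b))) ⊕ # 2 ⊗
          ((b ⊖ q ⊕ (k ⊖ b)) ⊗ (b ⊖ q ⊕ (k ⊖ b))) ⊜ oddᵖ q ⊗ (p ⊖ q) ⊕ (p ⊖ q) ⊗ (p ⊖ q) ⊕ # 4 ⊗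
          (l ⊗ l) ⊕ # 4 ⊗ ((# 1 ⊕ # 2 ⊗ q ⊕ (p ⊖ q)) ⊗ l) ⊕ # 1 ⊗
          (# 2 ⊗ (oddᵖ q ⊗ (k ⊖ q)) ⊕ # 2 ⊗ ((k ⊖ q) ⊗ (k ⊖ q)) ⊖
          ((# 1 ⊕ # 2 ⊗ q ⊕ (p ⊖ q)) ⊗ (p ⊖ q) ⊕ evenᵖ l ⊗ evenᵖ l ⊕ # 2 ⊗
          ((# 1 ⊕ # 2 ⊗ q ⊕ (p ⊖ q)) ⊗ evenᵖ l)))) refl b k p q l)

        E₃ : + 2 ℤ.* (Q ℤ.* h) ℤ.+ + 2 ℤ.* (h ℤ.* h) ℤ.+ d ℤ.* Q ℤ.+ + 2 ℤ.* (d ℤ.* h) ≡ Q ℤ.* x ℤ.+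
          + 2 ℤ.* (Q ℤ.* l) ℤ.+ + 4 ℤ.* (l ℤ.* l)
        E₃ = ℤₚ.*-cancelˡ-≡ (+ 4) _ _ (ℤ-use₁ (+ 1) e₃
          (ℤ-solve 5 (λ b k p q l → # 4 ⊗ (# 2 ⊗ (oddᵖ q ⊗ (b ⊖ q)) ⊕ # 2 ⊗ ((b ⊖ q) ⊗ (b ⊖ q)) ⊕
          (k ⊖ b) ⊗ oddᵖ q ⊕ # 2 ⊗ ((k ⊖ b) ⊗ (b ⊖ q))) ⊜ # 4 ⊗
          (oddᵖ q ⊗ (p ⊖ q) ⊕ # 2 ⊗ (oddᵖ q ⊗ l) ⊕ # 4 ⊗ (l ⊗ l)) ⊕ # 1 ⊗
          (# 2 ⊗ (oddᵖ k ⊗ oddᵖ b) ⊖ (# 2 ⊗ (oddᵖ p ⊗ oddᵖ q) ⊕ # 2 ⊗ (oddᵖ q ⊗ (# 2 ⊗ evenᵖ l)) ⊕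
          # 2 ⊗ evenᵖ l ⊗ (# 2 ⊗ evenᵖ l)))) refl b k p q l))

        even : (∃[ j ] x ≡ + 0 ℤ.+ + 2 ℤ.* j) → 1+2[ k ] ≡ 1+2[ b ] ⊎ 1+2[ k ] ≡ -[1+ 0 ]
          ℤ.* 1+2[ b ]
        even (j , x≡) = inj₁ (ℤ-use₁ (+ 2) (Origins-θ.at-1 Q h x d l E₁ E₂ E₃
          (square-cong-2 ⟨ + 2 ℤ.* l ℤ.+ + 2 ℤ.* x , ℤ.- Q ℤ.- x , Q ℤ.- + 2 ℤ.* l ⟩
            ⟨ + 0 , + 1 , + 1 ⟩ θ
            (2∣⟨⟩ (l ℤ.+ x) (-[1+ 0 ] ℤ.- q ℤ.- j) (q ℤ.- l)
              (⟨⟩-cong (ℤ-solve 2 (λ l x → # 2 ⊗ l ⊕ # 2 ⊗ x ⊕ # 0 ⊜ # 2 ⊗ (l ⊕ x)) refl l x)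
                (trans (cong (λ x → ℤ.- Q ℤ.- x ℤ.+ -[1+ 0 ]) x≡)
                (ℤ-solve 2 (λ q j → ⊝ (oddᵖ q) ⊖ evenᵖ j ⊕ K (-[1+ 0 ]) ⊜ # 2 ⊗
                (K (-[1+ 0 ]) ⊖ q ⊖ j)) refl q j)) (ℤ-solve 2
                (λ q l → # 1 ⊕ # 2 ⊗ q ⊖ # 2 ⊗ l ⊕ K (-[1+ 0 ]) ⊜ # 2 ⊗ (q ⊖ l)) refl q l)))
            (⟨ + 1 , + 1 , + 1 ⟩ , refl))) (ℤ-solve 2
              (λ b k → # 1 ⊕ # 2 ⊗ k ⊜ # 1 ⊕ # 2 ⊗ b ⊕ # 2 ⊗ (k ⊖ b ⊖ # 0)) refl b k))

        odd : (∃[ j ] x ≡ 1+2[ j ]) → 1+2[ k ] ≡ 1+2[ b ] ⊎ 1+2[ k ] ≡ -[1+ 0 ] ℤ.* 1+2[ b ]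
        odd (j , x≡) = inj₂ (ℤ-use₁ (+ 2) (Origins-θ.at-[-1] Q h x d l E₁ E₂ E₃
          (square-cong-2 ⟨ ℤ.- (+ 2 ℤ.* Q) ℤ.- + 6 ℤ.* l ℤ.- + 2 ℤ.* x , ℤ.- x , Q ℤ.+ + 2 ℤ.* l ⟩
            ⟨ + 0 , + 1 , + 1 ⟩ θ
            (2∣⟨⟩ (ℤ.- Q ℤ.- + 3 ℤ.* l ℤ.- x) (-[1+ 0 ] ℤ.- j) (q ℤ.+ l)
              (⟨⟩-cong (ℤ-solve 3 (λ q l x → ⊝ (# 2 ⊗ q) ⊖ # 6 ⊗ l ⊖ # 2 ⊗ x ⊕ # 0 ⊜ # 2 ⊗
                (⊝ q ⊖ # 3 ⊗ l ⊖ x)) refl Q l x) (trans (cong (λ x → ℤ.- x ℤ.+ -[1+ 0 ]) x≡)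
                (ℤ-solve 1 (λ j → ⊝ (oddᵖ j) ⊕ K (-[1+ 0 ]) ⊜ # 2 ⊗ (K (-[1+ 0 ]) ⊖ j)) refl j))
                (ℤ-solve 2 (λ q l → # 1 ⊕ # 2 ⊗ q ⊕ # 2 ⊗ l ⊕ K (-[1+ 0 ]) ⊜ # 2 ⊗ (q ⊕ l)) refl q
                l)))
            (⟨ + 1 , + 1 , + 1 ⟩ , refl))) (ℤ-solve 3
              (λ b k q → # 1 ⊕ # 2 ⊗ k ⊜ K (-[1+ 0 ]) ⊗ oddᵖ b ⊕ # 2 ⊗
              (k ⊖ b ⊕ # 2 ⊗ (b ⊖ q) ⊕ oddᵖ q ⊖ # 0)) refl b k q))

  -- Integral points of the homogeneous sextic

  module Integral (a b Y u v : ℤ) (ua+vb≡1 : u ℤ.* a ℤ.+ v ℤ.* b ≡ + 1) (Y²≡ : Y ℤ.* Y ≡ sextic a b)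
    where
    open Curve a b Y u v ua+vb≡1 Y²≡

    oγ : Odd γ
    oγ = odd-β⇒odd-γ α⊥β (λ-expand a b) (G-expand a b) oβ

    Y≢0 : Y ≢ + 0
    Y≢0 refl = odd≢0 oγ (norm≡0⇒≡0 γ norm-γ)

    γ≡class*w² : ∃₂ λ i w → γ ≡ class i * w ²
    γ≡class*w² = conclude (coprime-squares γ⊥adj (Y≢0 ∘ ι-injective)
      (trans (*-adj γ) (trans (cong ι norm-γ) (ι-* Y Y))))
      where
      conclude : Squares γ (adj γ) (ι Y) → ∃₂ λ i w → γ ≡ class i * w ²
      conclude (squares ε ε′ m n εε′≡1 γ≡ _ _) = finish (unit⇒unitClass (ε′ , εε′≡1))
        where
        finish : UnitClass ε → ∃₂ λ i w → γ ≡ class i * w ²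
        finish (i , η , ε≡) = i , η * m , trans γ≡
          (trans (cong (_* (m ²)) ε≡) (solve 3 (λ c η m → c :* η :² :* m :² := c :* (η :* m) :²)
          refl (class i) η m))

    -- The norm of γ is Y², a positive number; this sign excludes the classes - 1 and - θ.
    norm-class : ∀ {c w} → norm c ≡ -[1+ 0 ] → γ ≢ c * w ²
    norm-class {c} {w} N≡-1 γ≡ = Y≢0 (nonneg-sum Y (norm w) (begin
      Y ℤ.* Y                            ≡⟨ norm-γ ⟨
      norm γ                             ≡⟨ cong norm γ≡ ⟩
      norm (c * w ²)                 ≡⟨ norm-* c (w ²) ⟩
      norm c ℤ.* norm (w ²)            ≡⟨ cong₂ ℤ._*_ N≡-1 (norm-* w w) ⟩
      -[1+ 0 ] ℤ.* (norm w ℤ.* norm w)   ≡⟨ ℤₚ.-1*i≡-i _ ⟩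
      ℤ.- (norm w ℤ.* norm w)            ∎))
      where
      nonneg-sum : ∀ y n → y ℤ.* y ≡ ℤ.- (n ℤ.* n) → y ≡ + 0
      nonneg-sum y n eq = [ id , id ]′ (ℤₚ.i*j≡0⇒i≡0∨j≡0 y (both (nonneg-² y) (nonneg-² n) eq))
        where
        both : ∀ {i j} → Nonneg i → Nonneg j → i ≡ ℤ.- j → i ≡ + 0
        both (nonneg refl) (nonneg {zero} refl) eq = eq
        both (nonneg refl) (nonneg {suc _} refl) ()

    b-odd : ∃[ k ] b ≡ 1+2[ k ]
    b-odd = [ (λ (k , b≡) → ⊥-elim (oβ (ι k , trans (cong ι (trans b≡ (ℤₚ.+-identityˡ _)))
      (ι-* (+ 2) k)))) , id ]′ (parity b)

    γ-1-even : 2# ∣ γ - 1#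
    γ-1-even = conclude b-odd
      where
      conclude : (∃[ k ] b ≡ 1+2[ k ]) → 2# ∣ γ - 1#
      conclude (k , b≡) = 2∣⟨⟩ (+ 2 ℤ.* k ℤ.+ + 2 ℤ.* (k ℤ.* k)) (a ℤ.* a) (a ℤ.* b)
        (⟨⟩-cong (trans (cong (λ b → b ℤ.* b ℤ.+ -[1+ 0 ]) b≡)
          (ℤ-solve 1 (λ k → (oddᵖ k) ⊗ oddᵖ k ⊕ K (-[1+ 0 ]) ⊜ # 2 ⊗ (# 2 ⊗ k ⊕ # 2 ⊗ (k ⊗ k))) refl
          k)) (ℤₚ.+-identityʳ _) (ℤₚ.+-identityʳ _))

    -- The residue of w modulo 2 is the square root of class i, as θ⁷ ≡ 1.
    w-residue : ∀ {c w w₀} → γ ≡ c * w ² → Odd c → 2# ∣ c * w₀ ² - 1# → 2# ∣ w - w₀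
    w-residue {c} {w} {w₀} γ≡ oc 2∣ = even-² (w - w₀) (even-cancel oc
      (subst (2# ∣_) (use₁ 1# γ≡ (solve 4 (λ γ c w w₀ → γ :- con 1# :+ (:- (c :* w₀ :² :- con 1#))
        :+ con 2# :* (:- (c :* (w :* w₀)) :+ c :* w₀ :²) := c :* ((w :- w₀) :* (w :- w₀)) :+ con 1#
        :* (γ :- c :* w :²)) refl γ c w w₀)) (∣-+ (∣-+ γ-1-even (∣-neg 2∣))
        (- (c * (w * w₀)) + c * w₀ ² , refl))))

    result : a ≡ -[1+ 1 ] ℤ.* b ⊎ a ≡ -[1+ 0 ] ℤ.* b ⊎ a ≡ + 0 ⊎ a ≡ b
    result = conclude γ≡class*w² b-odd
      where
      2∣-coords : ∀ {w} i j k → 2# ∣ w - ⟨ i , j , k ⟩ → ∃ λ ((p , q , r) : ℤ × ℤ × ℤ) →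
        w ≡ ⟨ i ℤ.+ + 2 ℤ.* p , j ℤ.+ + 2 ℤ.* q , k ℤ.+ + 2 ℤ.* r ⟩
      2∣-coords {w} i j k (⟨ p , q , r ⟩ , eq) = (p , q , r) ,
        trans (use₁ 1# eq (solve 3 (λ w x y → w := x :+ y :+ con 1# :* (w :- x :- y)) refl w
          ⟨ i , j , k ⟩ (2# * ⟨ p , q , r ⟩))) (sym (split-2 i j k p q r))

      conclude : (∃₂ λ i w → γ ≡ class i * w ²) → (∃[ k ] b ≡ 1+2[ k ]) → a ≡ -[1+ 1 ] ℤ.* b ⊎ a ≡
        -[1+ 0 ] ℤ.* b ⊎ a ≡ + 0 ⊎ a ≡ b
      conclude (1F , w , γ≡) _ = ⊥-elim (norm-class { - 1#} {w} refl γ≡)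
      conclude (3F , w , γ≡) _ = ⊥-elim (norm-class { - θ} {w} refl γ≡)
      conclude (0F , w , γ≡) (k , b≡) = finish (2∣-coords (+ 1) (+ 0) (+ 0)
        (w-residue {1#} {w} {1#} γ≡ (unit⇒odd (1# , refl)) (0# , refl)))
        where
        finish : (∃ λ ((p , q , r) : ℤ × ℤ × ℤ) → w ≡
          ⟨ + 1 ℤ.+ + 2 ℤ.* p , + 0 ℤ.+ + 2 ℤ.* q , + 0 ℤ.+ + 2 ℤ.* r ⟩) → a ≡ -[1+ 1 ] ℤ.* b ⊎ a ≡
          -[1+ 0 ] ℤ.* b ⊎ a ≡ + 0 ⊎ a ≡ b
        finish ((p , q , r) , w≡) = [ inj₂ ∘ inj₂ ∘ inj₁ ,
          (λ e → inj₁ (trans e (cong (-[1+ 1 ] ℤ.*_) (sym b≡)))) ]′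
          (case-1 a k p q r (subst₂ (λ b w → G a b ≡ w ²) b≡
            (trans w≡ (⟨⟩-cong refl (ℤₚ.+-identityˡ _) (ℤₚ.+-identityˡ _)))
              (trans γ≡ (*-identityˡ (w ²)))))
      conclude (2F , w , γ≡) (k , b≡) = finish (2∣-coords (+ 1) (+ 1) (+ 0)
        (w-residue {θ} {w} {⟨ + 1 , + 1 , + 0 ⟩} γ≡ (unit⇒odd (ρ , refl))
        (⟨ + 0 , + 1 , + 1 ⟩ , refl)))
        where
        finish : (∃ λ ((p , q , r) : ℤ × ℤ × ℤ) → w ≡
          ⟨ + 1 ℤ.+ + 2 ℤ.* p , + 1 ℤ.+ + 2 ℤ.* q , + 0 ℤ.+ + 2 ℤ.* r ⟩) → a ≡ -[1+ 1 ] ℤ.* b ⊎ a ≡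
          -[1+ 0 ] ℤ.* b ⊎ a ≡ + 0 ⊎ a ≡ b
        finish ((p , q , r) , w≡) = [ (λ e → inj₂ (inj₂ (inj₂ (trans e (sym b≡))))) ,
          (λ e → inj₂ (inj₁ (trans e (cong (-[1+ 0 ] ℤ.*_) (sym b≡))))) ]′
          (case-θ a k p q r (subst₂ (λ b w → G a b ≡ θ * w ²) b≡
            (trans w≡ (⟨⟩-cong refl refl (ℤₚ.+-identityˡ _))) γ≡))

-- Passage from the rational numbers to the integers

open import Defs
open import Data.Rational using (ℚ; _*_; -_)
open import Data.Rational using (mkℚ; ↥_; ↧_; _+_; _-_; toℚᵘ)
private module A = Arithmetic
open Arithmetic using (ℤ[θ]; ⟨_,_,_⟩; ι)

toℚᵘ-q : ∀ i → toℚᵘ (q i) ℚᵘ.≃ mkℚᵘ i 0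
toℚᵘ-q i = ℚₚ.toℚᵘ-fromℚᵘ (mkℚᵘ i 0)

q-injective : ∀ {i j} → q i ≡ q j → i ≡ j
q-injective {i} {j} eq with ℚᵘₚ.≃-trans (ℚᵘₚ.≃-sym (toℚᵘ-q i))
  (ℚᵘₚ.≃-trans (ℚₚ.toℚᵘ-cong eq) (toℚᵘ-q j))
... | *≡* i*1≡j*1 = trans (sym (ℤₚ.*-identityʳ i)) (trans i*1≡j*1 (ℤₚ.*-identityʳ j))

q-+ : ∀ i j → q (i ℤ.+ j) ≡ q i + q j
q-+ i j = ℚₚ.toℚᵘ-injective (ℚᵘₚ.≃-trans (toℚᵘ-q (i ℤ.+ j))
  (ℚᵘₚ.≃-trans (*≡* (ℤ-solve 2 (λ i j → (i ⊕ j) ⊗ # 1 ⊜ (i ⊗ # 1 ⊕ j ⊗ # 1) ⊗ # 1) refl i j))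
  (ℚᵘₚ.≃-trans (ℚᵘₚ.+-cong (ℚᵘₚ.≃-sym (toℚᵘ-q i)) (ℚᵘₚ.≃-sym (toℚᵘ-q j)))
    (ℚᵘₚ.≃-sym (ℚₚ.toℚᵘ-homo-+ (q i) (q j))))))

q-* : ∀ i j → q (i ℤ.* j) ≡ q i * q j
q-* i j = ℚₚ.toℚᵘ-injective (ℚᵘₚ.≃-trans (toℚᵘ-q (i ℤ.* j)) (ℚᵘₚ.≃-trans (*≡* refl)
  (ℚᵘₚ.≃-trans (ℚᵘₚ.*-cong (ℚᵘₚ.≃-sym (toℚᵘ-q i)) (ℚᵘₚ.≃-sym (toℚᵘ-q j)))
    (ℚᵘₚ.≃-sym (ℚₚ.toℚᵘ-homo-* (q i) (q j))))))

q-neg : ∀ i → q (ℤ.- i) ≡ - q i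
q-neg i = ℚₚ.toℚᵘ-injective (ℚᵘₚ.≃-trans (toℚᵘ-q (ℤ.- i))
  (ℚᵘₚ.≃-trans (ℚᵘₚ.-‿cong (ℚᵘₚ.≃-sym (toℚᵘ-q i))) (ℚᵘₚ.≃-sym (ℚₚ.toℚᵘ-homo‿- (q i)))))

x*↧x≡↥x : ∀ x → x * q (↧ x) ≡ q (↥ x)
x*↧x≡↥x x@(mkℚ n d-1 _) = ℚₚ.toℚᵘ-injective (ℚᵘₚ.≃-trans (ℚₚ.toℚᵘ-homo-* x (q (↧ x)))
  (ℚᵘₚ.≃-trans (ℚᵘₚ.*-cong (ℚᵘₚ.≃-refl {mkℚᵘ n d-1}) (toℚᵘ-q (↧ x)))
    (ℚᵘₚ.≃-trans (*≡* eq) (ℚᵘₚ.≃-sym (toℚᵘ-q n)))))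
  where
  eq : n ℤ.* + suc d-1 ℤ.* + 1 ≡ n ℤ.* + (suc d-1 ℕ.* 1)
  eq = trans (ℤₚ.*-identityʳ (n ℤ.* + suc d-1))
    (cong (λ m → n ℤ.* + m) (sym (ℕₚ.*-identityʳ (suc d-1))))

↥≡k*↧⇒≡q : ∀ x k → ↥ x ≡ k ℤ.* ↧ x → x ≡ q k
↥≡k*↧⇒≡q x@(mkℚ n d-1 _) k eq = ℚₚ.toℚᵘ-injective
  (ℚᵘₚ.≃-trans (*≡* (trans (ℤₚ.*-identityʳ n) eq)) (ℚᵘₚ.≃-sym (toℚᵘ-q k)))

bézout-ℤ : ∀ x → ∃₂ λ u v → u ℤ.* ↥ x ℤ.+ v ℤ.* ↧ x ≡ + 1
bézout-ℤ (mkℚ n d-1 c) = signed (ℤₚ.+∣i∣≡i⊎+∣i∣≡-i n)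
  (natural (coprime-Bézout (recompute (coprime? (abs n) (suc d-1)) c)))
  where
  d = + suc d-1
  natural : ℕ-Bézout.Identity 1 (abs n) (suc d-1) → ∃₂ λ u v → u ℤ.* + abs n ℤ.+ v ℤ.* d ≡ + 1
  natural (ℕ-Bézout.+- x y eq) = + x , ℤ.- + y , (begin
    + x ℤ.* + abs n ℤ.+ ℤ.- + y ℤ.* d         ≡⟨ cong (ℤ._+ ℤ.- + y ℤ.* d) (ℤₚ.pos-* x (abs n)) ⟨
    + (x ℕ.* abs n) ℤ.+ ℤ.- + y ℤ.* d         ≡⟨ cong (λ m → + m ℤ.+ ℤ.- + y ℤ.* d) eq ⟨
    + 1 ℤ.+ + (y ℕ.* suc d-1) ℤ.+ ℤ.- + y ℤ.* d ≡⟨ cong (λ m → + 1 ℤ.+ m ℤ.+ ℤ.- + y ℤ.* d)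
      (ℤₚ.pos-* y (suc d-1)) ⟩
    + 1 ℤ.+ + y ℤ.* d ℤ.+ ℤ.- + y ℤ.* d       ≡⟨ h (+ y) d ⟩
    + 1                                       ∎)
    where
    h : ∀ y d → + 1 ℤ.+ y ℤ.* d ℤ.+ ℤ.- y ℤ.* d ≡ + 1
    h = ℤ-solve 2 (λ y d → # 1 ⊕ y ⊗ d ⊕ ⊝ y ⊗ d ⊜ # 1) refl
  natural (ℕ-Bézout.-+ x y eq) = ℤ.- + x , + y , (begin
    ℤ.- + x ℤ.* + abs n ℤ.+ + y ℤ.* d         ≡⟨ cong (λ m → ℤ.- + x ℤ.* + abs n ℤ.+ m)
      (ℤₚ.pos-* y (suc d-1)) ⟨
    ℤ.- + x ℤ.* + abs n ℤ.+ + (y ℕ.* suc d-1) ≡⟨ cong (λ m → ℤ.- + x ℤ.* + abs n ℤ.+ + m) eq ⟨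
    ℤ.- + x ℤ.* + abs n ℤ.+ (+ 1 ℤ.+ + (x ℕ.* abs n))
      ≡⟨ cong (λ m → ℤ.- + x ℤ.* + abs n ℤ.+ (+ 1 ℤ.+ m)) (ℤₚ.pos-* x (abs n)) ⟩
    ℤ.- + x ℤ.* + abs n ℤ.+ (+ 1 ℤ.+ + x ℤ.* + abs n) ≡⟨ h (+ x) (+ abs n) ⟩
    + 1                                       ∎)
    where
    h : ∀ x n → ℤ.- x ℤ.* n ℤ.+ (+ 1 ℤ.+ x ℤ.* n) ≡ + 1
    h = ℤ-solve 2 (λ x n → ⊝ x ⊗ n ⊕ (# 1 ⊕ x ⊗ n) ⊜ # 1) refl
  signed : + abs n ≡ n ⊎ + abs n ≡ ℤ.- n → (∃₂ λ u v → u ℤ.* + abs n ℤ.+ v ℤ.* d ≡ + 1) → ∃₂ λ u v →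
    u ℤ.* n ℤ.+ v ℤ.* d ≡ + 1
  signed (inj₁ ∣n∣≡n)  (u , v , eq) = u , v , subst (λ m → u ℤ.* m ℤ.+ v ℤ.* d ≡ + 1) ∣n∣≡n eq
  signed (inj₂ ∣n∣≡-n) (u , v , eq) = ℤ.- u , v , trans
    (ℤ-solve 4 (λ u v n d → ⊝ u ⊗ n ⊕ v ⊗ d ⊜ u ⊗ ⊝ n ⊕ v ⊗ d) refl u v n d)
    (subst (λ m → u ℤ.* m ℤ.+ v ℤ.* d ≡ + 1) ∣n∣≡-n eq)

infix  4 _⟼_
infixl 6 _⟨+⟩_ _⟨-⟩_
infixl 7 _⟨*⟩_

-- q is a ring homomorphism, in a form that transports whole expressions.
record _⟼_ (i : ℤ) (r : ℚ) : Set where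
  constructor maps
  field proof : q i ≡ r

con : ∀ i → i ⟼ q i
con i = maps refl

_⟨+⟩_ : ∀ {i j r s} → i ⟼ r → j ⟼ s → i ℤ.+ j ⟼ r + s
_⟨+⟩_ {i} {j} (maps i⟼r) (maps j⟼s) = maps (trans (q-+ i j) (cong₂ _+_ i⟼r j⟼s))

_⟨-⟩_ : ∀ {i j r s} → i ⟼ r → j ⟼ s → i ℤ.- j ⟼ r - s
_⟨-⟩_ {i} {j} (maps i⟼r) (maps j⟼s) = maps (trans (q-+ i (ℤ.- j))
  (cong₂ _+_ i⟼r (trans (q-neg j) (cong -_ j⟼s))))

_⟨*⟩_ : ∀ {i j r s} → i ⟼ r → j ⟼ s → i ℤ.* j ⟼ r * s
_⟨*⟩_ {i} {j} (maps i⟼r) (maps j⟼s) = maps (trans (q-* i j) (cong₂ _*_ i⟼r j⟼s))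

sextic-q : ∀ a b → q (A.sextic a b) ≡
  let α = q a ; β = q b in
  q (+ 8) * (α * α * α * α * α * α) - q (+ 12) * (α * α * α * α * β * β) - q (+ 4) *
    (α * α * α * β * β * β)
  + q (+ 4) * (α * α * β * β * β * β) + q (+ 4) * (α * β * β * β * β * β) + β * β * β * β * β * β
sextic-q a b = _⟼_.proof (
  con (+ 8) ⟨*⟩ (α ⟨*⟩ α ⟨*⟩ α ⟨*⟩ α ⟨*⟩ α ⟨*⟩ α) ⟨-⟩ con (+ 12) ⟨*⟩
    (α ⟨*⟩ α ⟨*⟩ α ⟨*⟩ α ⟨*⟩ β ⟨*⟩ β)
  ⟨-⟩ con (+ 4) ⟨*⟩ (α ⟨*⟩ α ⟨*⟩ α ⟨*⟩ β ⟨*⟩ β ⟨*⟩ β) ⟨+⟩ con (+ 4) ⟨*⟩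
    (α ⟨*⟩ α ⟨*⟩ β ⟨*⟩ β ⟨*⟩ β ⟨*⟩ β)
  ⟨+⟩ con (+ 4) ⟨*⟩ (α ⟨*⟩ β ⟨*⟩ β ⟨*⟩ β ⟨*⟩ β ⟨*⟩ β) ⟨+⟩ β ⟨*⟩ β ⟨*⟩ β ⟨*⟩ β ⟨*⟩ β ⟨*⟩ β)
  where
  α = con a
  β = con b

clear-denominators : ∀ x y → y * y ≡ f x →
  let a = ↥ x ; b = ↧ x ; n = ↥ y ; d = ↧ y in
  (n ℤ.* (b ℤ.* b ℤ.* b)) ℤ.* (n ℤ.* (b ℤ.* b ℤ.* b)) ≡ d ℤ.* d ℤ.* A.sextic a b
clear-denominators x y y²≡fx = q-injective (begin
  q (n ℤ.* (b ℤ.* b ℤ.* b) ℤ.* (n ℤ.* (b ℤ.* b ℤ.* b)))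
    ≡⟨ _⟼_.proof (con n ⟨*⟩ (con b ⟨*⟩ con b ⟨*⟩ con b) ⟨*⟩ (con n ⟨*⟩ (con b ⟨*⟩ con b ⟨*⟩ con b)))
      ⟩
  q n * (B * B * B) * (q n * (B * B * B))
    ≡⟨ cong (λ n → n * (B * B * B) * (n * (B * B * B))) (sym (x*↧x≡↥x y)) ⟩
  y * D * (B * B * B) * (y * D * (B * B * B))
    ≡⟨ lhs y B D ⟩
  y * y * (D * D * (B * B * B * B * B * B))
    ≡⟨ cong (_* (D * D * (B * B * B * B * B * B))) y²≡fx ⟩
  f x * (D * D * (B * B * B * B * B * B))
    ≡⟨ rhs x B D ⟩
  D * D * (let α = x * B in q (+ 8) * (α * α * α * α * α * α) - q (+ 12) * (α * α * α * α * B * B)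
    - q (+ 4) * (α * α * α * B * B * B)
    + q (+ 4) * (α * α * B * B * B * B) + q (+ 4) * (α * B * B * B * B * B) + B * B * B * B * B * B)
    ≡⟨ cong (λ α → D * D * (q (+ 8) * (α * α * α * α * α * α) - q (+ 12) * (α * α * α * α * B * B)
      - q (+ 4) * (α * α * α * B * B * B)
    + q (+ 4) * (α * α * B * B * B * B) + q (+ 4) * (α * B * B * B * B * B) + B * B * B * B * B *
      B)) (x*↧x≡↥x x) ⟩
  D * D * _
    ≡⟨ cong₂ _*_ (_⟼_.proof (con d ⟨*⟩ con d)) (sextic-q a b) ⟨
  q (d ℤ.* d) * q (A.sextic a b)
    ≡⟨ q-* (d ℤ.* d) (A.sextic a b) ⟨
  q (d ℤ.* d ℤ.* A.sextic a b) ∎)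
  where
  a = ↥ x ; b = ↧ x ; n = ↥ y ; d = ↧ y
  B = q b
  D = q d
  open ℚ-Solver using (solve; _:+_; _:*_; _:-_; _:=_) renaming (con to κℚ)
  lhs : ∀ y B D → y * D * (B * B * B) * (y * D * (B * B * B)) ≡ y * y *
    (D * D * (B * B * B * B * B * B))
  lhs = solve 3 (λ y B D → y :* D :* (B :* B :* B) :* (y :* D :* (B :* B :* B)) := y :* y :*
    (D :* D :* (B :* B :* B :* B :* B :* B))) refl
  rhs : ∀ x B D → f x * (D * D * (B * B * B * B * B * B)) ≡ D * D *
    (let α = x * B in q (+ 8) * (α * α * α * α * α * α) - q (+ 12) * (α * α * α * α * B * B) - q
    (+ 4) * (α * α * α * B * B * B)
    + q (+ 4) * (α * α * B * B * B * B) + q (+ 4) * (α * B * B * B * B * B) + B * B * B * B * B * B)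
  rhs = solve 3 (λ x B D → (κℚ (q (+ 8)) :* (x :* x :* x :* x :* x :* x) :- κℚ (q (+ 12)) :*
    (x :* x :* x :* x) :- κℚ (q (+ 4)) :* (x :* x :* x)
    :+ κℚ (q (+ 4)) :* (x :* x) :+ κℚ (q (+ 4)) :* x :+ κℚ (q (+ 1))) :*
      (D :* D :* (B :* B :* B :* B :* B :* B)) := D :* D :* (let α = x :* B in
    κℚ (q (+ 8)) :* (α :* α :* α :* α :* α :* α) :- κℚ (q (+ 12)) :* (α :* α :* α :* α :* B :* B) :-
      κℚ (q (+ 4)) :* (α :* α :* α :* B :* B :* B)
    :+ κℚ (q (+ 4)) :* (α :* α :* B :* B :* B :* B) :+ κℚ (q (+ 4)) :* (α :* B :* B :* B :* B :* B)
      :+ B :* B :* B :* B :* B :* B)) refl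

-- A rational number whose square is an integer is an integer; here m = n b³.
integral-root : ∀ m d s → d ≢ + 0 → m ℤ.* m ≡ d ℤ.* d ℤ.* s → ∃[ Y ] Y ℤ.* Y ≡ s
integral-root m d s d≢0 m²≡d²s = conclude (A.x²∣y²⇒x∣y (ι d) (ι m) (d≢0 ∘ A.ι-injective)
  (ι s , (begin
  ι m A.* ι m             ≡⟨ A.ι-* m m ⟨
  ι (m ℤ.* m)             ≡⟨ cong ι m²≡d²s ⟩
  ι (d ℤ.* d ℤ.* s)       ≡⟨ A.ι-* (d ℤ.* d) s ⟩
  ι (d ℤ.* d) A.* ι s     ≡⟨ cong (A._* ι s) (A.ι-* d d) ⟩
  ι d A.* ι d A.* ι s     ∎)))
  where
  conclude : ι d A.∣ ι m → ∃[ Y ] Y ℤ.* Y ≡ s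
  conclude (⟨ Y , _ , _ ⟩ , eq) = Y , cancel (trans
    (ℤ-solve 2 (λ d Y → d ⊗ d ⊗ (Y ⊗ Y) ⊜ d ⊗ Y ⊗ (d ⊗ Y)) refl d Y)
    (trans (cong₂ ℤ._*_ (sym m≡dY) (sym m≡dY)) m²≡d²s))
    where
    -- The division takes place in ℤ[θ]; as m and d are rational integers, the constant coordinate
    -- of the quotient is the integer sought.
    m≡dY : m ≡ d ℤ.* Y
    m≡dY = proj₁ (A.⟨⟩-injective (trans eq (A.ι-*-⟨⟩ d Y _ _)))
    cancel : d ℤ.* d ℤ.* (Y ℤ.* Y) ≡ d ℤ.* d ℤ.* s → Y ℤ.* Y ≡ s
    cancel = ℤₚ.*-cancelˡ-≡ (d ℤ.* d) (Y ℤ.* Y) s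
      {{ℤ.≢-nonZero λ d²≡0 → [ d≢0 , d≢0 ]′ (ℤₚ.i*j≡0⇒i≡0∨j≡0 d d²≡0)}}

theorem1p5 : (x y : ℚ) → y * y ≡ f x →
    x ≡ - q (+ 2) ⊎ x ≡ - q (+ 1) ⊎ x ≡ q (+ 0) ⊎ x ≡ q (+ 1)
theorem1p5 x y y²≡fx = conclude (bézout-ℤ x) (integral-root (↥ y ℤ.* (↧ x ℤ.* ↧ x ℤ.* ↧ x)) (↧ y)
  (A.sextic (↥ x) (↧ x)) (λ ()) (clear-denominators x y y²≡fx))
  where
  conclude : (∃₂ λ u v → u ℤ.* ↥ x ℤ.+ v ℤ.* ↧ x ≡ + 1) → (∃[ Y ] Y ℤ.* Y ≡ A.sextic (↥ x) (↧ x)) →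
    x ≡ - q (+ 2) ⊎ x ≡ - q (+ 1) ⊎ x ≡ q (+ 0) ⊎ x ≡ q (+ 1)
  conclude (u , v , eq) (Y , Y²≡) = Sum.map (↥≡k*↧⇒≡q x -[1+ 1 ]) (Sum.map (↥≡k*↧⇒≡q x -[1+ 0 ])
    (Sum.map (λ a≡0 → ↥≡k*↧⇒≡q x (+ 0) (trans a≡0 (sym (ℤₚ.*-zeroˡ (↧ x)))))
      (λ a≡b → ↥≡k*↧⇒≡q x (+ 1) (trans a≡b (sym (ℤₚ.*-identityˡ (↧ x)))))))
    (A.Integral.result (↥ x) (↧ x) Y u v eq Y²≡)
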